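{- Let $p$ be an odd prime with $p\not\equiv\pm1\pmod 8$, let $\delta_p$ be an integer with $8\delta_p\equiv1\pmod{p^2}$, and let $k,n\in\mathbb Z$ with $\left(\frac{k}{p}\right)=1$. Then $$v(p^2n+(pk-7)\delta_p)\equiv 0\pmod 4.$$
   Context: A sequence of integers $a_1,\dots,a_s$ is unimodal of size $n$ if $0<a_1\le\cdots\le a_{k-1}<a_k>a_{k+1}\ge\cdots\ge a_s>0$ for some $k$ and $a_1+\cdots+a_s=n$. It is odd-balanced if the peak $a_k$ is even, the even parts to the left of the peak are distinct, the even parts to the right of the peak are distinct, and the odd parts to the left of the peak are identical (as a multiset) to the odd parts to the right. Let $v(n)$ be the number of odd-balanced unimodal sequences of size $2n+2$; equivalently $\sum_{n\ge0}v(n)q^n=\sum_{n\ge0}\frac{(-q;q)_n^2q^n}{(q;q^2)_{n+1}}$, where $(a;q)_n=\prod_{j=0}^{n-1}(1-aq^j)$. Convention: $v(m)=0$ for $m<0$. $\left(\frac{\cdot}{\cdot}\right)$ is the Kronecker symbol. -}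

module Defs where

open import Data.Nat as ℕ using (ℕ; zero; suc; _%_; _∸_)
open import Data.Nat.Properties using (_≟_)
open import Data.Integer as ℤ using (ℤ; +_; -[1+_])
open import Data.Integer.DivMod using (_%ℕ_)
open import Data.List using (List; upTo)
open import Data.Bool.ListAction using (any)
open import Data.Bool using (Bool; true; false; if_then_else_)
open import Relation.Nullary.Decidable using (⌊_⌋)

Series : Set
Series = ℕ → ℤ

sumTo : ℕ → (ℕ → ℤ) → ℤ
sumTo zero    f = f zero
sumTo (suc m) f = sumTo m f ℤ.+ f (suc m)

one : Series
one zero    = + 1
one (suc _) = + 0

_⊛_ : Series → Series → Series
(f ⊛ g) m = sumTo m (λ i → f i ℤ.* g (m ∸ i))

shift : ℕ → Series → Series
shift n f m = if ⌊ n ℕ.≤? m ⌋ then f (m ∸ n) else + 0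

onePlusQ : ℕ → Series
onePlusQ d zero    = + 1 ℤ.+ (if ⌊ d ≟ 0 ⌋ then + 1 else + 0)
onePlusQ d (suc m) = if ⌊ d ≟ suc m ⌋ then + 1 else + 0

-- 1 / (1 - q^(2j+1)) = Σ_t q^((2j+1)t)
geomOdd : ℕ → Series
geomOdd j m = if ⌊ m % suc (2 ℕ.* j) ≟ 0 ⌋ then + 1 else + 0

negQPoch : ℕ → Series
negQPoch zero    = one
negQPoch (suc n) = negQPoch n ⊛ onePlusQ (suc n)

-- 1/(q;q^2)_{n+1} = Π_{j=0}^{n} 1/(1 - q^(2j+1))
invQQ2 : ℕ → Series
invQQ2 zero    = geomOdd zero
invQQ2 (suc n) = invQQ2 n ⊛ geomOdd (suc n)

term : ℕ → Series
term n = (negQPoch n ⊛ negQPoch n) ⊛ shift n (invQQ2 n)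

-- v(m) = coefficient of q^m in Σ_{n≥0} term n; summands with n > m have no q^m term.
vℕ : ℕ → ℤ
vℕ m = sumTo m (λ n → term n m)

v : ℤ → ℤ
v (+ m)      = vℕ m
v -[1+ _ ]   = + 0

-- Legendre symbol (k / p) for p = suc p' (used only for odd primes p, where it
-- coincides with the Kronecker symbol): 0 if p ∣ k, 1 if k is a nonzero square
-- mod p, -1 otherwise.
legendre : ℤ → ℕ → ℤ
legendre k zero     = + 0
legendre k (suc p') with k %ℕ suc p'
... | zero  = + 0
... | suc r = if any (λ x → ⌊ (x ℕ.* x) % suc p' ≟ suc r ⌋) (upTo (suc p'))
                then + 1 else ℤ.- (+ 1)

{-# OPTIONS --safe #-}
-- Modulo 4 we have (-q;q)_n² ≡ (q;q)_n², since (1+x)² = (1-x)² + 4x.  A Bailey pair relative to a = q² then gives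
--   Σ_n (q;q)_n² q^n / (q;q²)_{n+1} = Σ_r (-1)^r q^{r²+2r} (1+q^{r+1})/(1-q^{r+1}) Σ_{j≤r} q^{-j(j+1)/2}.
-- Putting y = r+1 and b = 2j+1, the coefficient of q^N counts, up to sign, the forms 2yX² + bXY + zY² with
-- 8yz - b² = 8N+7 and 0 < b < 2y ≤ 2z: once if y = z and twice if y < z.
--
-- In the theorem 8N+7 = pM with p ∤ M and M a square modulo p, while 2 is not a square modulo p.  Hence y = z is
-- impossible, v(N) is twice the number of forms with y < z, and that number must be shown to be even.  With the sign of
-- b normalised to b ≡ 1 (mod 4), these forms represent the classes of all forms of this shape under Γ₀(2) extended by
-- the exchange of y and z.  The Atkin–Lehner involution at p acts on the classes.  It has no fixed point: composed with
-- the exchange it would make 2 a square modulo p, and otherwise an elliptic automorph would make M ≡ 1 (mod 8) and so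
-- p ≡ 7 (mod 8).
module Submission where

-- The q-identity rests on no general Bailey lemma: the pair and the conjugate sum each satisfy a
-- first-order recurrence, and explicit antidifferences prove both.
--
-- On the side of forms, a translation X ↦ X + kY changes b by 4yk, so b modulo 4 survives it, and
-- exactly one of ±b is ≡ 1. This turns the condition 0 < b < 2y into -2y < b < 2y, a fundamental
-- strip for translations. The walls of the fundamental domain carry no forms: b = ±2y fails because
-- b is odd, y = z because 2 is not a square modulo p. So every class contains exactly one reduced
-- form, and counting forms is counting classes without weights.
--
-- The discriminant is divisible by p, so modulo p each form is a multiple of the square of a linear
-- form. Moving that linear form to Y brings the form to the shape (py, z, pb), and the involution
-- sends it to (pz, y, pb). The representative is not canonical and only the class of the image is
-- determined. Hence the involution is carried by a relation between reduced forms, and parity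
-- follows from a perfect matching. An equivalence is of two kinds, with or without the exchange of
-- y and z, and each kind needs its own obstruction to a fixed point.

-- Triangular numbers and the exponents of the double sum

module Triangular where

  open import Data.Nat as ℕ using (ℕ; zero; suc)
  import Data.Nat.Properties as ℕₚ
  open import Data.Nat.Tactic.RingSolver using (solve-∀)
  open import Relation.Binary.PropositionalEquality as ≡ using (_≡_; cong)

  tri : ℕ → ℕ
  tri zero    = 0
  tri (suc r) = suc r ℕ.+ tri r

  -- The subtraction is exact for j ≤ r.
  E : ℕ → ℕ → ℕ
  E r j = r ℕ.* (2 ℕ.+ r) ℕ.∸ tri j

  tri-double : ∀ r → tri r ℕ.+ tri r ≡ r ℕ.* suc r
  tri-double zero    = ≡.refl
  tri-double (suc r) = ≡.trans (regroup r (tri r)) (≡.trans (cong (suc r ℕ.+ suc r ℕ.+_) (tri-double r)) (expand r))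
    where
    regroup : ∀ r a → suc r ℕ.+ a ℕ.+ (suc r ℕ.+ a) ≡ suc r ℕ.+ suc r ℕ.+ (a ℕ.+ a)
    regroup = solve-∀
    expand : ∀ r → suc r ℕ.+ suc r ℕ.+ r ℕ.* suc r ≡ suc r ℕ.* suc (suc r)
    expand = solve-∀

  tri-mono : ∀ {j r} → j ℕ.≤ r → tri j ℕ.≤ tri r
  tri-mono ℕ.z≤n       = ℕ.z≤n
  tri-mono (ℕ.s≤s j≤r) = ℕₚ.+-mono-≤ (ℕ.s≤s j≤r) (tri-mono j≤r)

  tri≤ : ∀ {j r} → j ℕ.≤ r → tri j ℕ.≤ r ℕ.* (2 ℕ.+ r)
  tri≤ {j} {r} j≤r = ℕₚ.≤-trans (tri-mono j≤r) (ℕₚ.≤-trans (ℕₚ.m≤m+n (tri r) (tri r))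
    (ℕₚ.≤-trans (ℕₚ.≤-reflexive (tri-double r)) (ℕₚ.*-monoʳ-≤ r (ℕₚ.n≤1+n (suc r)))))

  -- With y = r+1 one has r(r+2) = y² - 1, so `E r j` is the N for which 8y² - (2j+1)² = 8N+7, the
  -- case y = z.
  E-tri : ∀ {j r} → j ℕ.≤ r → E r j ℕ.+ tri j ≡ r ℕ.* (2 ℕ.+ r)
  E-tri j≤r = ℕₚ.m∸n+n≡m (tri≤ j≤r)

  E-suc : ∀ {j r} → j ℕ.≤ r → E (suc r) j ≡ 3 ℕ.+ (r ℕ.+ r) ℕ.+ E r j
  E-suc {j} {r} j≤r = ≡.trans (cong (ℕ._∸ tri j) (expand r)) (ℕₚ.+-∸-assoc (3 ℕ.+ (r ℕ.+ r)) (tri≤ j≤r))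
    where
    expand : ∀ r → suc r ℕ.* (2 ℕ.+ suc r) ≡ 3 ℕ.+ (r ℕ.+ r) ℕ.+ r ℕ.* (2 ℕ.+ r)
    expand = solve-∀

  E-diagonal : ∀ r → E r r ≡ r ℕ.+ tri r
  E-diagonal r = ℕₚ.+-cancelʳ-≡ (tri r) _ _ (≡.trans (E-tri (ℕₚ.≤-refl {r}))
    (≡.trans (expand r) (≡.trans (cong (r ℕ.+_) (≡.sym (tri-double r))) (≡.sym (ℕₚ.+-assoc r (tri r) (tri r))))))
    where
    expand : ∀ r → r ℕ.* (2 ℕ.+ r) ≡ r ℕ.+ r ℕ.* suc r
    expand = solve-∀

-- Formal power series modulo 4 and their truncations

module PowerSeries where

  open import Defs
  open import Algebra.Bundles using (CommutativeRing)
  open import Algebra.Structures using (IsCommutativeRing)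
  open import Data.Nat as ℕ using (ℕ; zero; suc; _∸_; z≤n)
  import Data.Nat.Properties as ℕₚ
  open import Data.Integer as ℤ using (ℤ; +_)
  import Data.Integer.Properties as ℤₚ
  open import Data.Integer.Tactic.RingSolver using (solve-∀)
  open import Data.Product using (_,_)
  open import Function using (_∘_)
  open import Level using (0ℓ)
  open import Relation.Binary using (IsEquivalence)
  open import Relation.Binary.PropositionalEquality


  infix 4 _≡₄_
  -- As a record type it is injective in its indices, so both sides can be inferred from a proof.
  record _≡₄_ (a b : ℤ) : Set where
    constructor _,_
    field
      quotient₄ : ℤ
      equality₄ : a ≡ b ℤ.+ + 4 ℤ.* quotient₄

  ≡₄-refl : ∀ {a} → a ≡₄ a
  ≡₄-refl {a} = + 0 , lem a
    where
      lem : ∀ a → a ≡ a ℤ.+ + 4 ℤ.* + 0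
      lem = solve-∀

  ≡⇒≡₄ : ∀ {a b} → a ≡ b → a ≡₄ b
  ≡⇒≡₄ refl = ≡₄-refl

  ≡₄-sym : ∀ {a b} → a ≡₄ b → b ≡₄ a
  ≡₄-sym {b = b} (c , refl) = ℤ.- c , lem b c
    where
      lem : ∀ b c → b ≡ b ℤ.+ + 4 ℤ.* c ℤ.+ + 4 ℤ.* (ℤ.- c)
      lem = solve-∀

  ≡₄-trans : ∀ {a b c} → a ≡₄ b → b ≡₄ c → a ≡₄ c
  ≡₄-trans {c = c} (d , refl) (e , refl) = d ℤ.+ e , lem c d e
    where
      lem : ∀ c d e → c ℤ.+ + 4 ℤ.* e ℤ.+ + 4 ℤ.* d ≡ c ℤ.+ + 4 ℤ.* (d ℤ.+ e)
      lem = solve-∀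

  ≡₄-+ : ∀ {a b c d} → a ≡₄ b → c ≡₄ d → a ℤ.+ c ≡₄ b ℤ.+ d
  ≡₄-+ {b = b} {d = d} (m , refl) (n , refl) = m ℤ.+ n , lem b d m n
    where
      lem : ∀ b d m n → b ℤ.+ + 4 ℤ.* m ℤ.+ (d ℤ.+ + 4 ℤ.* n) ≡ b ℤ.+ d ℤ.+ + 4 ℤ.* (m ℤ.+ n)
      lem = solve-∀

  ≡₄-* : ∀ {a b c d} → a ≡₄ b → c ≡₄ d → a ℤ.* c ≡₄ b ℤ.* d
  ≡₄-* {b = b} {d = d} (m , refl) (n , refl) = m ℤ.* d ℤ.+ b ℤ.* n ℤ.+ + 4 ℤ.* m ℤ.* n , lem b d m n
    where
      lem : ∀ b d m n → (b ℤ.+ + 4 ℤ.* m) ℤ.* (d ℤ.+ + 4 ℤ.* n) ≡ b ℤ.* d ℤ.+ + 4 ℤ.* (m ℤ.* d ℤ.+ b ℤ.* n ℤ.+ + 4 ℤ.* m ℤ.* n)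
      lem = solve-∀

  ≡₄-neg : ∀ {a b} → a ≡₄ b → ℤ.- a ≡₄ ℤ.- b
  ≡₄-neg {b = b} (m , refl) = ℤ.- m , lem b m
    where
      lem : ∀ b m → ℤ.- (b ℤ.+ + 4 ℤ.* m) ≡ ℤ.- b ℤ.+ + 4 ℤ.* (ℤ.- m)
      lem = solve-∀

  sumTo-cong : ∀ m {f g : ℕ → ℤ} → (∀ i → i ℕ.≤ m → f i ≡ g i) → sumTo m f ≡ sumTo m g
  sumTo-cong zero    h = h 0 z≤n
  sumTo-cong (suc m) h = cong₂ ℤ._+_ (sumTo-cong m (λ i i≤m → h i (ℕₚ.m≤n⇒m≤1+n i≤m))) (h (suc m) ℕₚ.≤-refl)

  sumTo-cong₄ : ∀ m {f g : ℕ → ℤ} → (∀ i → i ℕ.≤ m → f i ≡₄ g i) → sumTo m f ≡₄ sumTo m g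
  sumTo-cong₄ zero    h = h 0 z≤n
  sumTo-cong₄ (suc m) h = ≡₄-+ (sumTo-cong₄ m (λ i i≤m → h i (ℕₚ.m≤n⇒m≤1+n i≤m))) (h (suc m) ℕₚ.≤-refl)

  sumTo-first : ∀ m (f : ℕ → ℤ) → sumTo (suc m) f ≡ f 0 ℤ.+ sumTo m (f ∘ suc)
  sumTo-first zero    f = refl
  sumTo-first (suc m) f = trans (cong (ℤ._+ f (2 ℕ.+ m)) (sumTo-first m f)) (ℤₚ.+-assoc (f 0) _ _)

  sumTo-+ : ∀ m (f g : ℕ → ℤ) → sumTo m (λ i → f i ℤ.+ g i) ≡ sumTo m f ℤ.+ sumTo m g
  sumTo-+ zero    f g = refl
  sumTo-+ (suc m) f g = trans (cong (λ k → k ℤ.+ (f (suc m) ℤ.+ g (suc m))) (sumTo-+ m f g)) (lem (sumTo m f)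
      (sumTo m g) (f (suc m)) (g (suc m)))
    where
      lem : ∀ a b c d → a ℤ.+ b ℤ.+ (c ℤ.+ d) ≡ a ℤ.+ c ℤ.+ (b ℤ.+ d)
      lem = solve-∀

  sumTo-*ˡ : ∀ m c (f : ℕ → ℤ) → sumTo m (λ i → c ℤ.* f i) ≡ c ℤ.* sumTo m f
  sumTo-*ˡ zero    c f = refl
  sumTo-*ˡ (suc m) c f = trans (cong (λ k → k ℤ.+ c ℤ.* f (suc m)) (sumTo-*ˡ m c f)) (sym (ℤₚ.*-distribˡ-+ c _ _))

  sumTo-0 : ∀ m → sumTo m (λ _ → + 0) ≡ + 0
  sumTo-0 zero    = refl
  sumTo-0 (suc m) = trans (ℤₚ.+-identityʳ _) (sumTo-0 m)

  infix 4 _≐_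
  _≐_ : Series → Series → Set
  f ≐ g = ∀ m → f m ≡ g m

  infixl 6 _⊞_
  _⊞_ : Series → Series → Series
  (f ⊞ g) m = f m ℤ.+ g m

  ⊟_ : Series → Series
  (⊟ f) m = ℤ.- f m

  constant : ℤ → Series
  constant c zero    = c
  constant c (suc _) = + 0

  0ₛ : Series
  0ₛ _ = + 0

  ⊛-cong : ∀ {f f′ g g′} → f ≐ f′ → g ≐ g′ → f ⊛ g ≐ f′ ⊛ g′
  ⊛-cong p q m = sumTo-cong m (λ i _ → cong₂ ℤ._*_ (p i) (q (m ∸ i)))

  ⊛-first : ∀ f g m → (f ⊛ g) (suc m) ≡ f 0 ℤ.* g (suc m) ℤ.+ ((f ∘ suc) ⊛ g) m
  ⊛-first f g m = sumTo-first m _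

  ⊛-last : ∀ f g m → (f ⊛ g) (suc m) ≡ (f ⊛ (g ∘ suc)) m ℤ.+ f (suc m) ℤ.* g 0
  ⊛-last f g m = cong₂ ℤ._+_
    (sumTo-cong m (λ i i≤m → cong (λ k → f i ℤ.* g k) (ℕₚ.+-∸-assoc 1 i≤m)))
    (cong (λ k → f (suc m) ℤ.* g k) (ℕₚ.n∸n≡0 m))

  ⊛-comm : ∀ f g → f ⊛ g ≐ g ⊛ f
  ⊛-comm f g zero    = ℤₚ.*-comm (f 0) (g 0)
  ⊛-comm f g (suc m) = begin
    (f ⊛ g) (suc m)                              ≡⟨ ⊛-first f g m ⟩
    f 0 ℤ.* g (suc m) ℤ.+ ((f ∘ suc) ⊛ g) m      ≡⟨ cong₂ ℤ._+_ (ℤₚ.*-comm (f 0) (g (suc m))) (⊛-comm (f ∘ suc) g m) ⟩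
    g (suc m) ℤ.* f 0 ℤ.+ (g ⊛ (f ∘ suc)) m      ≡⟨ ℤₚ.+-comm (g (suc m) ℤ.* f 0) _ ⟩
    (g ⊛ (f ∘ suc)) m ℤ.+ g (suc m) ℤ.* f 0      ≡⟨ ⊛-last g f m ⟨
    (g ⊛ f) (suc m)                              ∎
    where
      open ≡-Reasoning

  ⊛-distribʳ : ∀ h f g → (f ⊞ g) ⊛ h ≐ (f ⊛ h) ⊞ (g ⊛ h)
  ⊛-distribʳ h f g m = trans
    (sumTo-cong m (λ i _ → ℤₚ.*-distribʳ-+ (h (m ∸ i)) (f i) (g i)))
    (sumTo-+ m _ _)

  ⊛-distribˡ : ∀ h f g → h ⊛ (f ⊞ g) ≐ (h ⊛ f) ⊞ (h ⊛ g)
  ⊛-distribˡ h f g m = trans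
    (sumTo-cong m (λ i _ → ℤₚ.*-distribˡ-+ (h i) (f (m ∸ i)) (g (m ∸ i))))
    (sumTo-+ m _ _)

  scale-⊛ : ∀ c f g m → ((λ i → c ℤ.* f i) ⊛ g) m ≡ c ℤ.* (f ⊛ g) m
  scale-⊛ c f g m = trans
    (sumTo-cong m (λ i _ → ℤₚ.*-assoc c (f i) (g (m ∸ i))))
    (sumTo-*ˡ m c _)

  -- Induction on the degree: splitting off the constant term of `f` leaves associativity for the
  -- tail `f ∘ suc` in the degree below.
  ⊛-assoc : ∀ f g h → (f ⊛ g) ⊛ h ≐ f ⊛ (g ⊛ h)
  ⊛-assoc f g h zero    = ℤₚ.*-assoc (f 0) (g 0) (h 0)
  ⊛-assoc f g h (suc m) = begin
    ((f ⊛ g) ⊛ h) (suc m)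
      ≡⟨ ⊛-first (f ⊛ g) h m ⟩
    a ℤ.* b ℤ.* c ℤ.+ (((f ⊛ g) ∘ suc) ⊛ h) m
      ≡⟨ cong (λ k → a ℤ.* b ℤ.* c ℤ.+ k) (⊛-cong {g = h} (⊛-first f g) (λ _ → refl) m) ⟩
    a ℤ.* b ℤ.* c ℤ.+ (((λ i → a ℤ.* g (suc i)) ⊞ ((f ∘ suc) ⊛ g)) ⊛ h) m
      ≡⟨ cong (λ k → a ℤ.* b ℤ.* c ℤ.+ k) (trans (⊛-distribʳ h (λ i → a ℤ.* g (suc i)) ((f ∘ suc) ⊛ g) m)
           (cong₂ ℤ._+_ (scale-⊛ a (g ∘ suc) h m) (⊛-assoc (f ∘ suc) g h m))) ⟩
    a ℤ.* b ℤ.* c ℤ.+ (a ℤ.* ((g ∘ suc) ⊛ h) m ℤ.+ ((f ∘ suc) ⊛ (g ⊛ h)) m)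
      ≡⟨ lem a b c _ _ ⟩
    a ℤ.* (b ℤ.* c ℤ.+ ((g ∘ suc) ⊛ h) m) ℤ.+ ((f ∘ suc) ⊛ (g ⊛ h)) m
      ≡⟨ cong (λ k → a ℤ.* k ℤ.+ ((f ∘ suc) ⊛ (g ⊛ h)) m) (⊛-first g h m) ⟨
    a ℤ.* (g ⊛ h) (suc m) ℤ.+ ((f ∘ suc) ⊛ (g ⊛ h)) m
      ≡⟨ ⊛-first f (g ⊛ h) m ⟨
    (f ⊛ (g ⊛ h)) (suc m) ∎
    where
    open ≡-Reasoning
    a = f 0
    b = g 0
    c = h (suc m)
    lem : ∀ a b c d e → a ℤ.* b ℤ.* c ℤ.+ (a ℤ.* d ℤ.+ e) ≡ a ℤ.* (b ℤ.* c ℤ.+ d) ℤ.+ e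
    lem = solve-∀

  0ₛ-⊛ : ∀ f → 0ₛ ⊛ f ≐ 0ₛ
  0ₛ-⊛ f m = trans (sumTo-cong m (λ i _ → ℤₚ.*-zeroˡ (f (m ∸ i)))) (sumTo-0 m)

  constant-⊛ : ∀ c f m → (constant c ⊛ f) m ≡ c ℤ.* f m
  constant-⊛ c f zero    = refl
  constant-⊛ c f (suc m) = trans (⊛-first (constant c) f m)
    (trans (cong (λ k → c ℤ.* f (suc m) ℤ.+ k) (0ₛ-⊛ f m)) (ℤₚ.+-identityʳ _))

  one-⊛ : ∀ f → one ⊛ f ≐ f
  one-⊛ f m = trans (⊛-cong {g = f} one≐ (λ _ → refl) m) (trans (constant-⊛ (+ 1) f m) (ℤₚ.*-identityˡ (f m)))
    where
    one≐ : one ≐ constant (+ 1)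
    one≐ zero    = refl
    one≐ (suc _) = refl

  -- Series modulo (4, q^(K+1)): in this quotient the infinite sums are finite and 1 − q^k is a unit.
  module Truncated (K : ℕ) where

    infix 4 _≈_
    record _≈_ (f g : Series) : Set where
      constructor coeffs
      field coeff : ∀ m → m ℕ.≤ K → f m ≡₄ g m
    open _≈_ public

    ≐⇒≈ : ∀ {f g} → f ≐ g → f ≈ g
    ≐⇒≈ h = coeffs λ m _ → ≡⇒≡₄ (h m)

    ≈-isEquivalence : IsEquivalence _≈_
    ≈-isEquivalence = record
      { refl  = coeffs λ _ _ → ≡₄-refl
      ; sym   = λ p → coeffs λ m m≤K → ≡₄-sym (coeff p m m≤K)
      ; trans = λ p q → coeffs λ m m≤K → ≡₄-trans (coeff p m m≤K) (coeff q m m≤K)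
      }

    ⊛-cong-≈ : ∀ {f f′ g g′} → f ≈ f′ → g ≈ g′ → f ⊛ g ≈ f′ ⊛ g′
    ⊛-cong-≈ p q = coeffs λ m m≤K → sumTo-cong₄ m λ i i≤m →
      ≡₄-* (coeff p i (ℕₚ.≤-trans i≤m m≤K)) (coeff q (m ∸ i) (ℕₚ.≤-trans (ℕₚ.m∸n≤m m i) m≤K))

    isCommutativeRing : IsCommutativeRing _≈_ _⊞_ _⊛_ ⊟_ 0ₛ one
    isCommutativeRing = record
      { isRing = record
        { +-isAbelianGroup = record
          { isGroup = record
            { isMonoid = record
              { isSemigroup = record
                { isMagma = record
                  { isEquivalence = ≈-isEquivalence
                  ; ∙-cong = λ p q → coeffs λ m m≤K → ≡₄-+ (coeff p m m≤K) (coeff q m m≤K)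
                  }
                ; assoc = λ f g h → ≐⇒≈ λ m → ℤₚ.+-assoc (f m) (g m) (h m)
                }
              ; identity = (λ f → ≐⇒≈ λ m → ℤₚ.+-identityˡ (f m)) , (λ f → ≐⇒≈ λ m → ℤₚ.+-identityʳ (f m))
              }
            ; inverse = (λ f → ≐⇒≈ λ m → ℤₚ.+-inverseˡ (f m)) , (λ f → ≐⇒≈ λ m → ℤₚ.+-inverseʳ (f m))
            ; ⁻¹-cong = λ p → coeffs λ m m≤K → ≡₄-neg (coeff p m m≤K)
            }
          ; comm = λ f g → ≐⇒≈ λ m → ℤₚ.+-comm (f m) (g m)
          }
        ; *-cong = ⊛-cong-≈
        ; *-assoc = λ f g h → ≐⇒≈ (⊛-assoc f g h)
        ; *-identity = (λ f → ≐⇒≈ (one-⊛ f)) , (λ f → ≐⇒≈ λ m → trans (⊛-comm f one m) (one-⊛ f m))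
        ; distrib = (λ h f g → ≐⇒≈ (⊛-distribˡ h f g)) , (λ h f g → ≐⇒≈ (⊛-distribʳ h f g))
        }
      ; *-comm = λ f g → ≐⇒≈ (⊛-comm f g)
      }

    commutativeRing : CommutativeRing 0ℓ 0ℓ
    commutativeRing = record { isCommutativeRing = isCommutativeRing }

-- The q-series identity in a truncated ring

module QSeries where

  open Triangular
  open import Algebra.Bundles using (CommutativeRing)
  open import Data.Bool using (Bool; true; false; T)
  open import Data.Integer using (ℤ; +_; -[1+_])
  import Data.Integer.Properties as ℤₚ
  open import Data.Maybe using (nothing)
  open import Data.Nat as ℕ using (ℕ; zero; suc)
  import Data.Nat.Properties as ℕₚ
  open import Level using (0ℓ)
  open import Relation.Binary.PropositionalEquality as ≡ using (_≡_; cong)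
  import Relation.Binary.Reflection as Reflection
  import Relation.Binary.Reasoning.Setoid as SetoidReasoning
  open import Tactic.RingSolver.Core.AlmostCommutativeRing using
      (AlmostCommutativeRing; fromCommutativeRing; _-Raw-AlmostCommutative⟶_)
  open import Tactic.RingSolver.Core.Polynomial.Parameters using (Homomorphism; RawCoeff)
  import Tactic.RingSolver.Core.Expression as Expression
  import Tactic.RingSolver.Core.Polynomial.Base as PolynomialBase
  import Tactic.RingSolver.Core.Polynomial.Semantics as PolynomialSemantics
  import Tactic.RingSolver.Core.Polynomial.Homomorphism as PolynomialHomomorphism
  import Algebra.Properties.Semiring.Exp.TCOptimised as Exponentiation
  import Algebra.Properties.Ring as RingProperties

  almostCommutative : CommutativeRing 0ℓ 0ℓ → AlmostCommutativeRing 0ℓ 0ℓ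
  almostCommutative R = fromCommutativeRing R (λ _ → nothing)

  isZero : ℤ → Bool
  isZero (+ zero)  = true
  isZero (+ suc _) = false
  isZero -[1+ _ ]  = false

  integerCoeff : RawCoeff 0ℓ 0ℓ
  integerCoeff = record { rawRing = CommutativeRing.rawRing ℤₚ.+-*-commutativeRing ; isZero = isZero }

  -- A solver with integer coefficients, since equality in R need not be decidable.
  module IntegerSolver (R : CommutativeRing 0ℓ 0ℓ)
    (ι : RawCoeff.rawRing integerCoeff -Raw-AlmostCommutative⟶ almostCommutative R) where

    open CommutativeRing R
    open _-Raw-AlmostCommutative⟶_ ι using (⟦_⟧; 0-homo)

    homomorphism : Homomorphism 0ℓ 0ℓ 0ℓ 0ℓ
    homomorphism = record
      { from = integerCoeff
      ; to = almostCommutative R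
      ; morphism = ι
      ; Zero-C⟶Zero-R = zero-homo
      }
      where
      zero-homo : ∀ x → T (isZero x) → 0# ≈ ⟦ x ⟧
      zero-homo (+ zero) _ = sym 0-homo

    open Expression public using (Expr; Κ; Ι; _⊕_; _⊗_; ⊝_)
    open Expression using (_⊛_)
    module Eval = Expression.Eval rawRing ⟦_⟧

    open PolynomialBase (Homomorphism.from homomorphism)

    norm : ∀ {n} → Expr ℤ n → Poly n
    norm (Κ x)   = κ x
    norm (Ι x)   = PolynomialBase.ι (Homomorphism.from homomorphism) x
    norm (x ⊕ y) = norm x ⊞ norm y
    norm (x ⊗ y) = norm x ⊠ norm y
    norm (⊝ x)   = ⊟ norm x
    norm (x ⊛ i) = norm x ⊡ i

    module Sem = PolynomialSemantics homomorphism
    module Hom = PolynomialHomomorphism homomorphism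
    open Exponentiation semiring using (^-congˡ)

    correct : ∀ {n} (e : Expr ℤ n) ρ → Sem.⟦ norm e ⟧ ρ ≈ Eval.⟦ e ⟧ ρ
    correct (Κ x)   ρ = Hom.κ-hom x ρ
    correct (Ι x)   ρ = Hom.ι-hom x ρ
    correct (x ⊕ y) ρ = trans (Hom.⊞-hom (norm x) (norm y) ρ) (+-cong (correct x ρ) (correct y ρ))
    correct (x ⊗ y) ρ = trans (Hom.⊠-hom (norm x) (norm y) ρ) (*-cong (correct x ρ) (correct y ρ))
    correct (⊝ x)   ρ = trans (Hom.⊟-hom (norm x) ρ) (-‿cong (correct x ρ))
    correct (x ⊛ i) ρ = trans (Hom.⊡-hom (norm x) i ρ) (^-congˡ i (correct x ρ))

    open Reflection setoid Ι Eval.⟦_⟧ (λ e → Sem.⟦ norm e ⟧) correct public using (solve; _⊜_)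

    infixl 6 _⊖_
    _⊖_ : ∀ {n} → Expr ℤ n → Expr ℤ n → Expr ℤ n
    a ⊖ b = a ⊕ (⊝ b)

    -- Κ (+ 1) would denote ⟦ + 1 ⟧, which is 1# only up to _≈_.
    𝟙 : ∀ {n} → Expr ℤ n
    𝟙 = Κ (+ 0) ⊛ 0

  -- X k plays the role of q^k and g k that of 1/(1 - q^{k+1}).
  record TruncatedSeriesRing : Set₁ where
    field
      seriesRing : CommutativeRing 0ℓ 0ℓ
      ι    : RawCoeff.rawRing integerCoeff -Raw-AlmostCommutative⟶ almostCommutative seriesRing
    open CommutativeRing seriesRing public
    field
      X    : ℕ → Carrier
      X-0  : X 0 ≈ 1#
      X-+  : ∀ m n → X (m ℕ.+ n) ≈ X m * X n
      4≈0  : 1# + 1# + (1# + 1#) ≈ 0#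
      K    : ℕ
      X-K  : X (suc K) ≈ 0#
      g    : ℕ → Carrier
      inverse : ∀ k → (1# - X (suc k)) * g k ≈ 1#

  module QIdentities (𝓡 : TruncatedSeriesRing) where

    open TruncatedSeriesRing 𝓡
    open IntegerSolver seriesRing ι
    open SetoidReasoning setoid
    open RingProperties ring using (-0#≈0#)

    -- The ring solver proves identities but cannot use hypotheses. Each relation therefore enters
    -- as a difference `l - r` with an explicit cofactor `e`, and is discharged here.
    linear-combination : ∀ {a b e l r} → a ≈ b + e * (l - r) → l ≈ r → a ≈ b
    linear-combination {a} {b} {e} {l} {r} h l≈r = begin
      a               ≈⟨ h ⟩
      b + e * (l - r) ≈⟨ +-congˡ (*-congˡ (trans (+-congʳ l≈r) (-‿inverseʳ r))) ⟩
      b + e * 0#      ≈⟨ +-congˡ (zeroʳ e) ⟩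
      b + 0#          ≈⟨ +-identityʳ b ⟩
      b               ∎

    -- The three certificates of the telescoping sums, with x = q^n, y = q^r, w = q^{n-r} and w' = q^{n-r-1}.  As w is
    -- junk for r > n, the relation x = yw is only used after multiplication by J = 1/(q;q)_{n-r}, which vanishes there.
    t-certificate : ∀ q x y w J I s I₁ J' w' → J' ≈ (1# - w) * J → I₁ ≈ (1# - x * y * q * q) * I →
      q * w' * J' ≈ w * J' → x * J ≈ y * w * J →
      (1# - q * (x * x)) * (s * (1# - q * q * (y * y)) * J * I) - s * (1# - q * q * (y * y)) * J' * I₁
       ≈ s * w * (1# - q * (y * y)) * J * I₁ - q * q * (y * y) * ((- s) * w' * (1# - q * ((q * y) * (q * y))) * J' * I)
    t-certificate q x y w J I s I₁ J' w' hJ hI hw hx =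
      linear-combination (linear-combination (linear-combination (linear-combination (solve 10 (λ q x y w J I s I₁ J' w' →
       (𝟙 ⊖ q ⊗ (x ⊗ x)) ⊗ (s ⊗ (𝟙 ⊖ q ⊗ q ⊗ (y ⊗ y)) ⊗ J ⊗ I) ⊖ s ⊗ (𝟙 ⊖ q ⊗ q ⊗ (y ⊗ y)) ⊗ J' ⊗ I₁
       ⊜ s ⊗ w ⊗ (𝟙 ⊖ q ⊗ (y ⊗ y)) ⊗ J ⊗ I₁ ⊖ q ⊗ q ⊗ (y ⊗ y) ⊗ ((⊝ s) ⊗ w' ⊗ (𝟙 ⊖ q ⊗ ((q ⊗ y) ⊗ (q ⊗ y))) ⊗ J' ⊗ I)
         ⊕ s ⊗ I ⊗ (⊝ (q ⊗ (𝟙 ⊖ q ⊗ q ⊗ (y ⊗ y))) ⊗ (x ⊕ w ⊗ y) ⊕ y ⊗ q ⊗ q ⊗ ((𝟙 ⊖ q ⊗ q ⊗ (y ⊗ y)) ⊗ (𝟙 ⊖ w) ⊕ w ⊗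
             (𝟙 ⊖ q ⊗ (y ⊗ y)))) ⊗ (x ⊗ J ⊖ y ⊗ w ⊗ J)
         ⊕ (⊝ (s ⊗ q ⊗ (y ⊗ y) ⊗ (𝟙 ⊖ q ⊗ ((q ⊗ y) ⊗ (q ⊗ y))) ⊗ I)) ⊗ (q ⊗ w' ⊗ J' ⊖ w ⊗ J')
         ⊕ (⊝ (s ⊗ (𝟙 ⊖ q ⊗ q ⊗ (y ⊗ y)) ⊗ (𝟙 ⊖ w) ⊗ J ⊕ s ⊗ w ⊗ (𝟙 ⊖ q ⊗ (y ⊗ y)) ⊗ J)) ⊗ (I₁ ⊖ (𝟙 ⊖ x ⊗ y ⊗ q ⊗ q) ⊗ I)
         ⊕ (⊝ (s ⊗ (𝟙 ⊖ q ⊗ q ⊗ (y ⊗ y)) ⊗ I₁ ⊕ s ⊗ q ⊗ (y ⊗ y) ⊗ (𝟙 ⊖ q ⊗ ((q ⊗ y) ⊗ (q ⊗ y))) ⊗ w ⊗ I)) ⊗ (J' ⊖ (𝟙 ⊖ w) ⊗ J))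
         refl q x y w J I s I₁ J' w') hJ) hI) hw) hx

    W-certificate : ∀ q x y w J s c I₁ J' I₀ → J' ≈ (1# - w) * J → I₀ ≈ (1# - x * y * q) * I₁ → x * J ≈ y * w * J →
      (1# - x) * (s * w * (1# - q * (y * y)) * J * I₁ * (y * c))
       ≈ s * c * (1# - y) * x * J * I₀ - (- s) * (y * c) * (1# - q * y) * x * J' * I₁
    W-certificate q x y w J s c I₁ J' I₀ hJ hI hx =
      linear-combination (linear-combination (linear-combination (solve 10 (λ q x y w J s c I₁ J' I₀ →
       (𝟙 ⊖ x) ⊗ (s ⊗ w ⊗ (𝟙 ⊖ q ⊗ (y ⊗ y)) ⊗ J ⊗ I₁ ⊗ (y ⊗ c))
       ⊜ s ⊗ c ⊗ (𝟙 ⊖ y) ⊗ x ⊗ J ⊗ I₀ ⊖ (⊝ s) ⊗ (y ⊗ c) ⊗ (𝟙 ⊖ q ⊗ y) ⊗ x ⊗ J' ⊗ I₁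
         ⊕ s ⊗ c ⊗ I₁ ⊗ ((𝟙 ⊖ y) ⊗ y ⊗ q ⊗ x ⊖ (𝟙 ⊖ q ⊗ (y ⊗ y))) ⊗ (x ⊗ J ⊖ y ⊗ w ⊗ J)
         ⊕ (⊝ (s ⊗ c ⊗ (𝟙 ⊖ y) ⊗ x ⊗ J)) ⊗ (I₀ ⊖ (𝟙 ⊖ x ⊗ y ⊗ q) ⊗ I₁)
         ⊕ (⊝ (s ⊗ y ⊗ c ⊗ (𝟙 ⊖ q ⊗ y) ⊗ x ⊗ I₁)) ⊗ (J' ⊖ (𝟙 ⊖ w) ⊗ J))
         refl q x y w J s c I₁ J' I₀) hJ) hI) hx

    S-certificate : ∀ q x y w J Q I J' I₂ → J' ≈ (1# - w) * J → I₂ ≈ (1# - x * y * (q * q * q)) * I → x * J ≈ y * w * J →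
      x * (Q * Q) * (1# - q * q * q * (y * y)) * J' * I₂
        - q * x * ((Q * (1# - q * x)) * (Q * (1# - q * x))) * (1# - q * q * q * (y * y)) * J * I
       ≈ (1# - q * q * y) * (1# - q * q * y) * (x * (Q * Q) * J' * I)
        - q * ((1# - q * y) * (1# - q * y) * (x * (Q * Q) * J * I₂))
    S-certificate q x y w J Q I J' I₂ hJ hI hx =
      linear-combination (linear-combination (linear-combination (solve 9 (λ q x y w J Q I J' I₂ →
       x ⊗ (Q ⊗ Q) ⊗ (𝟙 ⊖ q ⊗ q ⊗ q ⊗ (y ⊗ y)) ⊗ J' ⊗ I₂
        ⊖ q ⊗ x ⊗ ((Q ⊗ (𝟙 ⊖ q ⊗ x)) ⊗ (Q ⊗ (𝟙 ⊖ q ⊗ x))) ⊗ (𝟙 ⊖ q ⊗ q ⊗ q ⊗ (y ⊗ y)) ⊗ J ⊗ I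
       ⊜ (𝟙 ⊖ q ⊗ q ⊗ y) ⊗ (𝟙 ⊖ q ⊗ q ⊗ y) ⊗ (x ⊗ (Q ⊗ Q) ⊗ J' ⊗ I)
        ⊖ q ⊗ ((𝟙 ⊖ q ⊗ y) ⊗ (𝟙 ⊖ q ⊗ y) ⊗ (x ⊗ (Q ⊗ Q) ⊗ J ⊗ I₂))
         ⊕ x ⊗ (Q ⊗ Q) ⊗ I ⊗
            ((⊝ (q ⊗ q ⊗ q ⊗ (𝟙 ⊖ q ⊗ q ⊗ q ⊗ (y ⊗ y)))) ⊗ (x ⊕ w ⊗ y)
              ⊕ (𝟙 ⊖ q ⊗ q ⊗ q ⊗ (y ⊗ y)) ⊗ (q ⊗ q ⊕ q ⊗ q ⊖ (𝟙 ⊖ w) ⊗ y ⊗ (q ⊗ q ⊗ q))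
              ⊖ q ⊗ (𝟙 ⊖ q ⊗ y) ⊗ (𝟙 ⊖ q ⊗ y) ⊗ y ⊗ (q ⊗ q ⊗ q))
            ⊗ (x ⊗ J ⊖ y ⊗ w ⊗ J)
         ⊕ x ⊗ (Q ⊗ Q) ⊗ J ⊗ ((𝟙 ⊖ q ⊗ q ⊗ q ⊗ (y ⊗ y)) ⊗ (𝟙 ⊖ w) ⊕ q ⊗ (𝟙 ⊖ q ⊗ y) ⊗ (𝟙 ⊖ q ⊗ y))
            ⊗ (I₂ ⊖ (𝟙 ⊖ x ⊗ y ⊗ (q ⊗ q ⊗ q)) ⊗ I)
         ⊕ x ⊗ (Q ⊗ Q) ⊗ ((𝟙 ⊖ q ⊗ q ⊗ q ⊗ (y ⊗ y)) ⊗ I₂ ⊖ (𝟙 ⊖ q ⊗ q ⊗ y) ⊗ (𝟙 ⊖ q ⊗ q ⊗ y) ⊗ I) ⊗ (J' ⊖ (𝟙 ⊖ w) ⊗ J))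
         refl q x y w J Q I J' I₂) hJ) hI) hx

    q : Carrier
    q = X 1

    X-suc : ∀ n → X (suc n) ≈ q * X n
    X-suc n = X-+ 1 n

    sum : ℕ → (ℕ → Carrier) → Carrier
    sum zero    f = f 0
    sum (suc m) f = sum m f + f (suc m)

    sum-cong : ∀ m {f h : ℕ → Carrier} → (∀ i → i ℕ.≤ m → f i ≈ h i) → sum m f ≈ sum m h
    sum-cong zero    e = e 0 ℕ.z≤n
    sum-cong (suc m) e = +-cong (sum-cong m (λ i i≤m → e i (ℕₚ.m≤n⇒m≤1+n i≤m))) (e (suc m) ℕₚ.≤-refl)

    sum-+ : ∀ m f h → sum m (λ i → f i + h i) ≈ sum m f + sum m h
    sum-+ zero    f h = refl
    sum-+ (suc m) f h = trans (+-congʳ (sum-+ m f h))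
      (solve 4 (λ a b c d → a ⊕ b ⊕ (c ⊕ d) ⊜ a ⊕ c ⊕ (b ⊕ d)) refl (sum m f) (sum m h) (f (suc m)) (h (suc m)))

    sum-*ˡ : ∀ m a f → sum m (λ i → a * f i) ≈ a * sum m f
    sum-*ˡ zero    a f = refl
    sum-*ˡ (suc m) a f = trans (+-congʳ (sum-*ˡ m a f)) (sym (distribˡ a (sum m f) (f (suc m))))

    sum-*ʳ : ∀ m a f → sum m (λ i → f i * a) ≈ sum m f * a
    sum-*ʳ m a f = trans (sum-cong m (λ i _ → *-comm (f i) a)) (trans (sum-*ˡ m a f) (*-comm a (sum m f)))

    sum-swap : ∀ m n (f : ℕ → ℕ → Carrier) → sum m (λ i → sum n (f i)) ≈ sum n (λ j → sum m (λ i → f i j))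
    sum-swap zero    n f = refl
    sum-swap (suc m) n f = trans (+-congʳ (sum-swap m n f)) (sym (sum-+ n (λ j → sum m (λ i → f i j)) (f (suc m))))

    sum-telescope : ∀ m (f h : ℕ → Carrier) → (∀ i → f i ≈ h i - h (suc i)) → sum m f ≈ h 0 - h (suc m)
    sum-telescope zero    f h e = e 0
    sum-telescope (suc m) f h e = trans (+-cong (sum-telescope m f h e) (e (suc m)))
      (solve 3 (λ a b c → a ⊖ b ⊕ (b ⊖ c) ⊜ a ⊖ c) refl (h 0) (h (suc m)) (h (suc (suc m))))

    cancel-unit : ∀ k a b → (1# - X (suc k)) * a ≈ b → a ≈ b * g k
    cancel-unit k a b e = begin
      a                             ≈⟨ *-identityˡ a ⟨
      1# * a                        ≈⟨ *-congʳ (inverse k) ⟨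
      (1# - X (suc k)) * g k * a    ≈⟨ solve 3 (λ a b c → a ⊗ b ⊗ c ⊜ a ⊗ c ⊗ b) refl (1# - X (suc k)) (g k) a ⟩
      (1# - X (suc k)) * a * g k    ≈⟨ *-congʳ e ⟩
      b * g k                       ∎

    -- Q n = (q;q)_n and iQ n = 1/(q;q)_n
    iQ Q : ℕ → Carrier
    iQ zero    = 1#
    iQ (suc n) = iQ n * g n
    Q zero    = 1#
    Q (suc n) = Q n * (1# - X (suc n))

    iQ-step : ∀ n → iQ n ≈ (1# - X (suc n)) * iQ (suc n)
    iQ-step n = begin
      iQ n                              ≈⟨ *-identityʳ (iQ n) ⟨
      iQ n * 1#                         ≈⟨ *-congˡ (inverse n) ⟨
      iQ n * ((1# - X (suc n)) * g n)   ≈⟨ solve 3 (λ a b c → a ⊗ (b ⊗ c) ⊜ b ⊗ (a ⊗ c)) refl (iQ n) (1# - X (suc n)) (g n) ⟩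
      (1# - X (suc n)) * (iQ n * g n)   ∎

    Q-iQ : ∀ n → Q n * iQ n ≈ 1#
    Q-iQ zero    = *-identityˡ 1#
    Q-iQ (suc n) = begin
      Q n * (1# - X (suc n)) * (iQ n * g n)     ≈⟨ solve 4 (λ a b c d → a ⊗ b ⊗ (c ⊗ d) ⊜ a ⊗ c ⊗ (b ⊗ d)) refl (Q n)
          (1# - X (suc n)) (iQ n) (g n) ⟩
      Q n * iQ n * ((1# - X (suc n)) * g n)     ≈⟨ *-cong (Q-iQ n) (inverse n) ⟩
      1# * 1#                                   ≈⟨ *-identityˡ 1# ⟩
      1#                                        ∎

    -- J n r = 1/(q;q)_{n-r}, which is 0 for r > n, and w n r = q^{n-r}, with junk values for r > n
    J w : ℕ → ℕ → Carrier
    J n       zero    = iQ n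
    J zero    (suc r) = 0#
    J (suc n) (suc r) = J n r
    w n       zero    = X n
    w zero    (suc r) = 1#
    w (suc n) (suc r) = w n r

    -- At r = n the factor 1 - w is 1 - q^0, which produces the zero; for r > n both sides vanish.
    J-step : ∀ n r → J n (suc r) ≈ (1# - w n r) * J n r
    J-step zero    zero    = begin
      0#               ≈⟨ zeroˡ 1# ⟨
      0# * 1#          ≈⟨ *-congʳ (-‿inverseʳ 1#) ⟨
      (1# - 1#) * 1#   ≈⟨ *-congʳ (+-congˡ (-‿cong X-0)) ⟨
      (1# - X 0) * 1#  ∎
    J-step (suc n) zero    = iQ-step n
    J-step zero    (suc r) = sym (zeroʳ (1# - 1#))
    J-step (suc n) (suc r) = J-step n r

    X-J : ∀ n r → X n * J n r ≈ X r * w n r * J n r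
    X-J n       zero    = *-congʳ (trans (sym (*-identityˡ (X n))) (*-congʳ (sym X-0)))
    X-J zero    (suc r) = trans (zeroʳ (X 0)) (sym (zeroʳ (X (suc r) * 1#)))
    X-J (suc n) (suc r) = begin
      X (suc n) * J n r                 ≈⟨ *-congʳ (X-suc n) ⟩
      q * X n * J n r                   ≈⟨ *-assoc q (X n) (J n r) ⟩
      q * (X n * J n r)                 ≈⟨ *-congˡ (X-J n r) ⟩
      q * (X r * w n r * J n r)         ≈⟨ solve 4 (λ q a b c → q ⊗ (a ⊗ b ⊗ c) ⊜ q ⊗ a ⊗ b ⊗ c) refl q (X r) (w n r) (J n r) ⟩
      q * X r * w n r * J n r           ≈⟨ *-congʳ (*-congʳ (X-suc r)) ⟨
      X (suc r) * w n r * J n r         ∎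

    w-J : ∀ n r → q * w n (suc r) * J n (suc r) ≈ w n r * J n (suc r)
    w-J zero    r       = trans (zeroʳ (q * 1#)) (sym (zeroʳ (w 0 r)))
    w-J (suc n) zero    = *-congʳ (sym (X-suc n))
    w-J (suc n) (suc r) = w-J n r

    J-vanish : ∀ {n r} → n ℕ.< r → J n r ≈ 0#
    J-vanish {zero}  {suc r} _           = refl
    J-vanish {suc n} {suc r} (ℕ.s≤s n<r) = J-vanish n<r

    sgn : ℕ → Carrier
    sgn zero    = 1#
    sgn (suc r) = - sgn r

    -- This is r(r-1)/2, so that `tri r` is r + `C r`, also for r = 0.
    C : ℕ → ℕ
    C zero    = 0
    C (suc r) = tri r

    -- A r = Σ_{j≤r} q^{r(r+1) - j(j+1)/2}
    A : ℕ → Carrier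
    A zero    = 1#
    A (suc r) = X (2 ℕ.+ (r ℕ.+ r)) * A r + X (tri (suc r))

    -- P R n = Σ_r α_r / ((q;q)_{n-r} (q³;q)_{n+r}), the right-hand side of the Bailey pair; U and W are the antidifferences
    -- in r that yield the recurrence (1 - q^{2n+1}) P R n = P R (n-1).
    t U W P : ℕ → ℕ → Carrier
    t n r = sgn r * (1# - X (2 ℕ.+ (r ℕ.+ r))) * J n r * iQ (2 ℕ.+ (n ℕ.+ r))
    U n r = sgn r * w n r * (1# - X (1 ℕ.+ (r ℕ.+ r))) * J n r * iQ (1 ℕ.+ (n ℕ.+ r))
    W n r = sgn r * X (C r) * (1# - X r) * X n * J n r * iQ (n ℕ.+ r)
    P R n = sum R (λ r → t n r * A r)

    X-odd : ∀ r → X (1 ℕ.+ (r ℕ.+ r)) ≈ q * (X r * X r)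
    X-odd r = trans (X-suc (r ℕ.+ r)) (*-congˡ (X-+ r r))

    X-2+ : ∀ m → X (2 ℕ.+ m) ≈ q * q * X m
    X-2+ m = trans (X-suc (suc m)) (trans (*-congˡ (X-suc m)) (sym (*-assoc q q (X m))))

    X-3+ : ∀ m → X (3 ℕ.+ m) ≈ q * q * q * X m
    X-3+ m = trans (X-suc (2 ℕ.+ m)) (trans (*-congˡ (X-2+ m)) (solve 2 (λ q y → q ⊗ (q ⊗ q ⊗ y) ⊜ q ⊗ q ⊗ q ⊗ y) refl q (X m)))

    X-even : ∀ r → X (2 ℕ.+ (r ℕ.+ r)) ≈ q * q * (X r * X r)
    X-even r = trans (X-2+ (r ℕ.+ r)) (*-congˡ (X-+ r r))

    1-cong : ∀ {a b} → a ≈ b → 1# - a ≈ 1# - b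
    1-cong e = +-congˡ (-‿cong e)

    iQ-index : ∀ {m n} → m ≡ n → iQ m ≈ iQ n
    iQ-index e = reflexive (cong iQ e)

    -- The factor q^(2r+2) before `U n (suc r)` is the one in the recurrence of `A`. Summation by
    -- parts against `A` therefore leaves only the inhomogeneous terms q^(r(r+1)/2) of that
    -- recurrence and one boundary term.
    t-step : ∀ m r → let n = suc m in
      (1# - X (1 ℕ.+ (n ℕ.+ n))) * t n r - t m r ≈ U n r - X (2 ℕ.+ (r ℕ.+ r)) * U n (suc r)
    t-step m r = begin
      (1# - X (1 ℕ.+ (n ℕ.+ n))) * t n r - t m r
        ≈⟨ +-cong (*-cong (1-cong (X-odd n)) (*-congʳ (*-congʳ (*-congˡ (1-cong (X-even r))))))
                  (-‿cong (*-congʳ (*-congʳ (*-congˡ (1-cong (X-even r)))))) ⟩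
      _ ≈⟨ t-certificate q (X n) (X r) (w n r) (J n r) (iQ (2 ℕ.+ (n ℕ.+ r))) (sgn r) (iQ (1 ℕ.+ (n ℕ.+ r))) (J n
          (suc r)) (w n (suc r))
             (J-step n r)
             (trans (iQ-step (1 ℕ.+ (n ℕ.+ r))) (*-congʳ (1-cong (trans (X-2+ (n ℕ.+ r)) (trans (*-congˡ (X-+ n r))
               (solve 3 (λ q x y → q ⊗ q ⊗ (x ⊗ y) ⊜ x ⊗ y ⊗ q ⊗ q) refl q (X n) (X r)))))))
             (w-J n r) (X-J n r) ⟩
      _ ≈⟨ +-cong (*-congʳ (*-congʳ (*-congˡ (1-cong (sym (X-odd r))))))
                  (-‿cong (*-cong (sym (X-even r)) (*-cong (*-congʳ (*-congˡ (1-cong (sym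
                    (trans (X-odd (suc r)) (*-congˡ (*-cong (X-suc r) (X-suc r)))))))) (iQ-index
                        (cong suc (≡.sym (ℕₚ.+-suc n r))))))) ⟩
      U n r - X (2 ℕ.+ (r ℕ.+ r)) * U n (suc r) ∎
      where
        n = suc m

    -- The sum left over by the first telescoping telescopes again once it is multiplied by 1 - q^n,
    -- a unit for n > 0.
    W-step : ∀ n r → (1# - X n) * (U n r * X (tri r)) ≈ W n r - W n (suc r)
    W-step n r = begin
      (1# - X n) * (U n r * X (tri r))
        ≈⟨ *-congˡ (*-cong (*-congʳ (*-congʳ (*-congˡ (1-cong (X-odd r))))) X-tri) ⟩
      _ ≈⟨ W-certificate q (X n) (X r) (w n r) (J n r) (sgn r) (X (C r)) (iQ (1 ℕ.+ (n ℕ.+ r))) (J n (suc r)) (iQ (n ℕ.+ r))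
             (J-step n r)
             (trans (iQ-step (n ℕ.+ r)) (*-congʳ (1-cong (trans (X-suc (n ℕ.+ r)) (trans (*-congˡ (X-+ n r))
                 (*-comm q (X n * X r)))))))
             (X-J n r) ⟩
      _ ≈⟨ +-congˡ (-‿cong (*-cong (*-congʳ (*-congʳ (*-cong (*-congˡ (sym X-tri)) (1-cong (sym (X-suc r))))))
          (iQ-index (≡.sym (ℕₚ.+-suc n r))))) ⟩
      W n r - W n (suc r) ∎
      where
      tri≡ : ∀ r → tri r ≡ r ℕ.+ C r
      tri≡ zero    = ≡.refl
      tri≡ (suc r) = ≡.refl
      X-tri : X (tri r) ≈ X r * X (C r)
      X-tri = trans (reflexive (cong X (tri≡ r))) (X-+ r (C r))

    P-partial : ∀ m R → let n = suc m in
      (1# - X (1 ℕ.+ (n ℕ.+ n))) * P R n - P R m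
        ≈ sum R (λ r → U n r * X (tri r)) - X (2 ℕ.+ (R ℕ.+ R)) * U n (suc R) * A R
    P-partial m zero = begin
      c * (t n 0 * 1#) - t m 0 * 1#          ≈⟨ solve 3 (λ c a b → c ⊗ (a ⊗ 𝟙) ⊖ b ⊗ 𝟙 ⊜ c ⊗ a ⊖ b) refl c (t n 0) (t m 0) ⟩
      c * t n 0 - t m 0                      ≈⟨ t-step m 0 ⟩
      U n 0 - X 2 * U n 1                    ≈⟨ +-cong (trans (sym (*-identityʳ (U n 0))) (*-congˡ (sym X-0)))
          (-‿cong (sym (*-identityʳ (X 2 * U n 1)))) ⟩
      U n 0 * X 0 - X 2 * U n 1 * 1#         ∎
      where
      n = suc m
      c = 1# - X (1 ℕ.+ (n ℕ.+ n))
    P-partial m (suc R) = begin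
      c * (P R n + t n R′ * A R′) - (P R m + t m R′ * A R′)
        ≈⟨ solve 6 (λ c p t a p′ t′ → c ⊗ (p ⊕ t ⊗ a) ⊖ (p′ ⊕ t′ ⊗ a) ⊜ (c ⊗ p ⊖ p′) ⊕ (c ⊗ t ⊖ t′) ⊗ a) refl
             c (P R n) (t n R′) (A R′) (P R m) (t m R′) ⟩
      (c * P R n - P R m) + (c * t n R′ - t m R′) * A R′
        ≈⟨ +-cong (P-partial m R) (*-congʳ (t-step m R′)) ⟩
      (s - x * U n R′ * A R) + (U n R′ - x′ * U n (suc R′)) * (x * A R + X (tri R′))
        ≈⟨ solve 7 (λ s x u a x′ u′ y → (s ⊖ x ⊗ u ⊗ a) ⊕ (u ⊖ x′ ⊗ u′) ⊗ (x ⊗ a ⊕ y) ⊜ s ⊕ u ⊗ y ⊖ x′ ⊗ u′ ⊗ (x ⊗ a ⊕ y)) refl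
             s x (U n R′) (A R) x′ (U n (suc R′)) (X (tri R′)) ⟩
      s + U n R′ * X (tri R′) - x′ * U n (suc R′) * (x * A R + X (tri R′)) ∎
      where
      n = suc m
      c = 1# - X (1 ℕ.+ (n ℕ.+ n))
      R′ = suc R
      s = sum R (λ r → U n r * X (tri r))
      x = X (2 ℕ.+ (R ℕ.+ R))
      x′ = X (2 ℕ.+ (R′ ℕ.+ R′))

    -‿vanish : ∀ {a b} → b ≈ 0# → a - b ≈ a
    -‿vanish {a} {b} e = trans (+-congˡ (-‿cong e)) (trans (+-congˡ -0#≈0#) (+-identityʳ a))

    -- For n ≤ R every term at `suc R` contains `J n (suc R)`, which is zero, and `W n 0` contains 1
    -- - q^0. Both telescoping sums thus lose their boundary terms.
    P-step : ∀ {R m} → suc m ℕ.≤ R → let n = suc m in (1# - X (1 ℕ.+ (n ℕ.+ n))) * P R n ≈ P R m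
    P-step {R} {m} n≤R = begin
      c * P R n                      ≈⟨ solve 2 (λ a b → a ⊜ b ⊕ (a ⊖ b)) refl (c * P R n) (P R m) ⟩
      P R m + (c * P R n - P R m)    ≈⟨ +-congˡ (trans (P-partial m R) (trans (-‿vanish boundary) total)) ⟩
      P R m + 0#                     ≈⟨ +-identityʳ (P R m) ⟩
      P R m                          ∎
      where
      n = suc m
      c = 1# - X (1 ℕ.+ (n ℕ.+ n))
      J≈0 : J n (suc R) ≈ 0#
      J≈0 = J-vanish (ℕ.s≤s n≤R)
      boundary : X (2 ℕ.+ (R ℕ.+ R)) * U n (suc R) * A R ≈ 0#
      boundary = trans (*-congʳ (trans (*-congˡ (trans (*-congʳ (trans (*-congˡ J≈0) (zeroʳ _))) (zeroˡ _))) (zeroʳ _))) (zeroˡ _)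
      W-0 : W n 0 ≈ 0#
      W-0 = trans (*-congʳ (trans (*-congʳ (trans (*-congʳ (trans (*-congˡ (trans (1-cong X-0) (-‿inverseʳ 1#)))
          (zeroʳ _))) (zeroˡ _))) (zeroˡ _))) (zeroˡ _)
      W-R : W n (suc R) ≈ 0#
      W-R = trans (*-congʳ (trans (*-congˡ J≈0) (zeroʳ _))) (zeroˡ _)
      total : sum R (λ r → U n r * X (tri r)) ≈ 0#
      total = trans (cancel-unit m _ 0# (begin
        (1# - X n) * sum R (λ r → U n r * X (tri r))     ≈⟨ sum-*ˡ R (1# - X n) _ ⟨
        sum R (λ r → (1# - X n) * (U n r * X (tri r)))   ≈⟨ sum-telescope R _ (W n) (W-step n) ⟩
        W n 0 - W n (suc R)                            ≈⟨ -‿vanish W-R ⟩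
        W n 0                                          ≈⟨ W-0 ⟩
        0#                                             ∎)) (zeroˡ (g m))

    -- β_n = 1/(q;q²)_{n+1}
    b : ℕ → Carrier
    b zero    = g 0
    b (suc n) = b n * g (suc n ℕ.+ suc n)

    sum-0 : ∀ m f → (∀ r → f (suc r) ≈ 0#) → sum m f ≈ f 0
    sum-0 zero    f e = refl
    sum-0 (suc m) f e = trans (+-cong (sum-0 m f e) (e m)) (+-identityʳ (f 0))

    -- Both sides satisfy the same first-order recurrence in n. At n = 0 only r = 0 contributes.
    bailey-pair : ∀ R n → n ℕ.≤ R → b n ≈ P R n
    bailey-pair R zero    _   = sym (begin
      P R 0
        ≈⟨ sum-0 R _ (λ r → trans (*-congʳ (trans (*-congʳ (zeroʳ _)) (zeroˡ _))) (zeroˡ _)) ⟩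
      1# * (1# - X 2) * 1# * iQ 2 * 1#
        ≈⟨ solve 2 (λ a c → 𝟙 ⊗ a ⊗ 𝟙 ⊗ c ⊗ 𝟙 ⊜ a ⊗ c) refl (1# - X 2) (iQ 2) ⟩
      (1# - X 2) * iQ 2                     ≈⟨ iQ-step 1 ⟨
      1# * g 0                              ≈⟨ *-identityˡ (g 0) ⟩
      g 0                                   ∎)
    bailey-pair R (suc n) n<R = sym (trans
      (cancel-unit (suc n ℕ.+ suc n) (P R (suc n)) (P R n) (P-step n<R))
      (*-congʳ (sym (bailey-pair R n (ℕₚ.<⇒≤ n<R)))))

    -- c r = Σ_n κ n r has the closed form q^r/(1-q^{r+1})²; S is the antidifference in n for the recurrence in r.
    κ S : ℕ → ℕ → Carrier
    κ n r = X n * (Q n * Q n) * J n r * iQ (2 ℕ.+ (n ℕ.+ r))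
    S n r = X n * (Q n * Q n) * (1# - X (3 ℕ.+ (r ℕ.+ r))) * J n (suc r) * iQ (2 ℕ.+ (n ℕ.+ r))

    S-step : ∀ n r → (1# - X (2 ℕ.+ r)) * (1# - X (2 ℕ.+ r)) * κ n (suc r)
        - q * ((1# - X (1 ℕ.+ r)) * (1# - X (1 ℕ.+ r)) * κ n r) ≈ S n r - S (suc n) r
    S-step n r = sym (begin
      S n r - S (suc n) r
        ≈⟨ +-cong (*-congʳ (*-congʳ (*-congˡ (1-cong e3))))
             (-‿cong (*-congʳ (*-congʳ (*-cong (*-cong (X-suc n) (*-cong (*-congˡ (1-cong (X-suc n)))
                 (*-congˡ (1-cong (X-suc n))))) (1-cong e3))))) ⟩
      _ ≈⟨ S-certificate q (X n) (X r) (w n r) (J n r) (Q n) (iQ (3 ℕ.+ (n ℕ.+ r))) (J n (suc r)) (iQ (2 ℕ.+ (n ℕ.+ r)))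
             (J-step n r)
             (trans (iQ-step (2 ℕ.+ (n ℕ.+ r))) (*-congʳ (1-cong (trans (X-3+ (n ℕ.+ r))
                 (trans (*-congˡ (X-+ n r)) (*-comm (q * q * q) (X n * X r)))))))
             (X-J n r) ⟩
      _ ≈⟨ +-cong (*-cong (*-cong e2 e2) (*-congˡ (iQ-index (cong (2 ℕ.+_) (≡.sym (ℕₚ.+-suc n r))))))
             (-‿cong (*-congˡ (*-congʳ (*-cong e1 e1)))) ⟩
      _ ∎)
      where
      e3 : X (3 ℕ.+ (r ℕ.+ r)) ≈ q * q * q * (X r * X r)
      e3 = trans (X-3+ (r ℕ.+ r)) (*-congˡ (X-+ r r))
      e2 : 1# - q * q * X r ≈ 1# - X (2 ℕ.+ r)
      e2 = 1-cong (sym (X-2+ r))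
      e1 : 1# - q * X r ≈ 1# - X (1 ℕ.+ r)
      e1 = 1-cong (sym (X-suc r))

    c : ℕ → Carrier
    c r = sum K (λ n → κ n r)

    X-K-* : ∀ a → X (suc K) * a ≈ 0#
    X-K-* a = trans (*-congʳ X-K) (zeroˡ a)

    -- The sum over n telescopes with antidifference `S`. The lower end vanishes through
    -- `J 0 (suc r)`, the upper end through q^(K+1) = 0.
    c-step : ∀ r → (1# - X (2 ℕ.+ r)) * (1# - X (2 ℕ.+ r)) * c (suc r) ≈ q * ((1# - X (1 ℕ.+ r)) * (1# - X (1 ℕ.+ r)) * c r)
    c-step r = begin
      α * c (suc r)
        ≈⟨ solve 2 (λ a b → a ⊜ a ⊖ b ⊕ b) refl (α * c (suc r)) (q * (β * c r)) ⟩
      α * c (suc r) - q * (β * c r) + q * (β * c r)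
        ≈⟨ +-congʳ difference ⟩
      0# + q * (β * c r)
        ≈⟨ +-identityˡ _ ⟩
      q * (β * c r) ∎
      where
      α = (1# - X (2 ℕ.+ r)) * (1# - X (2 ℕ.+ r))
      β = (1# - X (1 ℕ.+ r)) * (1# - X (1 ℕ.+ r))
      difference : α * c (suc r) - q * (β * c r) ≈ 0#
      difference = begin
        α * c (suc r) - q * (β * c r)
          ≈⟨ solve 5 (λ a x q b y → a ⊗ x ⊖ q ⊗ (b ⊗ y) ⊜ a ⊗ x ⊕ (⊝ (q ⊗ b)) ⊗ y) refl α (c (suc r)) q β (c r) ⟩
        α * c (suc r) + (- (q * β)) * c r
          ≈⟨ +-cong (sum-*ˡ K α _) (sum-*ˡ K (- (q * β)) _) ⟨
        sum K (λ n → α * κ n (suc r)) + sum K (λ n → (- (q * β)) * κ n r)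
          ≈⟨ sum-+ K _ _ ⟨
        sum K (λ n → α * κ n (suc r) + (- (q * β)) * κ n r)
          ≈⟨ sum-telescope K _ (λ n → S n r) (λ n → trans
               (solve 5 (λ a x q b y → a ⊗ x ⊕ (⊝ (q ⊗ b)) ⊗ y ⊜ a ⊗ x ⊖ q ⊗ (b ⊗ y)) refl α (κ n (suc r)) q β (κ n r))
               (S-step n r)) ⟩
        S 0 r - S (suc K) r
          ≈⟨ -‿vanish (trans (*-congʳ (*-congʳ (*-congʳ (X-K-* _)))) (trans
              (*-congʳ (trans (*-congʳ (zeroˡ _)) (zeroˡ _))) (zeroˡ _))) ⟩
        S 0 r
          ≈⟨ trans (*-congʳ (zeroʳ _)) (zeroˡ _) ⟩
        0# ∎

    -- At r = 0 the factor `J n 0` cancels one `Q n`, and 1 - q = (1 - q^(n+2)) - q(1 - q^(n+1))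
    -- makes the rest a difference. Only `D 0` = 1/(1-q) survives.
    c-0 : (1# - X 1) * (1# - X 1) * c 0 ≈ 1#
    c-0 = begin
      (1# - X 1) * (1# - X 1) * c 0            ≈⟨ *-assoc _ _ _ ⟩
      (1# - X 1) * ((1# - X 1) * c 0)          ≈⟨ *-congˡ (sum-*ˡ K (1# - X 1) _) ⟨
      (1# - X 1) * sum K (λ n → (1# - X 1) * κ n 0)   ≈⟨ *-congˡ (sum-telescope K _ D D-step) ⟩
      (1# - X 1) * (D 0 - D (suc K))           ≈⟨ *-congˡ (-‿vanish (trans (*-congʳ (X-K-* _)) (zeroˡ _))) ⟩
      (1# - X 1) * (X 0 * 1# * (1# * g 0))     ≈⟨ *-congˡ (*-cong (trans (*-identityʳ (X 0)) X-0) (*-identityˡ (g 0))) ⟩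
      (1# - X 1) * (1# * g 0)                  ≈⟨ *-congˡ (*-identityˡ (g 0)) ⟩
      (1# - X 1) * g 0                         ≈⟨ inverse 0 ⟩
      1#                                       ∎
      where
      D : ℕ → Carrier
      D n = X n * Q n * iQ (1 ℕ.+ n)
      D-step : ∀ n → (1# - X 1) * κ n 0 ≈ D n - D (suc n)
      D-step n = begin
        (1# - q) * (X n * (Q n * Q n) * iQ n * iQ (2 ℕ.+ (n ℕ.+ 0)))
          ≈⟨ *-congˡ (*-congˡ (iQ-index (cong (2 ℕ.+_) (ℕₚ.+-identityʳ n)))) ⟩
        (1# - q) * (X n * (Q n * Q n) * iQ n * I)
          ≈⟨ solve 5 (λ q x Q i I → (𝟙 ⊖ q) ⊗ (x ⊗ (Q ⊗ Q) ⊗ i ⊗ I) ⊜ (𝟙 ⊖ q) ⊗ x ⊗ Q ⊗ I ⊗ (Q ⊗ i)) refl q (X n) (Q n) (iQ n) I ⟩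
        (1# - q) * X n * Q n * I * (Q n * iQ n)
          ≈⟨ *-congˡ (Q-iQ n) ⟩
        (1# - q) * X n * Q n * I * 1#
          ≈⟨ solve 4 (λ q x Q I → (𝟙 ⊖ q) ⊗ x ⊗ Q ⊗ I ⊗ 𝟙 ⊜ x ⊗ Q ⊗ ((𝟙 ⊖ q ⊗ q ⊗ x) ⊗ I) ⊖ q ⊗ x ⊗ (Q ⊗
              (𝟙 ⊖ q ⊗ x)) ⊗ I) refl q (X n) (Q n) I ⟩
        X n * Q n * ((1# - q * q * X n) * I) - q * X n * (Q n * (1# - q * X n)) * I
          ≈⟨ +-cong (*-congˡ (trans (*-congʳ (1-cong (sym (X-2+ n)))) (sym (iQ-step (suc n)))))
               (-‿cong (*-congʳ (*-cong (sym (X-suc n)) (*-congˡ (1-cong (sym (X-suc n))))))) ⟩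
        D n - D (suc n) ∎
        where
          I = iQ (2 ℕ.+ n)

    c-closed : ∀ r → (1# - X (suc r)) * (1# - X (suc r)) * c r ≈ X r
    c-closed zero    = trans c-0 (sym X-0)
    c-closed (suc r) = trans (c-step r) (trans (*-congˡ (c-closed r)) (sym (X-suc r)))

    -- (-q;q)_n
    plus : ℕ → Carrier
    plus zero    = 1#
    plus (suc n) = plus n * (1# + X (suc n))

    plus² : ∀ n → plus n * plus n ≈ Q n * Q n
    plus² zero    = refl
    plus² (suc n) = begin
      plus n * (1# + x) * (plus n * (1# + x))
        ≈⟨ solve 2 (λ p x → p ⊗ (𝟙 ⊕ x) ⊗ (p ⊗ (𝟙 ⊕ x)) ⊜ p ⊗ p ⊗ ((𝟙 ⊖ x) ⊗ (𝟙 ⊖ x)) ⊕ (𝟙 ⊕ 𝟙 ⊕ (𝟙 ⊕ 𝟙)) ⊗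
            (p ⊗ p ⊗ x)) refl (plus n) x ⟩
      plus n * plus n * ((1# - x) * (1# - x)) + (1# + 1# + (1# + 1#)) * (plus n * plus n * x)
        ≈⟨ +-cong (*-congʳ (plus² n)) (trans (*-congʳ 4≈0) (zeroˡ _)) ⟩
      Q n * Q n * ((1# - x) * (1# - x)) + 0#
        ≈⟨ +-identityʳ _ ⟩
      Q n * Q n * ((1# - x) * (1# - x))
        ≈⟨ solve 2 (λ p x → p ⊗ p ⊗ ((𝟙 ⊖ x) ⊗ (𝟙 ⊖ x)) ⊜ p ⊗ (𝟙 ⊖ x) ⊗ (p ⊗ (𝟙 ⊖ x))) refl (Q n) x ⟩
      Q n * (1# - x) * (Q n * (1# - x)) ∎
      where
        x = X (suc n)

    -- Inserting the Bailey pair and exchanging the sums isolates `c r`. Of its denominator (1 -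
    -- q^(r+1))² one factor is cancelled by 1 - q^(2r+2) = (1 + q^(r+1))(1 - q^(r+1)), which comes
    -- from `t`.
    hecke : sum K (λ n → plus n * plus n * (X n * b n)) ≈ sum K (λ r → sgn r * (X r * A r) * ((1# + X (suc r)) * g r))
    hecke = begin
      sum K (λ n → plus n * plus n * (X n * b n))
        ≈⟨ sum-cong K (λ n n≤K → *-cong (plus² n) (*-congˡ (bailey-pair K n n≤K))) ⟩
      sum K (λ n → Q n * Q n * (X n * P K n))
        ≈⟨ sum-cong K (λ n _ → trans (sym (*-assoc _ _ _)) (sym (sum-*ˡ K (Q n * Q n * X n) _))) ⟩
      sum K (λ n → sum K (λ r → Q n * Q n * X n * (t n r * A r)))
        ≈⟨ sum-swap K K _ ⟩
      sum K (λ r → sum K (λ n → Q n * Q n * X n * (t n r * A r)))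
        ≈⟨ sum-cong K (λ r _ → trans (sum-cong K (λ n _ → rearrange n r)) (sum-*ˡ K
            (sgn r * A r * (1# - X (2 ℕ.+ (r ℕ.+ r)))) _)) ⟩
      sum K (λ r → sgn r * A r * (1# - X (2 ℕ.+ (r ℕ.+ r))) * c r)
        ≈⟨ sum-cong K (λ r _ → summand r) ⟩
      sum K (λ r → sgn r * (X r * A r) * ((1# + X (suc r)) * g r)) ∎
      where
      rearrange : ∀ n r → Q n * Q n * X n * (t n r * A r) ≈ sgn r * A r * (1# - X (2 ℕ.+ (r ℕ.+ r))) * κ n r
      rearrange n r = solve 7 (λ Q x s e j i a → Q ⊗ Q ⊗ x ⊗ (s ⊗ e ⊗ j ⊗ i ⊗ a) ⊜ s ⊗ a ⊗ e ⊗ (x ⊗ (Q ⊗ Q) ⊗ j ⊗ i)) refl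
        (Q n) (X n) (sgn r) (1# - X (2 ℕ.+ (r ℕ.+ r))) (J n r) (iQ (2 ℕ.+ (n ℕ.+ r))) (A r)
      square : ∀ r → 1# - X (2 ℕ.+ (r ℕ.+ r)) ≈ (1# + X (suc r)) * (1# - X (suc r))
      square r = trans (1-cong (trans (reflexive (cong X (cong suc (≡.sym (ℕₚ.+-suc r r))))) (X-+ (suc r) (suc r))))
        (solve 1 (λ y → 𝟙 ⊖ y ⊗ y ⊜ (𝟙 ⊕ y) ⊗ (𝟙 ⊖ y)) refl (X (suc r)))
      summand : ∀ r → sgn r * A r * (1# - X (2 ℕ.+ (r ℕ.+ r))) * c r ≈ sgn r * (X r * A r) * ((1# + X (suc r)) * g r)
      summand r = begin
        sgn r * A r * (1# - X (2 ℕ.+ (r ℕ.+ r))) * c r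
          ≈⟨ *-congʳ (*-congˡ (square r)) ⟩
        sgn r * A r * ((1# + y) * (1# - y)) * c r
          ≈⟨ *-identityʳ _ ⟨
        sgn r * A r * ((1# + y) * (1# - y)) * c r * 1#
          ≈⟨ *-congˡ (inverse r) ⟨
        sgn r * A r * ((1# + y) * (1# - y)) * c r * ((1# - y) * g r)
          ≈⟨ solve 5 (λ s a y c g → s ⊗ a ⊗ ((𝟙 ⊕ y) ⊗ (𝟙 ⊖ y)) ⊗ c ⊗ ((𝟙 ⊖ y) ⊗ g) ⊜ s ⊗ a ⊗ (𝟙 ⊕ y) ⊗ g ⊗
              ((𝟙 ⊖ y) ⊗ (𝟙 ⊖ y) ⊗ c)) refl (sgn r) (A r) y (c r) (g r) ⟩
        sgn r * A r * (1# + y) * g r * ((1# - y) * (1# - y) * c r)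
          ≈⟨ *-congˡ (c-closed r) ⟩
        sgn r * A r * (1# + y) * g r * X r
          ≈⟨ solve 5 (λ s a y g x → s ⊗ a ⊗ (𝟙 ⊕ y) ⊗ g ⊗ x ⊜ s ⊗ (x ⊗ a) ⊗ ((𝟙 ⊕ y) ⊗ g)) refl (sgn r) (A r) y (g r) (X r) ⟩
        sgn r * (X r * A r) * ((1# + y) * g r) ∎
        where
          y = X (suc r)

    -- Multiplication by q turns the factor q^(2r+2) in the recurrence of `A` into q^(2r+3), the
    -- step of `E` from r to r+1; the inhomogeneous term supplies the new summand j = r+1.
    X-A : ∀ r → X r * A r ≈ sum r (λ j → X (E r j))
    X-A zero    = *-identityʳ (X 0)
    X-A (suc r) = begin
      X (suc r) * (X (2 ℕ.+ (r ℕ.+ r)) * A r + X (tri (suc r)))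
        ≈⟨ *-congʳ (X-suc r) ⟩
      q * X r * (X (2 ℕ.+ (r ℕ.+ r)) * A r + X (tri (suc r)))
        ≈⟨ solve 5 (λ q x z a y → q ⊗ x ⊗ (z ⊗ a ⊕ y) ⊜ q ⊗ z ⊗ (x ⊗ a) ⊕ q ⊗ x ⊗ y) refl q (X r) (X
            (2 ℕ.+ (r ℕ.+ r))) (A r) (X (tri (suc r))) ⟩
      q * X (2 ℕ.+ (r ℕ.+ r)) * (X r * A r) + q * X r * X (tri (suc r))
        ≈⟨ +-cong (*-cong (sym (X-suc (2 ℕ.+ (r ℕ.+ r)))) (X-A r))
             (trans (*-congʳ (sym (X-suc r))) (trans (sym (X-+ (suc r) (tri (suc r)))) (reflexive
                 (cong X (≡.sym (E-diagonal (suc r))))))) ⟩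
      X (3 ℕ.+ (r ℕ.+ r)) * sum r (λ j → X (E r j)) + X (E (suc r) (suc r))
        ≈⟨ +-congʳ (trans (sym (sum-*ˡ r _ _)) (sum-cong r (λ j j≤r →
             trans (sym (X-+ (3 ℕ.+ (r ℕ.+ r)) (E r j))) (reflexive (cong X (≡.sym (E-suc j≤r))))))) ⟩
      sum r (λ j → X (E (suc r) j)) + X (E (suc r) (suc r)) ∎

    2-sgn : ∀ r → (1# + 1#) * sgn r ≈ 1# + 1#
    2-sgn zero    = *-identityʳ (1# + 1#)
    2-sgn (suc r) = begin
      (1# + 1#) * (- sgn r)    ≈⟨ solve 2 (λ o s → o ⊗ (⊝ s) ⊜ ⊝ (o ⊗ s)) refl (1# + 1#) (sgn r) ⟩
      - ((1# + 1#) * sgn r)    ≈⟨ -‿cong (2-sgn r) ⟩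
      - (1# + 1#)              ≈⟨ solve 1 (λ o → ⊝ (o ⊕ o) ⊜ o ⊕ o ⊖ (o ⊕ o ⊕ (o ⊕ o))) refl 1# ⟩
      1# + 1# - (1# + 1# + (1# + 1#))  ≈⟨ -‿vanish 4≈0 ⟩
      1# + 1#                  ∎

    -- With y = q^(r+1), (1+y)/(1-y) = 1 + 2y/(1-y). The 1 gives the forms with equal outer
    -- coefficients, the other term the remaining ones; there the sign disappears because 2 = -2
    -- modulo 4.
    hecke-mod-4 : sum K (λ n → plus n * plus n * (X n * b n)) ≈
      sum K (λ r → sgn r * sum r (λ j → X (E r j))) + (1# + 1#) * sum K (λ r → sum r (λ j → X (E r j ℕ.+ suc r) * g r))
    hecke-mod-4 = begin
      sum K (λ n → plus n * plus n * (X n * b n))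
        ≈⟨ hecke ⟩
      sum K (λ r → sgn r * (X r * A r) * ((1# + X (suc r)) * g r))
        ≈⟨ sum-cong K (λ r _ → summand r) ⟩
      sum K (λ r → sgn r * Σ r + (1# + 1#) * sum r (λ j → X (E r j ℕ.+ suc r) * g r))
        ≈⟨ sum-+ K _ _ ⟩
      sum K (λ r → sgn r * Σ r) + sum K (λ r → (1# + 1#) * sum r (λ j → X (E r j ℕ.+ suc r) * g r))
        ≈⟨ +-congˡ (sum-*ˡ K (1# + 1#) _) ⟩
      sum K (λ r → sgn r * Σ r) + (1# + 1#) * sum K (λ r → sum r (λ j → X (E r j ℕ.+ suc r) * g r)) ∎
      where
      Σ : ℕ → Carrier
      Σ r = sum r (λ j → X (E r j))
      summand : ∀ r → sgn r * (X r * A r) * ((1# + X (suc r)) * g r) ≈ sgn r * Σ r + (1# + 1#) * sum r (λ j → X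
          (E r j ℕ.+ suc r) * g r)
      summand r = begin
        sgn r * (X r * A r) * ((1# + y) * g r)
          ≈⟨ *-congʳ (*-congˡ (X-A r)) ⟩
        sgn r * Σ r * ((1# + y) * g r)
          ≈⟨ solve 4 (λ s a y g → s ⊗ a ⊗ ((𝟙 ⊕ y) ⊗ g) ⊜ s ⊗ a ⊗ ((𝟙 ⊖ y) ⊗ g) ⊕ (𝟙 ⊕ 𝟙) ⊗ s ⊗ (a ⊗ (y ⊗ g))) refl
              (sgn r) (Σ r) y (g r) ⟩
        sgn r * Σ r * ((1# - y) * g r) + (1# + 1#) * sgn r * (Σ r * (y * g r))
          ≈⟨ +-cong (trans (*-congˡ (inverse r)) (*-identityʳ _)) (*-cong (2-sgn r) (trans (sym (sum-*ʳ r (y * g r) _))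
               (sum-cong r (λ j _ → trans (sym (*-assoc _ _ _)) (*-congʳ (sym (X-+ (E r j) (suc r)))))))) ⟩
        sgn r * Σ r + (1# + 1#) * sum r (λ j → X (E r j ℕ.+ suc r) * g r) ∎
        where
          y = X (suc r)

-- Coefficient extraction: the value of v modulo 4 as a count

module Coefficients where

  open import Defs
  open Triangular
  open PowerSeries
  open QSeries
  open import Algebra.Bundles using (CommutativeRing)
  open import Data.Bool using (Bool; if_then_else_)
  open import Data.Nat as ℕ using (ℕ; zero; suc; _∸_; s≤s; _%_)
  import Data.Nat.Properties as ℕₚ
  import Data.Nat.DivMod as ℕ
  open import Data.Integer as ℤ using (ℤ; +_)
  import Data.Integer.Properties as ℤₚ
  open import Data.Product using (_,_; _×_)
  open import Data.Empty using (⊥-elim)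
  open import Function using (_∘_)
  open import Relation.Nullary using (Dec; yes; no)
  open import Relation.Nullary.Decidable using (⌊_⌋; _×-dec_)
  open import Relation.Binary.PropositionalEquality hiding (J)

  timesQ : Series → Series
  timesQ f zero    = + 0
  timesQ f (suc m) = f m

  timesQ-⊛ : ∀ f h → timesQ f ⊛ h ≐ timesQ (f ⊛ h)
  timesQ-⊛ f h zero    = refl
  timesQ-⊛ f h (suc m) = trans (⊛-first (timesQ f) h m) (ℤₚ.+-identityˡ _)

  timesQ-cong : ∀ {f h} → f ≐ h → timesQ f ≐ timesQ h
  timesQ-cong e zero    = refl
  timesQ-cong e (suc m) = e m

  Xₛ : ℕ → Series
  Xₛ zero    = one
  Xₛ (suc k) = timesQ (Xₛ k)

  Xₛ-+ : ∀ m n → Xₛ (m ℕ.+ n) ≐ Xₛ m ⊛ Xₛ n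
  Xₛ-+ zero    n i = sym (one-⊛ (Xₛ n) i)
  Xₛ-+ (suc m) n i = trans (timesQ-cong (Xₛ-+ m n) i) (sym (timesQ-⊛ (Xₛ m) (Xₛ n) i))

  Xₛ-⊛-< : ∀ k f {m} → m ℕ.< k → (Xₛ k ⊛ f) m ≡ + 0
  Xₛ-⊛-< (suc k) f {zero}  _         = refl
  Xₛ-⊛-< (suc k) f {suc m} (s≤s m<k) = trans (timesQ-⊛ (Xₛ k) f (suc m)) (Xₛ-⊛-< k f m<k)

  Xₛ-⊛-+ : ∀ k f m → (Xₛ k ⊛ f) (k ℕ.+ m) ≡ f m
  Xₛ-⊛-+ zero    f m = one-⊛ f m
  Xₛ-⊛-+ (suc k) f m = trans (timesQ-⊛ (Xₛ k) f (suc k ℕ.+ m)) (Xₛ-⊛-+ k f m)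

  Xₛ-diag : ∀ k → Xₛ k k ≡ + 1
  Xₛ-diag zero    = refl
  Xₛ-diag (suc k) = Xₛ-diag k

  Xₛ-off : ∀ {k m} → k ≢ m → Xₛ k m ≡ + 0
  Xₛ-off {zero}  {zero}  k≢m = ⊥-elim (k≢m refl)
  Xₛ-off {zero}  {suc m} k≢m = refl
  Xₛ-off {suc k} {zero}  k≢m = refl
  Xₛ-off {suc k} {suc m} k≢m = Xₛ-off (k≢m ∘ cong suc)

  shift≐ : ∀ n f → shift n f ≐ Xₛ n ⊛ f
  shift≐ n f m with n ℕ.≤? m
  ... | yes n≤m = sym (trans (cong (Xₛ n ⊛ f) (sym (ℕₚ.m+[n∸m]≡n n≤m))) (Xₛ-⊛-+ n f (m ∸ n)))
  ... | no  n≰m = sym (Xₛ-⊛-< n f (ℕₚ.≰⇒> n≰m))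

  onePlusQ≐ : ∀ n → onePlusQ (suc n) ≐ one ⊞ Xₛ (suc n)
  onePlusQ≐ n zero    = refl
  onePlusQ≐ n (suc m) with suc n ℕₚ.≟ suc m
  ... | yes refl = sym (trans (ℤₚ.+-identityˡ _) (Xₛ-diag n))
  ... | no  n≢m  = sym (trans (ℤₚ.+-identityˡ _) (Xₛ-off (n≢m ∘ cong suc)))

  -- 1/(1 - q^{k+1})
  geom : ℕ → Series
  geom k m = if ⌊ m % suc k ℕₚ.≟ 0 ⌋ then + 1 else + 0

  geom-period : ∀ k m → geom k (suc k ℕ.+ m) ≡ geom k m
  geom-period k m = cong (λ r → if ⌊ r ℕₚ.≟ 0 ⌋ then + 1 else + 0)
    (trans (cong (_% suc k) (ℕₚ.+-comm (suc k) m)) (ℕ.[m+n]%n≡m%n m (suc k)))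

  geom-small : ∀ k {m} → m ℕ.< suc k → geom k m ≡ one m
  geom-small k {zero}  _   = refl
  geom-small k {suc m} m<k = cong (λ r → if ⌊ r ℕₚ.≟ 0 ⌋ then + 1 else + 0) (ℕ.m<n⇒m%n≡m m<k)

  ⊟-⊛ : ∀ f h → (⊟ f) ⊛ h ≐ ⊟ (f ⊛ h)
  ⊟-⊛ f h m = trans (sumTo-cong m (λ i _ → sym (negate (f i) (h (m ∸ i)))))
    (trans (sumTo-*ˡ m (ℤ.- + 1) _) (ℤₚ.-1*i≡-i _))
    where
    negate : ∀ a b → (ℤ.- + 1) ℤ.* (a ℤ.* b) ≡ ℤ.- a ℤ.* b
    negate a b = trans (ℤₚ.-1*i≡-i (a ℤ.* b)) (ℤₚ.neg-distribˡ-* a b)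

  -- Below degree k+1 the series `geom k` is 1; from there on, its periodicity makes the two terms
  -- cancel.
  geom-inverse : ∀ k → (one ⊞ ⊟ (Xₛ (suc k))) ⊛ geom k ≐ one
  geom-inverse k m = trans (⊛-distribʳ (geom k) one (⊟ (Xₛ (suc k))) m)
    (trans (cong₂ ℤ._+_ (one-⊛ (geom k) m) (⊟-⊛ (Xₛ (suc k)) (geom k) m)) (cases m))
    where
    cases : ∀ m → geom k m ℤ.+ ℤ.- ((Xₛ (suc k) ⊛ geom k) m) ≡ one m
    cases m with m ℕₚ.<? suc k
    ... | yes m<k = trans (cong₂ (λ a b → a ℤ.+ ℤ.- b) (geom-small k m<k) (Xₛ-⊛-< (suc k) (geom k) m<k)) (ℤₚ.+-identityʳ (one m))
    ... | no  m≮k = subst (λ i → geom k i ℤ.+ ℤ.- ((Xₛ (suc k) ⊛ geom k) i) ≡ one i) (ℕₚ.m+[n∸m]≡n (ℕₚ.≮⇒≥ m≮k))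
      (trans (cong₂ (λ a b → a ℤ.+ ℤ.- b) (geom-period k d) (Xₛ-⊛-+ (suc k) (geom k) d)) (ℤₚ.+-inverseʳ (geom k d)))
      where
        d = m ∸ suc k

  module Coefficient (N : ℕ) where

    open Truncated N

    truncated : TruncatedSeriesRing
    truncated = record
      { seriesRing = commutativeRing
      ; ι = record
        { ⟦_⟧ = constant
        ; +-homo = λ a b → ≐⇒≈ λ { zero → refl ; (suc m) → refl }
        ; *-homo = λ a b → ≐⇒≈ λ { zero → refl ; (suc m) → sym (trans (constant-⊛ a (constant b) (suc m)) (ℤₚ.*-zeroʳ a)) }
        ; -‿homo = λ a → ≐⇒≈ λ { zero → refl ; (suc m) → refl }
        ; 0-homo = ≐⇒≈ λ { zero → refl ; (suc m) → refl }
        ; 1-homo = ≐⇒≈ λ { zero → refl ; (suc m) → refl }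
        }
      ; X = Xₛ
      ; X-0 = ≐⇒≈ λ _ → refl
      ; X-+ = λ m n → ≐⇒≈ (Xₛ-+ m n)
      ; 4≈0 = coeffs λ { zero _ → + 1 , refl ; (suc m) _ → + 0 , refl }
      ; K = N
      ; X-K = coeffs λ m m≤N → ≡⇒≡₄ (Xₛ-off (ℕₚ.>⇒≢ (s≤s m≤N)))
      ; g = geom
      ; inverse = λ k → ≐⇒≈ (geom-inverse k)
      }

    open QIdentities truncated
    open CommutativeRing commutativeRing using (*-cong) renaming (refl to ≈-refl; sym to ≈-sym; trans to ≈-trans)

    sum-coeff : ∀ m f i → sum m f i ≡ sumTo m (λ n → f n i)
    sum-coeff zero    f i = refl
    sum-coeff (suc m) f i = cong (λ a → a ℤ.+ f (suc m) i) (sum-coeff m f i)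

    negQPoch≈ : ∀ n → negQPoch n ≈ plus n
    negQPoch≈ zero    = ≈-refl
    negQPoch≈ (suc n) = *-cong (negQPoch≈ n) (≐⇒≈ (onePlusQ≐ n))

    invQQ2≈ : ∀ n → invQQ2 n ≈ b n
    invQQ2≈ zero    = ≈-refl
    invQQ2≈ (suc n) = *-cong (invQQ2≈ n) (≐⇒≈ λ m → cong (λ k → geom k m) (cong (λ i → suc n ℕ.+ i) (ℕₚ.+-identityʳ (suc n))))

    term≈ : ∀ n → term n ≈ (plus n ⊛ plus n) ⊛ (Xₛ n ⊛ b n)
    term≈ n = *-cong (*-cong (negQPoch≈ n) (negQPoch≈ n)) (≈-trans (≐⇒≈ (shift≐ n (invQQ2 n))) (*-cong
        (≈-refl {Xₛ n}) (invQQ2≈ n)))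

    -- N = E r j + (r+1)(k+1) for some k ≥ 0
    Hit : ℕ → ℕ → Set
    Hit r j = E r j ℕ.+ suc r ℕ.≤ N × (N ∸ (E r j ℕ.+ suc r)) % suc r ≡ 0

    hit? : ∀ r j → Dec (Hit r j)
    hit? r j = (E r j ℕ.+ suc r ℕ.≤? N) ×-dec ((N ∸ (E r j ℕ.+ suc r)) % suc r ℕₚ.≟ 0)

    indicator : ℕ → ℕ → ℤ
    indicator r j = if ⌊ hit? r j ⌋ then + 1 else + 0

    indicator≡ : ∀ r j → (Xₛ (E r j ℕ.+ suc r) ⊛ geom r) N ≡ indicator r j
    indicator≡ r j with E r j ℕ.+ suc r ℕ.≤? N
    ... | no  e≰N = Xₛ-⊛-< (E r j ℕ.+ suc r) (geom r) (ℕₚ.≰⇒> e≰N)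
    ... | yes e≤N with (N ∸ (E r j ℕ.+ suc r)) % suc r ℕₚ.≟ 0 | trans (cong (Xₛ (E r j ℕ.+ suc r) ⊛ geom r)
        (sym (ℕₚ.m+[n∸m]≡n e≤N))) (Xₛ-⊛-+ (E r j ℕ.+ suc r) (geom r) (N ∸ (E r j ℕ.+ suc r)))
    ... | yes _ | e = e
    ... | no  _ | e = e

    sgn-coeff : ∀ r f → f N ≡ + 0 → (sgn r ⊛ f) N ≡ + 0
    sgn-coeff zero    f e = trans (one-⊛ f N) e
    sgn-coeff (suc r) f e = trans (⊟-⊛ (sgn r) f N) (cong ℤ.-_ (sgn-coeff r f e))

    -- The hypothesis says that no form has y = z. It removes the signed sum, and what remains is
    -- twice a count without signs.
    v-mod-4 : (∀ r j → j ℕ.≤ r → E r j ≢ N) → vℕ N ≡₄ + 2 ℤ.* sumTo N (λ r → sumTo r (indicator r))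
    v-mod-4 e≢N = ≡₄-trans (≡⇒≡₄ (sym (sum-coeff N term N)))
      (≡₄-trans (coeff (≈-trans (sum-cong N (λ n _ → term≈ n)) hecke-mod-4) N ℕₚ.≤-refl)
        (≡⇒≡₄ (trans (cong₂ ℤ._+_ vanishing doubled) (ℤₚ.+-identityˡ _))))
      where
      vanishing : sum N (λ r → sgn r ⊛ sum r (λ j → Xₛ (E r j))) N ≡ + 0
      vanishing = trans (sum-coeff N _ N) (trans (sumTo-cong N (λ r _ → sgn-coeff r (sum r (λ j → Xₛ (E r j)))
        (trans (sum-coeff r (λ j → Xₛ (E r j)) N) (trans (sumTo-cong r (λ j j≤r → Xₛ-off (e≢N r j j≤r)))
            (sumTo-0 r))))) (sumTo-0 N))
      H = sum N (λ r → sum r (λ j → Xₛ (E r j ℕ.+ suc r) ⊛ geom r))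
      H≡ : H N ≡ sumTo N (λ r → sumTo r (indicator r))
      H≡ = trans (sum-coeff N _ N) (sumTo-cong N (λ r _ → trans (sum-coeff r _ N) (sumTo-cong r (λ j _ → indicator≡ r j))))
      doubled : ((one ⊞ one) ⊛ H) N ≡ + 2 ℤ.* sumTo N (λ r → sumTo r (indicator r))
      doubled = trans (⊛-cong {g = H} two (λ _ → refl) N) (trans (constant-⊛ (+ 2) H N) (cong (λ a → + 2 ℤ.* a) H≡))
        where
        two : one ⊞ one ≐ constant (+ 2)
        two zero    = refl
        two (suc _) = refl

-- Residues modulo 8 and the quadratic character of 2

module Residues where

  open Triangular
  open import Data.Empty using (⊥; ⊥-elim)
  open import Data.Nat as ℕ using (ℕ; zero; suc; s≤s; z≤n; _%_; _/_)
  import Data.Nat.Properties as ℕₚ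
  import Data.Nat.DivMod as ℕ
  import Data.Nat.Divisibility as ℕ
  import Data.Nat.Tactic.RingSolver as ℕSolver
  open import Data.Nat.Induction using (<-rec)
  open import Data.Nat.Coprimality using (Coprime; coprime-Bézout)
  open import Data.Nat.GCD using (module Bézout)
  open import Data.Nat.Primality using (Prime; euclidsLemma; prime⇒irreducible)
  open import Data.Integer using (+_; -[1+_]; _+_; _*_; _-_; -_; ∣_∣)
  import Data.Integer.Properties as ℤₚ
  open import Data.Integer.Divisibility.Signed using (_∣_; divides; _∣?_; ∣⇒∣ᵤ; ∣ᵤ⇒∣)
  open import Data.Integer.Tactic.RingSolver using (solve-∀)
  open import Data.Product using (∃; ∃₂; _,_; _×_)
  open import Data.Sum using (_⊎_; inj₁; inj₂)
  open import Relation.Nullary using (¬_; Dec; yes; no)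
  open import Relation.Nullary.Decidable using (from-yes; _→-dec_)
  open import Relation.Binary.PropositionalEquality

  data ±3mod8 (n : ℕ) : Set where
    ≡3 : n % 8 ≡ 3 → ±3mod8 n
    ≡5 : n % 8 ≡ 5 → ±3mod8 n

  parity : ∀ n → (∃ λ h → n ≡ h ℕ.+ h) ⊎ (∃ λ h → n ≡ suc (h ℕ.+ h))
  parity zero    = inj₁ (0 , refl)
  parity (suc n) with parity n
  ... | inj₁ (h , e) = inj₂ (h , cong suc e)
  ... | inj₂ (h , e) = inj₁ (suc h , trans (cong suc e) (cong suc (sym (ℕₚ.+-suc h h))))

  even-%8 : ∀ h → (h ℕ.+ h) % 2 ≡ 0
  even-%8 h = trans (cong (_% 2) (double h)) (ℕ.m*n%n≡0 h 2)
    where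
    double : ∀ h → h ℕ.+ h ≡ h ℕ.* 2
    double = ℕSolver.solve-∀

  %8-%2 : ∀ n → n % 8 % 2 ≡ n % 2
  %8-%2 n = ℕ.m∣n⇒o%n%m≡o%m 2 8 n (ℕ.divides 4 refl)

  odd-part : ∀ {n} → ±3mod8 n → ∃ λ h → n ≡ suc (h ℕ.+ h)
  odd-part {n} n±3 with parity n
  ... | inj₂ odd       = odd
  ... | inj₁ (h , refl) = ⊥-elim (contra n±3)
    where
    contra : ±3mod8 (h ℕ.+ h) → ⊥
    contra (≡3 e) with () ← trans (sym (cong (_% 2) e)) (trans (%8-%2 (h ℕ.+ h)) (even-%8 h))
    contra (≡5 e) with () ← trans (sym (cong (_% 2) e)) (trans (%8-%2 (h ℕ.+ h)) (even-%8 h))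

  ±3-≥3 : ∀ {n} → ±3mod8 n → 3 ℕ.≤ n
  ±3-≥3 {0} (≡3 ())
  ±3-≥3 {0} (≡5 ())
  ±3-≥3 {1} (≡3 ())
  ±3-≥3 {1} (≡5 ())
  ±3-≥3 {2} (≡3 ())
  ±3-≥3 {2} (≡5 ())
  ±3-≥3 {suc (suc (suc n))} _ = s≤s (s≤s (s≤s z≤n))

  -- Modulo 8 the product of n and m is -1, which pairs the residue 3 with 5; a finite check over
  -- the residues confirms it.
  cofactor : ∀ {n m} → ±3mod8 n → (1 ℕ.+ n ℕ.* m) % 8 ≡ 0 → ±3mod8 m
  cofactor {n} {m} n±3 e = go n±3
    where
    inverse : ∀ a b → Dec (∀ {c} → c ℕ.< 8 → (1 ℕ.+ (a ℕ.* c) % 8) % 8 ≡ 0 → c ≡ b)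
    inverse a b = ℕₚ.allUpTo? (λ c → ((1 ℕ.+ (a ℕ.* c) % 8) % 8 ℕₚ.≟ 0) →-dec (c ℕₚ.≟ b)) 8
    reduce : ∀ {a} → n % 8 ≡ a → (1 ℕ.+ (a ℕ.* (m % 8)) % 8) % 8 ≡ 0
    reduce refl = trans (sym (trans (ℕ.%-distribˡ-+ 1 (n ℕ.* m) 8) (cong (λ k → (1 ℕ.+ k) % 8) (ℕ.%-distribˡ-* n m 8)))) e
    go : ±3mod8 n → ±3mod8 m
    go (≡3 h) = ≡5 (from-yes (inverse 3 5) (ℕ.m%n<n m 8) (reduce h))
    go (≡5 h) = ≡3 (from-yes (inverse 5 3) (ℕ.m%n<n m 8) (reduce h))

  odd-square : ∀ h → suc (h ℕ.+ h) ℕ.* suc (h ℕ.+ h) ≡ 1 ℕ.+ tri h ℕ.* 8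
  odd-square h = trans (expand h) (trans (cong (λ k → 1 ℕ.+ 4 ℕ.* k) (sym (tri-double h))) (regroup (tri h)))
    where
    expand : ∀ h → suc (h ℕ.+ h) ℕ.* suc (h ℕ.+ h) ≡ 1 ℕ.+ 4 ℕ.* (h ℕ.* suc h)
    expand = ℕSolver.solve-∀
    regroup : ∀ k → 1 ℕ.+ 4 ℕ.* (k ℕ.+ k) ≡ 1 ℕ.+ k ℕ.* 8
    regroup = ℕSolver.solve-∀

  -- Descent: if n ≡ ±3 (mod 8) divides x² - 2 with x odd and x ≤ n, then the cofactor m < n is again ≡ ±3 (mod 8).
  2-nonresidue : ∀ n → ±3mod8 n → ∀ x → ¬ (∃ λ m → x ℕ.* x ≡ 2 ℕ.+ n ℕ.* m)
  2-nonresidue = <-rec _ λ n rec n±3 x (m , e) →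
    let (h , n≡) = odd-part n±3
        nz : ℕ.NonZero n
        nz = ℕ.>-nonZero (ℕₚ.≤-trans (s≤s z≤n) (±3-≥3 n±3))
        (k , k≤n , m′ , e′) = odd-root n {{nz}} n±3 h n≡ x m e
    in descend n {{nz}} rec n±3 k k≤n m′ e′
    where
    descend : ∀ n .{{_ : ℕ.NonZero n}} → (∀ {m} → m ℕ.< n → ±3mod8 m → ∀ x → ¬ (∃ λ k → x ℕ.* x ≡ 2 ℕ.+ m ℕ.* k)) →
      ±3mod8 n → ∀ k → suc (k ℕ.+ k) ℕ.≤ n → ∀ m → suc (k ℕ.+ k) ℕ.* suc (k ℕ.+ k) ≡ 2 ℕ.+ n ℕ.* m → ⊥
    descend n rec n±3 k k≤n m e = rec m<n (cofactor {n} {m} n±3 mod8) (suc (k ℕ.+ k)) (n , trans e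
        (cong (2 ℕ.+_) (ℕₚ.*-comm n m)))
      where
      m<n : m ℕ.< n
      m<n = ℕₚ.*-cancelˡ-< n m n (ℕₚ.≤-trans (ℕₚ.n≤1+n _) (ℕₚ.≤-trans (ℕₚ.≤-reflexive (sym e)) (ℕₚ.*-mono-≤ k≤n k≤n)))
      mod8 : (1 ℕ.+ n ℕ.* m) % 8 ≡ 0
      mod8 = trans (cong (_% 8) (sym (ℕₚ.suc-injective (trans (sym (odd-square k)) e)))) (ℕ.m*n%n≡0 (tri k) 8)

    -- As n is odd, the remainder of x and its complement to n have opposite parities, so one of
    -- these two roots is odd, and neither exceeds n.
    odd-root : ∀ n .{{_ : ℕ.NonZero n}} → ±3mod8 n → ∀ h → n ≡ suc (h ℕ.+ h) → ∀ x m → x ℕ.* x ≡ 2 ℕ.+ n ℕ.* m →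
      ∃ λ k → suc (k ℕ.+ k) ℕ.≤ n × ∃ λ m → suc (k ℕ.+ k) ℕ.* suc (k ℕ.+ k) ≡ 2 ℕ.+ n ℕ.* m
    odd-root n n±3 h n≡ x m e with parity (x % n)
    ... | inj₂ (k , x≡) = k , subst (ℕ._≤ n) x≡ (ℕₚ.<⇒≤ (ℕ.m%n<n x n)) , subst
        (λ y → ∃ λ m → y ℕ.* y ≡ 2 ℕ.+ n ℕ.* m) x≡ (root (x % n) x₀²)
      where
      x₀² : (x % n ℕ.* (x % n)) % n ≡ 2
      x₀² = trans (sym (ℕ.%-distribˡ-* x x n)) (trans (cong (_% n) (trans e (cong (2 ℕ.+_) (ℕₚ.*-comm n m)))) (trans
          (ℕ.[m+kn]%n≡m%n 2 m n) (ℕ.m<n⇒m%n≡m (±3-≥3 n±3))))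
      root : ∀ y → (y ℕ.* y) % n ≡ 2 → ∃ λ m → y ℕ.* y ≡ 2 ℕ.+ n ℕ.* m
      root y y² = (y ℕ.* y) / n , trans (ℕ.m≡m%n+[m/n]*n (y ℕ.* y) n) (cong₂ ℕ._+_ y² (ℕₚ.*-comm _ n))
    ... | inj₁ (k , x≡) = d , d≤n , (suc (d ℕ.+ d) ℕ.* suc (d ℕ.+ d)) / n , trans (ℕ.m≡m%n+[m/n]*n _ n)
        (cong₂ ℕ._+_ d² (ℕₚ.*-comm _ n))
      where
      d = h ℕ.∸ k
      k≤h : k ℕ.≤ h
      k≤h = half (subst₂ ℕ._≤_ x≡ n≡ (ℕₚ.<⇒≤ (ℕ.m%n<n x n)))
        where
        half : k ℕ.+ k ℕ.≤ suc (h ℕ.+ h) → k ℕ.≤ h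
        half le with k ℕₚ.≤? h
        ... | yes p = p
        ... | no ¬p = ⊥-elim (ℕₚ.<⇒≱ (s≤s (ℕₚ.+-monoʳ-< h (ℕₚ.≰⇒> ¬p))) (ℕₚ.≤-trans (ℕₚ.+-monoˡ-≤ k (ℕₚ.≰⇒> ¬p)) le))
      split : n ≡ suc (d ℕ.+ d) ℕ.+ (k ℕ.+ k)
      split = trans n≡ (trans (cong (λ h → suc (h ℕ.+ h)) (sym (ℕₚ.m∸n+n≡m k≤h))) (regroup d k))
        where
        regroup : ∀ d k → suc (d ℕ.+ k ℕ.+ (d ℕ.+ k)) ≡ suc (d ℕ.+ d) ℕ.+ (k ℕ.+ k)
        regroup = ℕSolver.solve-∀
      d≤n : suc (d ℕ.+ d) ℕ.≤ n
      d≤n = subst (suc (d ℕ.+ d) ℕ.≤_) (sym split) (ℕₚ.m≤m+n _ _)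
      x₀² : ((k ℕ.+ k) ℕ.* (k ℕ.+ k)) % n ≡ 2
      x₀² = trans (cong (λ y → (y ℕ.* y) % n) (sym x≡)) (trans (sym (ℕ.%-distribˡ-* x x n)) (trans
          (cong (_% n) (trans e (cong (2 ℕ.+_) (ℕₚ.*-comm n m)))) (trans (ℕ.[m+kn]%n≡m%n 2 m n) (ℕ.m<n⇒m%n≡m (±3-≥3 n±3)))))
      -- With D = n - 2k, the multiple 2(2k)n is added to D² to avoid subtraction: D² + 2(2k)n =
      -- (2k)² + n².
      d² : (suc (d ℕ.+ d) ℕ.* suc (d ℕ.+ d)) % n ≡ 2
      d² = trans (sym (ℕ.[m+kn]%n≡m%n (D ℕ.* D) (2 ℕ.* (k ℕ.+ k)) n))
        (trans (cong (_% n) (trans (cong (λ n → D ℕ.* D ℕ.+ 2 ℕ.* (k ℕ.+ k) ℕ.* n) split) (trans (square D (k ℕ.+ k))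
            (cong (λ n → (k ℕ.+ k) ℕ.* (k ℕ.+ k) ℕ.+ n ℕ.* n) (sym split)))))
          (trans (ℕ.[m+kn]%n≡m%n ((k ℕ.+ k) ℕ.* (k ℕ.+ k)) n n) x₀²))
        where
        D = suc (d ℕ.+ d)
        square : ∀ a b → a ℕ.* a ℕ.+ 2 ℕ.* b ℕ.* (a ℕ.+ b) ≡ b ℕ.* b ℕ.+ (a ℕ.+ b) ℕ.* (a ℕ.+ b)
        square = ℕSolver.solve-∀

  prime-∣-* : ∀ {p} → Prime p → ∀ a b → + p ∣ a * b → (+ p ∣ a) ⊎ (+ p ∣ b)
  prime-∣-* {p} p-prime a b p∣ab with euclidsLemma ∣ a ∣ ∣ b ∣ p-prime (subst (p ℕ.∣_) (ℤₚ.abs-* a b) (∣⇒∣ᵤ p∣ab))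
  ... | inj₁ h = inj₁ (∣ᵤ⇒∣ h)
  ... | inj₂ h = inj₂ (∣ᵤ⇒∣ h)

  prime-inverse : ∀ {p} → Prime p → ∀ a → ¬ + p ∣ a → ∃₂ λ e k → a * e ≡ + 1 + + p * k
  prime-inverse {p} p-prime a p∤a = signed a (bezout (coprime-Bézout coprime))
    where
    coprime : Coprime ∣ a ∣ p
    coprime {d} (d∣a , d∣p) with prime⇒irreducible p-prime d∣p
    ... | inj₁ d≡1 = d≡1
    ... | inj₂ d≡p = ⊥-elim (p∤a (∣ᵤ⇒∣ (subst (ℕ._∣ ∣ a ∣) d≡p d∣a)))
    bezout : Bézout.Identity 1 ∣ a ∣ p → ∃₂ λ e k → + ∣ a ∣ * e ≡ + 1 + + p * k
    bezout (Bézout.+- x y eq) = + x , + y , trans (ℤₚ.*-comm (+ ∣ a ∣) (+ x))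
      (trans (sym (ℤₚ.pos-* x ∣ a ∣)) (trans (cong +_ (sym eq)) (cong (λ j → + 1 + j)
          (trans (ℤₚ.pos-* y p) (ℤₚ.*-comm (+ y) (+ p))))))
    bezout (Bézout.-+ x y eq) = - + x , - + y , (begin
      + ∣ a ∣ * (- + x)           ≡⟨ move (+ ∣ a ∣) (+ x) ⟩
      + 1 - (+ 1 + + x * + ∣ a ∣) ≡⟨ cong (λ k → + 1 - (+ 1 + k)) (ℤₚ.pos-* x ∣ a ∣) ⟨
      + 1 - + (1 ℕ.+ x ℕ.* ∣ a ∣) ≡⟨ cong (λ k → + 1 - + k) eq ⟩
      + 1 - + (y ℕ.* p)           ≡⟨ cong (λ j → + 1 - j) (ℤₚ.pos-* y p) ⟩
      + 1 - + y * + p             ≡⟨ back (+ y) (+ p) ⟩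
      + 1 + + p * (- + y)         ∎)
      where
      open ≡-Reasoning
      move : ∀ a x → a * (- x) ≡ + 1 - (+ 1 + x * a)
      move = solve-∀
      back : ∀ y p → + 1 - y * p ≡ + 1 + p * (- y)
      back = solve-∀
    signed : ∀ a → (∃₂ λ e k → + ∣ a ∣ * e ≡ + 1 + + p * k) → ∃₂ λ e k → a * e ≡ + 1 + + p * k
    signed (+ _)    h           = h
    signed -[1+ n ] (e , k , h) = - e , k , trans (neg (+ suc n) e) h
      where
      neg : ∀ a e → (- a) * (- e) ≡ a * e
      neg = solve-∀

  abs-square : ∀ a → a * a ≡ + (∣ a ∣ ℕ.* ∣ a ∣)
  abs-square (+ n)    = sym (ℤₚ.pos-* n n)
  abs-square -[1+ n ] = refl

  -- If p does not divide u, then s times an inverse of u would be a square root of 2 modulo p.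
  2u²≡s² : ∀ {p} → Prime p → ±3mod8 p → ∀ u s → + p ∣ + 2 * (u * u) - s * s → + p ∣ s
  2u²≡s² {p} p-prime p±3 u s (divides c eq) with + p ∣? u
  ... | yes (divides d refl) = collapse (prime-∣-* p-prime s s (divides (+ 2 * (d * d * + p) - c)
      (trans (isolate (+ 2 * (d * + p * (d * + p))) (s * s)) (trans (cong (λ k → + 2 * (d * + p * (d * + p)) - k) eq)
      (factor d (+ p) c)))))
    where
    collapse : (+ p ∣ s) ⊎ (+ p ∣ s) → + p ∣ s
    collapse (inj₁ h) = h
    collapse (inj₂ h) = h
    isolate : ∀ a b → b ≡ a - (a - b)
    isolate = solve-∀
    factor : ∀ d p c → + 2 * (d * p * (d * p)) - c * p ≡ (+ 2 * (d * d * p) - c) * p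
    factor = solve-∀
  ... | no p∤u with (e , k , ue≡1) ← prime-inverse p-prime u p∤u = ⊥-elim (natural c′ square)
    where
    c′ = + 4 * k + + 2 * + p * k * k - c * e * e
    square : s * e * (s * e) ≡ + 2 + + p * c′
    square = begin
      s * e * (s * e)
        ≡⟨ isolate u s e ⟩
      + 2 * (u * e * (u * e)) - (+ 2 * (u * u) - s * s) * (e * e)
        ≡⟨ cong₂ (λ a b → + 2 * (a * a) - b * (e * e)) ue≡1 eq ⟩
      + 2 * ((+ 1 + + p * k) * (+ 1 + + p * k)) - c * + p * (e * e)
        ≡⟨ expand (+ p) k c e ⟩
      + 2 + + p * c′ ∎
      where
      open ≡-Reasoning
      isolate : ∀ u s e → s * e * (s * e) ≡ + 2 * (u * e * (u * e)) - (+ 2 * (u * u) - s * s) * (e * e)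
      isolate = solve-∀
      expand : ∀ p k c e → + 2 * ((+ 1 + p * k) * (+ 1 + p * k)) - c * p * (e * e) ≡ + 2 + p *
          (+ 4 * k + + 2 * p * k * k - c * e * e)
      expand = solve-∀
    natural : ∀ c → s * e * (s * e) ≡ + 2 + + p * c → ⊥
    natural (+ c) h = 2-nonresidue p p±3 ∣ s * e ∣ (c , ℤₚ.+-injective (trans (sym (abs-square (s * e)))
        (trans h (cong (λ j → + 2 + j) (sym (ℤₚ.pos-* p c))))))
    -- A negative cofactor would give x² + p(c+1) = 2, impossible for p ≥ 3.
    natural -[1+ c ] h = ℕₚ.<⇒≱ (±3-≥3 p±3) (ℕₚ.≤-trans (ℕₚ.m≤m*n p (suc c)) (ℕₚ.≤-trans (ℕₚ.m≤n+m _ _) (ℕₚ.≤-reflexive total)))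
      where
      x² = ∣ s * e ∣ ℕ.* ∣ s * e ∣
      cancel : ∀ a b → + 2 + a * (- b) + a * b ≡ + 2
      cancel = solve-∀
      total : x² ℕ.+ p ℕ.* suc c ≡ 2
      total = ℤₚ.+-injective (trans (cong₂ _+_ (trans (sym (abs-square (s * e))) h) (ℤₚ.pos-* p (suc c))) (cancel
          (+ p) (+ suc c)))

-- Binary quadratic forms under Γ₀(2) and the exchange

module Forms where

  open import Data.Integer hiding (suc)
  import Data.Integer.Properties as ℤₚ
  open import Data.Integer.Tactic.RingSolver using (solve-∀)
  open import Relation.Binary.PropositionalEquality

  -- The quadratic form 2yX² + bXY + zY².
  record Form : Set where
    constructor form
    field y z b : ℤ

  -- The substitution X ↦ αX + βY, Y ↦ 2γX + δY.
  record Matrix : Set where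
    constructor matrix
    field α β γ δ : ℤ

  det : Matrix → ℤ
  det (matrix α β γ δ) = α * δ - + 2 * (β * γ)

  act : Matrix → Form → Form
  act (matrix α β γ δ) (form y z b) = form
    (y * (α * α) + b * (α * γ) + + 2 * (z * (γ * γ)))
    (+ 2 * (y * (β * β)) + b * (β * δ) + z * (δ * δ))
    (+ 4 * (y * (α * β)) + b * (α * δ + + 2 * (β * γ)) + + 4 * (z * (γ * δ)))

  -- This is the substitution X ↦ Y/√2, Y ↦ √2 X. Its determinant is -1, which is why b keeps its
  -- sign.
  swap : Form → Form
  swap (form y z b) = form z y b

  -- The negative of the usual discriminant, hence positive for definite forms.
  disc : Form → ℤ
  disc (form y z b) = + 8 * (y * z) - b * b

  _·_ : Matrix → Matrix → Matrix
  matrix α β γ δ · matrix α′ β′ γ′ δ′ =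
    matrix (α * α′ + + 2 * (β * γ′)) (α * β′ + β * δ′) (γ * α′ + δ * γ′) (+ 2 * (γ * β′) + δ * δ′)

  -- `inv` is the adjugate and `flip` is conjugation by `swap`, in coordinates where the lower left
  -- entry is 2γ.
  inv flip : Matrix → Matrix
  inv  (matrix α β γ δ) = matrix δ (- β) (- γ) α
  flip (matrix α β γ δ) = matrix δ γ β α

  form-≡ : ∀ {y z b y′ z′ b′} → y ≡ y′ → z ≡ z′ → b ≡ b′ → form y z b ≡ form y′ z′ b′
  form-≡ refl refl refl = refl

  act-· : ∀ m m′ x → act m′ (act m x) ≡ act (m · m′) x
  act-· (matrix α β γ δ) (matrix α′ β′ γ′ δ′) (form y z b) = form-≡
    (eq₁ y z b α β γ δ α′ γ′) (eq₂ y z b α β γ δ β′ δ′) (eq₃ y z b α β γ δ α′ β′ γ′ δ′)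
    where
    eq₁ : ∀ y z b α β γ δ α′ γ′ →
      (y * (α * α) + b * (α * γ) + + 2 * (z * (γ * γ))) * (α′ * α′)
      + (+ 4 * (y * (α * β)) + b * (α * δ + + 2 * (β * γ)) + + 4 * (z * (γ * δ))) * (α′ * γ′)
      + + 2 * ((+ 2 * (y * (β * β)) + b * (β * δ) + z * (δ * δ)) * (γ′ * γ′))
      ≡ y * ((α * α′ + + 2 * (β * γ′)) * (α * α′ + + 2 * (β * γ′)))
      + b * ((α * α′ + + 2 * (β * γ′)) * (γ * α′ + δ * γ′))
      + + 2 * (z * ((γ * α′ + δ * γ′) * (γ * α′ + δ * γ′)))
    eq₁ = solve-∀
    eq₂ : ∀ y z b α β γ δ β′ δ′ →
      + 2 * ((y * (α * α) + b * (α * γ) + + 2 * (z * (γ * γ))) * (β′ * β′))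
      + (+ 4 * (y * (α * β)) + b * (α * δ + + 2 * (β * γ)) + + 4 * (z * (γ * δ))) * (β′ * δ′)
      + (+ 2 * (y * (β * β)) + b * (β * δ) + z * (δ * δ)) * (δ′ * δ′)
      ≡ + 2 * (y * ((α * β′ + β * δ′) * (α * β′ + β * δ′)))
      + b * ((α * β′ + β * δ′) * (+ 2 * (γ * β′) + δ * δ′))
      + z * ((+ 2 * (γ * β′) + δ * δ′) * (+ 2 * (γ * β′) + δ * δ′))
    eq₂ = solve-∀
    eq₃ : ∀ y z b α β γ δ α′ β′ γ′ δ′ →
      + 4 * ((y * (α * α) + b * (α * γ) + + 2 * (z * (γ * γ))) * (α′ * β′))
      + (+ 4 * (y * (α * β)) + b * (α * δ + + 2 * (β * γ)) + + 4 * (z * (γ * δ))) * (α′ * δ′ + + 2 * (β′ * γ′))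
      + + 4 * ((+ 2 * (y * (β * β)) + b * (β * δ) + z * (δ * δ)) * (γ′ * δ′))
      ≡ + 4 * (y * ((α * α′ + + 2 * (β * γ′)) * (α * β′ + β * δ′)))
      + b * ((α * α′ + + 2 * (β * γ′)) * (+ 2 * (γ * β′) + δ * δ′) + + 2 * ((α * β′ + β * δ′) * (γ * α′ + δ * γ′)))
      + + 4 * (z * ((γ * α′ + δ * γ′) * (+ 2 * (γ * β′) + δ * δ′)))
    eq₃ = solve-∀

  det-· : ∀ m m′ → det (m · m′) ≡ det m * det m′
  det-· (matrix α β γ δ) (matrix α′ β′ γ′ δ′) = eq α β γ δ α′ β′ γ′ δ′
    where
    eq : ∀ α β γ δ α′ β′ γ′ δ′ →
      (α * α′ + + 2 * (β * γ′)) * (+ 2 * (γ * β′) + δ * δ′) - + 2 * ((α * β′ + β * δ′) * (γ * α′ + δ * γ′))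
      ≡ (α * δ - + 2 * (β * γ)) * (α′ * δ′ - + 2 * (β′ * γ′))
    eq = solve-∀

  det-inv : ∀ m → det (inv m) ≡ det m
  det-inv (matrix α β γ δ) = eq α β γ δ
    where
    eq : ∀ α β γ δ → δ * α - + 2 * ((- β) * (- γ)) ≡ α * δ - + 2 * (β * γ)
    eq = solve-∀

  det-flip : ∀ m → det (flip m) ≡ det m
  det-flip (matrix α β γ δ) = eq α β γ δ
    where
    eq : ∀ α β γ δ → δ * α - + 2 * (γ * β) ≡ α * δ - + 2 * (β * γ)
    eq = solve-∀

  act-flip : ∀ m x → act (flip m) (swap x) ≡ swap (act m x)
  act-flip (matrix α β γ δ) (form y z b) = form-≡ (eq₁ y z b β δ) (eq₂ y z b α γ) (eq₃ y z b α β γ δ)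
    where
    eq₁ : ∀ y z b β δ → z * (δ * δ) + b * (δ * β) + + 2 * (y * (β * β)) ≡ + 2 * (y * (β * β)) + b * (β * δ) + z * (δ * δ)
    eq₁ = solve-∀
    eq₂ : ∀ y z b α γ → + 2 * (z * (γ * γ)) + b * (γ * α) + y * (α * α) ≡ y * (α * α) + b * (α * γ) + + 2 * (z * (γ * γ))
    eq₂ = solve-∀
    eq₃ : ∀ y z b α β γ δ → + 4 * (z * (δ * γ)) + b * (δ * α + + 2 * (γ * β)) + + 4 * (y * (β * α))
      ≡ + 4 * (y * (α * β)) + b * (α * δ + + 2 * (β * γ)) + + 4 * (z * (γ * δ))
    eq₃ = solve-∀

  act-inv : ∀ m x → det m ≡ + 1 → act (inv m) (act m x) ≡ x
  act-inv m@(matrix α β γ δ) x@(form y z b) det≡1 = trans (act-· m (inv m) x)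
    (form-≡ (trans (eq₁ y z b α β γ δ) (unit y)) (trans (eq₂ y z b α β γ δ) (unit z)) (trans (eq₃ y z b α β γ δ) (unit b)))
    where
    D = det m
    unit : ∀ a → a * (D * D) ≡ a
    unit a = trans (cong (λ d → a * (d * d)) det≡1) (ℤₚ.*-identityʳ a)
    eq₁ : ∀ y z b α β γ δ →
      y * ((α * δ + + 2 * (β * - γ)) * (α * δ + + 2 * (β * - γ))) + b * ((α * δ + + 2 * (β * - γ)) * (γ * δ + δ * - γ))
      + + 2 * (z * ((γ * δ + δ * - γ) * (γ * δ + δ * - γ)))
      ≡ y * ((α * δ - + 2 * (β * γ)) * (α * δ - + 2 * (β * γ)))
    eq₁ = solve-∀
    eq₂ : ∀ y z b α β γ δ →
      + 2 * (y * ((α * - β + β * α) * (α * - β + β * α))) + b * ((α * - β + β * α) * (+ 2 * (γ * - β) + δ * α))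
      + z * ((+ 2 * (γ * - β) + δ * α) * (+ 2 * (γ * - β) + δ * α))
      ≡ z * ((α * δ - + 2 * (β * γ)) * (α * δ - + 2 * (β * γ)))
    eq₂ = solve-∀
    eq₃ : ∀ y z b α β γ δ →
      + 4 * (y * ((α * δ + + 2 * (β * - γ)) * (α * - β + β * α)))
      + b * ((α * δ + + 2 * (β * - γ)) * (+ 2 * (γ * - β) + δ * α) + + 2 * ((α * - β + β * α) * (γ * δ + δ * - γ)))
      + + 4 * (z * ((γ * δ + δ * - γ) * (+ 2 * (γ * - β) + δ * α)))
      ≡ b * ((α * δ - + 2 * (β * γ)) * (α * δ - + 2 * (β * γ)))
    eq₃ = solve-∀

  disc-swap : ∀ x → disc (swap x) ≡ disc x
  disc-swap (form y z b) = cong (λ k → + 8 * k - b * b) (ℤₚ.*-comm z y)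

  infix 4 _~_
  -- By `act-flip` the exchange normalises Γ₀(2), so the group they generate is the union of two
  -- cosets, one for each constructor.
  data _~_ (x x′ : Form) : Set where
    plain   : ∀ m → det m ≡ + 1 → x′ ≡ act m x → x ~ x′
    swapped : ∀ m → det m ≡ + 1 → x′ ≡ swap (act m x) → x ~ x′

  det-·-1 : ∀ m m′ → det m ≡ + 1 → det m′ ≡ + 1 → det (m · m′) ≡ + 1
  det-·-1 m m′ d d′ = trans (det-· m m′) (cong₂ _*_ d d′)

  ~-trans : ∀ {x x′ x″} → x ~ x′ → x′ ~ x″ → x ~ x″
  ~-trans {x} (plain m d refl) (plain m′ d′ refl) = plain (m · m′) (det-·-1 m m′ d d′) (act-· m m′ x)
  ~-trans {x} (plain m d refl) (swapped m′ d′ refl) = swapped (m · m′) (det-·-1 m m′ d d′) (cong swap (act-· m m′ x))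
  ~-trans {x} (swapped m d refl) (plain m′ d′ refl) =
    swapped (m · flip m′) (det-·-1 m (flip m′) d (trans (det-flip m′) d′)) (trans (act-flip (flip m′) (act m x))
        (cong swap (act-· m (flip m′) x)))
  ~-trans {x} (swapped m d refl) (swapped m′ d′ refl) =
    plain (m · flip m′) (det-·-1 m (flip m′) d (trans (det-flip m′) d′)) (trans
        (cong swap (act-flip (flip m′) (act m x))) (act-· m (flip m′) x))

  ~-sym : ∀ {x x′} → x ~ x′ → x′ ~ x
  ~-sym {x} (plain m d refl) = plain (inv m) (trans (det-inv m) d) (sym (act-inv m x d))
  ~-sym {x} (swapped m d refl) = swapped (flip (inv m)) (trans (det-flip (inv m)) (trans (det-inv m) d))
    (sym (trans (cong swap (act-flip (inv m) (act m x))) (act-inv m x d)))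

  swap-~ : ∀ x → x ~ swap x
  swap-~ (form y z b) = swapped (matrix (+ 1) (+ 0) (+ 0) (+ 1)) refl (form-≡ (eq₁ z y b) (eq₂ y z b) (eq₃ y z b))
    where
    eq₁ : ∀ z y b → z ≡ + 2 * (y * (+ 0 * + 0)) + b * (+ 0 * + 1) + z * (+ 1 * + 1)
    eq₁ = solve-∀
    eq₂ : ∀ y z b → y ≡ y * (+ 1 * + 1) + b * (+ 1 * + 0) + + 2 * (z * (+ 0 * + 0))
    eq₂ = solve-∀
    eq₃ : ∀ y z b → b ≡ + 4 * (y * (+ 1 * + 0)) + b * (+ 1 * + 1 + + 2 * (+ 0 * + 0)) + + 4 * (z * (+ 0 * + 1))
    eq₃ = solve-∀

  ~-refl : ∀ {x} → x ~ x
  ~-refl {x} = ~-trans (swap-~ x) (swap-~ (swap x))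

  -- The effect of X ↦ X + kY. The change of b is a multiple of 4, so the condition b ≡ 1 (mod 4) is
  -- preserved.
  translate : ℤ → Form → Form
  translate k (form y z b) = form y (+ 2 * (y * (k * k)) + b * k + z) (+ 4 * (y * k) + b)

  translate-~ : ∀ k x → x ~ translate k x
  translate-~ k (form y z b) = plain (matrix (+ 1) k (+ 0) (+ 1)) (d k) (form-≡ (eq₁ y z b) (eq₂ y z b k) (eq₃ y z b k))
    where
    d : ∀ k → + 1 * + 1 - + 2 * (k * + 0) ≡ + 1
    d = solve-∀
    eq₁ : ∀ y z b → y ≡ y * (+ 1 * + 1) + b * (+ 1 * + 0) + + 2 * (z * (+ 0 * + 0))
    eq₁ = solve-∀
    eq₂ : ∀ y z b k → + 2 * (y * (k * k)) + b * k + z ≡ + 2 * (y * (k * k)) + b * (k * + 1) + z * (+ 1 * + 1)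
    eq₂ = solve-∀
    eq₃ : ∀ y z b k → + 4 * (y * k) + b ≡ + 4 * (y * (+ 1 * k)) + b * (+ 1 * + 1 + + 2 * (k * + 0)) + + 4 * (z * (+ 0 * + 1))
    eq₃ = solve-∀

  disc-translate : ∀ k x → disc (translate k x) ≡ disc x
  disc-translate k (form y z b) = eq k y z b
    where
    eq : ∀ k y z b → + 8 * (y * (+ 2 * (y * (k * k)) + b * k + z)) - (+ 4 * (y * k) + b) * (+ 4 *
        (y * k) + b) ≡ + 8 * (y * z) - b * b
    eq = solve-∀

-- Reduction theory: one reduced form in every class

module ReducedForms where

  open Residues using (abs-square)
  open Forms
  open import Data.Empty using (⊥; ⊥-elim)
  open import Data.Nat as ℕ using (ℕ; zero; suc; z≤n)
  import Data.Nat.Properties as ℕₚ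
  import Data.Nat.Divisibility as ℕ
  open import Data.Nat.Induction using (<-rec)
  open import Data.Integer hiding (suc; positive)
  open import Data.Integer.DivMod using (_%ℕ_; _/ℕ_; n%ℕd<d; a≡a%ℕn+[a/ℕn]*n)
  open import Data.Integer.Divisibility.Signed using (divides; ∣⇒∣ᵤ)
  import Data.Integer.Properties as ℤₚ
  open import Data.Integer.Tactic.RingSolver using (solve-∀)
  open import Data.Product using (∃; _,_; _×_)
  open import Data.Sum using (_⊎_; inj₁; inj₂)
  open import Relation.Nullary using (yes; no)
  open import Relation.Binary.PropositionalEquality

  0≤-* : ∀ {a b} → + 0 ≤ a → + 0 ≤ b → + 0 ≤ a * b
  0≤-* {+ m} {+ n} _ _ = subst (+ 0 ≤_) (ℤₚ.pos-* m n) (+≤+ z≤n)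

  0≤-+ : ∀ {a b} → + 0 ≤ a → + 0 ≤ b → + 0 ≤ a + b
  0≤-+ = ℤₚ.+-mono-≤

  0≤+ : ∀ {n} → + 0 ≤ + n
  0≤+ = +≤+ z≤n

  0≤-square : ∀ a → + 0 ≤ a * a
  0≤-square a = subst (+ 0 ≤_) (sym (abs-square a)) 0≤+

  0≤-square-1 : ∀ {a} → a ≢ + 0 → + 0 ≤ a * a - + 1
  0≤-square-1 {+ zero}   a≢0 = ⊥-elim (a≢0 refl)
  0≤-square-1 { +[1+ n ]} _  = 0≤+
  0≤-square-1 { -[1+ n ]} _  = 0≤+

  0≤-cancel : ∀ a {b} → + 0 ≤ a - + 1 → + 0 ≤ a * b → + 0 ≤ b
  0≤-cancel +[1+ m ] {+ n}       _ _ = 0≤+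
  0≤-cancel +[1+ m ] { -[1+ n ]} _ ()

  0≰negative : ∀ {a n} → + 0 ≤ a → a ≢ -[1+ n ]
  0≰negative () refl

  dichotomy : ∀ a → (+ 0 ≤ a) ⊎ (+ 0 ≤ - a - + 1)
  dichotomy (+ n)    = inj₁ 0≤+
  dichotomy -[1+ n ] = inj₂ 0≤+

  2∤1 : ∀ w → + 2 * w ≢ + 1
  2∤1 w e with () ← ℕ.∣1⇒≡1 (∣⇒∣ᵤ (divides w (trans (sym e) (ℤₚ.*-comm (+ 2) w))))

  unit-square : ∀ α δ → α * δ ≡ + 1 → α * α ≡ + 1
  unit-square α δ e = trans (abs-square α) (cong (λ n → + (n ℕ.* n)) (ℕₚ.m*n≡1⇒m≡1 ∣ α ∣ ∣ δ ∣
      (trans (sym (ℤₚ.abs-* α δ)) (cong ∣_∣ e))))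

  -- Strict inequalities have the shape `+ 0 ≤ a - + 1`, so that they can be added and multiplied as
  -- nonnegative quantities. The domain is open, since the forms in question never meet its walls.
  record Reduced (x : Form) : Set where
    constructor reduced
    open Form x
    field
      0<y   : + 0 ≤ y - + 1
      -2y<b : + 0 ≤ + 2 * y + b - + 1
      b<2y  : + 0 ≤ + 2 * y - b - + 1
      y<z   : + 0 ≤ z - y - + 1

  0≤-weaken : ∀ a → + 0 ≤ a - + 1 → + 0 ≤ a
  0≤-weaken a h = subst (+ 0 ≤_) (eq a) (0≤-+ h (0≤+ {1}))
    where
    eq : ∀ a → a - + 1 + + 1 ≡ a
    eq = solve-∀

  0<4* : ∀ y → + 0 ≤ y - + 1 → + 0 ≤ + 4 * y - + 1
  0<4* y h = subst (+ 0 ≤_) (eq y) (0≤-+ (0≤-* (0≤+ {4}) h) (0≤+ {3}))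
    where
    eq : ∀ y → + 4 * (y - + 1) + + 3 ≡ + 4 * y - + 1
    eq = solve-∀

  -- The value is affine in b, so it suffices to bound it at the endpoints b = ±2y of the allowed range.
  growth : ∀ {y z b α γ} → Reduced (form y z b) → γ ≢ + 0 →
    + 0 ≤ (y * (α * α) + b * (α * γ) + + 2 * (z * (γ * γ))) - y - + 1
  growth {y} {z} {b} {α} {γ} (reduced 0<y -2y<b b<2y y<z) γ≢0 =
    0≤-cancel (+ 4 * y) (0<4* y 0<y) (subst (+ 0 ≤_) (eq y z b α γ)
      (0≤-+ (0≤-* (0≤-weaken (+ 2 * y + b) -2y<b) (bound (α + γ))) (0≤-* (0≤-weaken (+ 2 * y - b) b<2y) (bound (α - γ)))))
    where
    eq₂ : ∀ y z → (z - y - + 1) + (z - y - + 1) + (y - + 1) + + 3 ≡ + 2 * z - y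
    eq₂ = solve-∀
    eq₃ : ∀ y z → (z - y - + 1) + (z - y - + 1) + + 1 ≡ + 2 * z - + 2 * y - + 1
    eq₃ = solve-∀
    bound : ∀ s → + 0 ≤ y * (s * s) + (+ 2 * z - y) * (γ * γ - + 1) + (+ 2 * z - + 2 * y - + 1)
    bound s = 0≤-+ (0≤-+ (0≤-* (0≤-weaken y 0<y) (0≤-square s))
      (0≤-* (subst (+ 0 ≤_) (eq₂ y z) (0≤-+ (0≤-+ (0≤-+ y<z y<z) 0<y) 0≤+)) (0≤-square-1 γ≢0)))
      (subst (+ 0 ≤_) (eq₃ y z) (0≤-+ (0≤-+ y<z y<z) 0≤+))
    eq : ∀ y z b α γ →
      (+ 2 * y + b) * (y * ((α + γ) * (α + γ)) + (+ 2 * z - y) * (γ * γ - + 1) + (+ 2 * z - + 2 * y - + 1))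
      + (+ 2 * y - b) * (y * ((α - γ) * (α - γ)) + (+ 2 * z - y) * (γ * γ - + 1) + (+ 2 * z - + 2 * y - + 1))
      ≡ + 4 * y * ((y * (α * α) + b * (α * γ) + + 2 * (z * (γ * γ))) - y - + 1)
    eq = solve-∀

  -- Again it suffices to look at b = ±2y, where the value is y((β ± δ)² + β²) + (z - y)δ². As δ ≠
  -- 0, the integers β and β ± δ are not both zero, so the bracket is at least 1.
  growth-swapped : ∀ {y z b β δ} → Reduced (form y z b) → δ ≢ + 0 →
    + 0 ≤ (+ 2 * (y * (β * β)) + b * (β * δ) + z * (δ * δ)) - y - + 1
  growth-swapped {y} {z} {b} {β} {δ} (reduced 0<y -2y<b b<2y y<z) δ≢0 =
    0≤-cancel (+ 4 * y) (0<4* y 0<y) (subst (+ 0 ≤_) (eq y z b β δ)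
      (0≤-+ (0≤-* (0≤-weaken (+ 2 * y + b) -2y<b) (bound δ (λ e → e))) (0≤-* (0≤-weaken (+ 2 * y - b) b<2y)
          (bound (- δ) λ e → trans (sym (ℤₚ.neg-involutive δ)) (cong -_ e)))))
    where
    reorder : ∀ a b → b + (a - + 1) ≡ b + a - + 1
    reorder = solve-∀
    sum-squares : ∀ s → (s ≡ + 0 → δ ≡ + 0) → + 0 ≤ (β + s) * (β + s) + β * β - + 1
    sum-squares s h with β ≟ + 0
    ... | no  β≢0 = subst (+ 0 ≤_) (reorder (β * β) ((β + s) * (β + s))) (0≤-+ (0≤-square (β + s)) (0≤-square-1 β≢0))
    ... | yes refl = subst (+ 0 ≤_) (eq′ s) (0≤-square-1 λ e → δ≢0 (h e))
      where
      eq′ : ∀ s → s * s - + 1 ≡ (+ 0 + s) * (+ 0 + s) + + 0 * + 0 - + 1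
      eq′ = solve-∀
    bound : ∀ s → (s ≡ + 0 → δ ≡ + 0) → + 0 ≤ y * ((β + s) * (β + s) + β * β - + 1) + (z - y - + 1) * (δ * δ) + (δ * δ - + 1)
    bound s h = 0≤-+ (0≤-+ (0≤-* (0≤-weaken y 0<y) (sum-squares s h)) (0≤-* y<z (0≤-square δ))) (0≤-square-1 δ≢0)
    eq : ∀ y z b β δ →
      (+ 2 * y + b) * (y * ((β + δ) * (β + δ) + β * β - + 1) + (z - y - + 1) * (δ * δ) + (δ * δ - + 1))
      + (+ 2 * y - b) * (y * ((β + - δ) * (β + - δ) + β * β - + 1) + (z - y - + 1) * (δ * δ) + (δ * δ - + 1))
      ≡ + 4 * y * ((+ 2 * (y * (β * β)) + b * (β * δ) + z * (δ * δ)) - y - + 1)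
    eq = solve-∀

  contradictory : ∀ a b → + 0 ≤ a - b - + 1 → + 0 ≤ b - a - + 1 → ⊥
  contradictory a b h k = 0≰negative (0≤-+ h k) (eq a b)
    where
    eq : ∀ a b → (a - b - + 1) + (b - a - + 1) ≡ -[1+ 1 ]
    eq = solve-∀

  δ≢0 : ∀ m → det m ≡ + 1 → Matrix.δ m ≢ + 0
  δ≢0 (matrix α β γ _) d refl = 2∤1 (- (β * γ)) (trans (eq α β γ) d)
    where
    eq : ∀ α β γ → + 2 * (- (β * γ)) ≡ α * + 0 - + 2 * (β * γ)
    eq = solve-∀

  -- A swapped equivalence, or a plain one with γ ≠ 0, strictly increases y. The inverse is of the
  -- same kind and would increase it back. What is left is ± a translation, and the strip for b
  -- allows only the trivial one.
  reduced-unique : ∀ {x x′} → Reduced x → Reduced x′ → x ~ x′ → x ≡ x′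
  reduced-unique {x} {x′} r r′ (swapped m d refl) =
    ⊥-elim (contradictory (Form.y x′) (Form.y x) (growth-swapped {β = β} r (δ≢0 m d)) (subst
        (λ k → + 0 ≤ k - Form.y x′ - + 1) y≡ (growth-swapped {β = - γ} r′ (δ≢0 m d))))
    where
    open Matrix m
    -- `flip (inv m)` carries x′ to `swap x` and has the same entry δ as `m`, so `growth-swapped`
    -- applies in the reverse direction too.
    y≡ : + 2 * (Form.y x′ * (- γ * - γ)) + Form.b x′ * (- γ * δ) + Form.z x′ * (δ * δ) ≡ Form.y x
    y≡ = cong Form.z (trans (act-flip (inv m) (act m x)) (cong swap (act-inv m x d)))
  reduced-unique {x} {x′} r r′ (plain m d refl) with Matrix.γ m ≟ + 0
  ... | no γ≢0 = ⊥-elim (contradictory (Form.y x′) (Form.y x) (growth {α = Matrix.α m} r γ≢0)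
      (subst (λ k → + 0 ≤ k - Form.y x′ - + 1) (cong Form.y (act-inv m x d))
        (growth {α = Matrix.δ m} r′ λ e → γ≢0 (trans (sym (ℤₚ.neg-involutive _)) (cong -_ e)))))
  reduced-unique {form y z b} (reduced 0<y l u y<z) (reduced _ l′ u′ _) (plain (matrix α β _ δ) d refl) | yes refl =
    form-≡ (sym y′≡y)
      (sym (trans (cong (λ β → + 2 * (y * (β * β)) + b * (β * δ) + z * (δ * δ)) β≡0)
        (trans (eq₂ y z b δ) (trans (cong (z *_) δ²≡1) (ℤₚ.*-identityʳ z)))))
      (sym (trans b′≡ (trans (cong (λ w → b + + 4 * y * w) αβ≡0) (eq₀ b y))))
    where
    eq₀ : ∀ b y → b + + 4 * y * + 0 ≡ b
    eq₀ = solve-∀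
    eq₁ : ∀ y z b α → y * (α * α) + b * (α * + 0) + + 2 * (z * (+ 0 * + 0)) ≡ y * (α * α)
    eq₁ = solve-∀
    eq₂ : ∀ y z b δ → + 2 * (y * (+ 0 * + 0)) + b * (+ 0 * δ) + z * (δ * δ) ≡ z * (δ * δ)
    eq₂ = solve-∀
    αδ≡1 : α * δ ≡ + 1
    αδ≡1 = trans (eq α β δ) d
      where
      eq : ∀ α β δ → α * δ ≡ α * δ - + 2 * (β * + 0)
      eq = solve-∀
    α²≡1 = unit-square α δ αδ≡1
    δ²≡1 = unit-square δ α (trans (ℤₚ.*-comm δ α) αδ≡1)
    y′≡y = trans (eq₁ y z b α) (trans (cong (y *_) α²≡1) (ℤₚ.*-identityʳ y))
    b′≡ : + 4 * (y * (α * β)) + b * (α * δ + + 2 * (β * + 0)) + + 4 * (z * (+ 0 * δ)) ≡ b + + 4 * y * (α * β)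
    b′≡ = trans (eq y z b α β δ) (trans (cong (λ k → b * k + + 4 * y * (α * β)) αδ≡1) (cong (_+ + 4 * y * (α * β))
        (ℤₚ.*-identityʳ b)))
      where
      eq : ∀ y z b α β δ → + 4 * (y * (α * β)) + b * (α * δ + + 2 * (β * + 0)) + + 4 * (z * (+ 0 * δ)) ≡ b *
          (α * δ) + + 4 * y * (α * β)
      eq = solve-∀
    0≤4y = 0≤-weaken (+ 4 * y) (0<4* y 0<y)
    -- The two values of b differ by 4y times αβ and lie in an open interval of length 4y.
    αβ≡0 : α * β ≡ + 0
    αβ≡0 = between (α * β) b′≡
      where
      above : ∀ w → + 0 ≤ w - + 1 → + 0 ≤ + 2 * y - (b + + 4 * y * w) - + 1 → ⊥
      above w h k = 0≰negative (0≤-+ (0≤-+ l (0≤-* 0≤4y h)) k) (eq y b w)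
        where
        eq : ∀ y b w → + 2 * y + b - + 1 + + 4 * y * (w - + 1) + (+ 2 * y - (b + + 4 * y * w) - + 1) ≡ -[1+ 1 ]
        eq = solve-∀
      below : ∀ w → + 0 ≤ - w - + 1 → + 0 ≤ + 2 * y + (b + + 4 * y * w) - + 1 → ⊥
      below w h k = 0≰negative (0≤-+ (0≤-+ u (0≤-* 0≤4y h)) k) (eq y b w)
        where
        eq : ∀ y b w → + 2 * y - b - + 1 + + 4 * y * (- w - + 1) + (+ 2 * y + (b + + 4 * y * w) - + 1) ≡ -[1+ 1 ]
        eq = solve-∀
      between : ∀ w → + 4 * (y * (α * β)) + b * (α * δ + + 2 * (β * + 0)) + + 4 * (z * (+ 0 * δ)) ≡ b + + 4 * y * w → w ≡ + 0
      between (+ zero)  _ = refl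
      between +[1+ n ]  e = ⊥-elim (above +[1+ n ] 0≤+ (subst₂ (λ y b → + 0 ≤ + 2 * y - b - + 1) y′≡y e u′))
      between -[1+ n ]  e = ⊥-elim (below -[1+ n ] 0≤+ (subst₂ (λ y b → + 0 ≤ + 2 * y + b - + 1) y′≡y e l′))
    β≡0 : β ≡ + 0
    β≡0 = trans (sym (ℤₚ.*-identityˡ β)) (trans (cong (_* β) (sym α²≡1)) (trans (ℤₚ.*-assoc α α β)
        (trans (cong (α *_) αβ≡0) (ℤₚ.*-zeroʳ α))))

  -- Writing the discriminant as `suc D` makes it visibly positive, so that y > 0 already means
  -- positive definite.
  record Admissible (D : ℕ) (x : Form) : Set where
    constructor admissible
    field
      positive : + 0 ≤ Form.y x - + 1
      disc≡    : disc x ≡ + suc D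
      b≡1      : ∃ λ i → Form.b x ≡ + 4 * i + + 1

  z-positive : ∀ {D x} → Admissible D x → + 0 ≤ Form.z x - + 1
  z-positive {D} {form +[1+ m ] +[1+ n ] b} _ = 0≤+
  z-positive {D} {form +[1+ m ] (+ zero) b} (admissible _ e _) =
    ⊥-elim (0≰negative (0≤-square b) (trans (eq (+ suc m) b) (cong (λ k → - k) e)))
    where
    eq : ∀ y b → b * b ≡ - (+ 8 * (y * + 0) - b * b)
    eq = solve-∀
  z-positive {D} {form +[1+ m ] -[1+ n ] b} (admissible _ e _) =
    ⊥-elim (0≰negative (0≤-+ (0≤-square b) (0≤-* (0≤+ {8}) (0≤-* (0≤+ {suc m}) (0≤+ {suc n})))) (trans
        (eq (+ suc m) (+ suc n) b) (cong (λ k → - k) e)))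
    where
    eq : ∀ y n b → b * b + + 8 * (y * n) ≡ - (+ 8 * (y * - n) - b * b)
    eq = solve-∀

  swap-admissible : ∀ {D x} → Admissible D x → Admissible D (swap x)
  swap-admissible {x = x} a = admissible (z-positive a) (trans (disc-swap x) (Admissible.disc≡ a)) (Admissible.b≡1 a)

  translate-admissible : ∀ {D x} k → Admissible D x → Admissible D (translate k x)
  translate-admissible {x = x} k (admissible p d (i , refl)) =
    admissible p (trans (disc-translate k x) d) (Form.y x * k + i , eq (Form.y x) k i)
    where
    eq : ∀ y k i → + 4 * (y * k) + (+ 4 * i + + 1) ≡ + 4 * (y * k + i) + + 1
    eq = solve-∀

  module Reduction (D : ℕ) (off-diagonal : ∀ y b → disc (form y y b) ≢ + suc D) where

    centre : ∀ x → Admissible D x → ∃ λ k → let b = Form.b (translate k x) ; y = Form.y x in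
      (+ 0 ≤ + 2 * y + b - + 1) × (+ 0 ≤ + 2 * y - b - + 1)
    centre x@(form y@(+[1+ m ]) z b) a = k , lower , upper
      where
      d = 4 ℕ.* suc m
      r = (b + + 2 * y) %ℕ d
      k = - ((b + + 2 * y) /ℕ d)
      b′≡ : + 4 * (y * k) + b ≡ + r - + 2 * y
      b′≡ = trans (eq₁ y k b) (trans (cong (λ s → s + + 4 * (y * k) - + 2 * y) (a≡a%ℕn+[a/ℕn]*n (b + + 2 * y) d))
        (trans (cong (λ s → + r + (b + + 2 * y) /ℕ d * s + + 4 * (y * k) - + 2 * y) (ℤₚ.pos-* 4 (suc m))) (eq₂ (+ r)
            ((b + + 2 * y) /ℕ d) y)))
        where
        eq₁ : ∀ y k b → + 4 * (y * k) + b ≡ b + + 2 * y + + 4 * (y * k) - + 2 * y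
        eq₁ = solve-∀
        eq₂ : ∀ r s y → r + s * (+ 4 * y) + + 4 * (y * - s) - + 2 * y ≡ r - + 2 * y
        eq₂ = solve-∀
      -- The remainder 0 would put the new b at -2y, but b is odd. This gives the strict lower
      -- bound.
      r≢0 : r ≢ 0
      r≢0 r≡0 = let (i , e) = Admissible.b≡1 (translate-admissible k a) in
        2∤1 (- y - + 2 * i) (trans (eq y i) (trans (cong (λ s → s - + 4 * i) (trans
            (cong (λ s → + s - + 2 * y) (sym r≡0)) (trans (sym b′≡) e))) (eq′ i)))
        where
        eq : ∀ y i → + 2 * (- y - + 2 * i) ≡ + 0 - + 2 * y - + 4 * i
        eq = solve-∀
        eq′ : ∀ i → + 4 * i + + 1 - + 4 * i ≡ + 1
        eq′ = solve-∀
      lower : + 0 ≤ + 2 * y + (+ 4 * (y * k) + b) - + 1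
      lower = subst (+ 0 ≤_) (sym (trans (cong (λ s → + 2 * y + s - + 1) b′≡) (eq y (+ r)))) (ℤₚ.i≤j⇒0≤j-i (+≤+ (ℕₚ.n≢0⇒n>0 r≢0)))
        where
        eq : ∀ y r → + 2 * y + (r - + 2 * y) - + 1 ≡ r - + 1
        eq = solve-∀
      upper : + 0 ≤ + 2 * y - (+ 4 * (y * k) + b) - + 1
      upper = subst (+ 0 ≤_) (sym (trans (cong (λ s → + 2 * y - s - + 1) b′≡) (trans (eq y (+ r))
          (cong (λ s → s - (+ 1 + + r)) (sym (ℤₚ.pos-* 4 (suc m))))))) (ℤₚ.i≤j⇒0≤j-i (+≤+ (n%ℕd<d (b + + 2 * y) d)))
        where
        eq : ∀ y r → + 2 * y - (r - + 2 * y) - + 1 ≡ + 4 * y - (+ 1 + r)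
        eq = solve-∀

    Reducible : Form → Set
    Reducible x = ∃ λ t → Reduced t × Admissible D t × x ~ t

    -- Gauss reduction by induction on y: after centring b, either y < z, or z < y and the exchange
    -- lowers y. Equality is ruled out by `off-diagonal`.
    reduce : ∀ x → Admissible D x → Reducible x
    reduce x a = <-rec (λ n → ∀ x → ∣ Form.y x ∣ ≡ n → Admissible D x → Reducible x) step ∣ Form.y x ∣ x refl a
      where
      step : ∀ n → (∀ {m} → m ℕ.< n → ∀ x → ∣ Form.y x ∣ ≡ m → Admissible D x → Reducible x) →
        ∀ x → ∣ Form.y x ∣ ≡ n → Admissible D x → Reducible x
      step n rec x refl a with (k , lower , upper) ← centre x a | dichotomy (Form.z (translate k x) - Form.y x - + 1)
      ... | inj₁ y<z = translate k x , reduced (Admissible.positive a) lower upper y<z , a′ , translate-~ k x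
        where
          a′ = translate-admissible k a
      ... | inj₂ z≤y =
        let (t , r , at , t~) = rec (smaller z′ (Form.y x) (z-positive a′) (Admissible.positive a) z≤y z′≢y) (swap
                (translate k x)) refl (swap-admissible a′)
        in t , r , at , ~-trans (translate-~ k x) (~-trans (swap-~ (translate k x)) t~)
        where
        z′ = Form.z (translate k x)
        a′ = translate-admissible k a
        z′≢y : z′ ≢ Form.y x
        z′≢y e = off-diagonal (Form.y x) (Form.b (translate k x))
          (trans (cong (λ z → disc (form (Form.y x) z (Form.b (translate k x)))) (sym e)) (Admissible.disc≡ a′))
        smaller : ∀ z y → + 0 ≤ z - + 1 → + 0 ≤ y - + 1 → + 0 ≤ - (z - y - + 1) - + 1 → z ≢ y → ∣ z ∣ ℕ.< ∣ y ∣
        smaller (+ z) (+ y) _ _ h z≢y = ℕₚ.≤∧≢⇒< (ℤₚ.drop‿+≤+ (ℤₚ.0≤i-j⇒j≤i (subst (+ 0 ≤_) (eq (+ z) (+ y)) h)))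
            (λ e → z≢y (cong +_ e))
          where
          eq : ∀ z y → - (z - y - + 1) - + 1 ≡ y - z
          eq = solve-∀

-- The Atkin-Lehner involution and its lack of fixed points

module Involution where

  open Residues
  open Forms
  open ReducedForms
  open import Data.Empty using (⊥; ⊥-elim)
  open import Data.Nat as ℕ using (ℕ; suc; z≤n; s≤s)
  import Data.Nat.Properties as ℕₚ
  import Data.Nat.Divisibility as ℕ
  import Data.Nat.DivMod as ℕ
  open import Data.Nat.Primality using (Prime)
  open import Data.Integer hiding (suc; positive)
  open import Data.Integer.DivMod using (_%ℕ_; _/ℕ_; n%ℕd<d; a≡a%ℕn+[a/ℕn]*n)
  open import Data.Integer.Divisibility.Signed using (_∣_; divides; _∣?_; ∣⇒∣ᵤ)
  import Data.Integer.Properties as ℤₚ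
  open import Data.Integer.Tactic.RingSolver using (solve-∀)
  open import Data.Product using (∃; ∃₂; _,_; _×_; proj₁; proj₂)
  open import Data.Sum using (_⊎_; inj₁; inj₂)
  open import Relation.Nullary using (¬_; Dec; yes; no)
  open import Relation.Binary.PropositionalEquality

  module AtkinLehner (p : ℕ) (p-prime : Prime p) (p±3 : ±3mod8 p) (D : ℕ) (M s c : ℤ)
    (pM≡D : + p * M ≡ + suc D) (M≡s² : M ≡ s * s + + p * c) (p∤M : ¬ + p ∣ M)
    (D≡7 : ∃ λ t → + suc D ≡ + 8 * t + + 7) where

    P : ℤ
    P = + p

    instance
      P≢0 : NonZero P
      P≢0 = ℕ.>-nonZero (ℕₚ.≤-trans (s≤s z≤n) (±3-≥3 p±3))

    p∤2 : ¬ P ∣ + 2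
    p∤2 h = ℕₚ.<⇒≱ (±3-≥3 p±3) (ℕ.∣⇒≤ (∣⇒∣ᵤ h))

    strip-2 : ∀ a → P ∣ + 2 * a → P ∣ a
    strip-2 a h with prime-∣-* p-prime (+ 2) a h
    ... | inj₁ h₂ = ⊥-elim (p∤2 h₂)
    ... | inj₂ ha = ha

    ∣-square : ∀ a → P ∣ a * a → P ∣ a
    ∣-square a h with prime-∣-* p-prime a a h
    ... | inj₁ ha = ha
    ... | inj₂ ha = ha

    p∤s : ¬ P ∣ s
    p∤s (divides q refl) = p∤M (divides (q * q * P + c) (trans M≡s² (eq q P c)))
      where
      eq : ∀ q p c → q * p * (q * p) + p * c ≡ (q * q * p + c) * p
      eq = solve-∀

    cancel-P : ∀ a b → P * a ≡ P * b → a ≡ b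
    cancel-P a b = ℤₚ.*-cancelˡ-≡ P a b

    -- For y = z the equation is 2(2y)² - b² = pM. As 2 is not a square modulo p, p divides b and
    -- then y, so p² divides pM and p divides M.
    off-diagonal : ∀ y b → disc (form y y b) ≢ + suc D
    off-diagonal y b e = p∤M (divides (+ 8 * (y₀ * y₀) - b₀ * b₀) (cancel-P M ((+ 8 * (y₀ * y₀) - b₀ * b₀) * P)
        (trans M-eq (eq₄ y₀ b₀ P))))
      where
      e′ : + 8 * (y * y) - b * b ≡ P * M
      e′ = trans e (sym pM≡D)
      eq₁ : ∀ y b → + 2 * (+ 2 * y * (+ 2 * y)) - b * b ≡ + 8 * (y * y) - b * b
      eq₁ = solve-∀
      p∣b : P ∣ b
      p∣b = 2u²≡s² p-prime p±3 (+ 2 * y) b (divides M (trans (eq₁ y b) (trans e′ (ℤₚ.*-comm P M))))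
      b₀ = _∣_.quotient p∣b
      b≡ : b ≡ b₀ * P
      b≡ = _∣_.equality p∣b
      eq₂ : ∀ y b → + 2 * (+ 2 * (+ 2 * (y * y))) ≡ (+ 8 * (y * y) - b * b) + b * b
      eq₂ = solve-∀
      eq₃ : ∀ P M b₀ → P * M + b₀ * P * (b₀ * P) ≡ (M + b₀ * b₀ * P) * P
      eq₃ = solve-∀
      p∣y : P ∣ y
      p∣y = ∣-square y (strip-2 (y * y) (strip-2 (+ 2 * (y * y)) (strip-2 (+ 2 * (+ 2 * (y * y))) (divides (M + b₀ * b₀ * P)
        (trans (eq₂ y b) (trans (cong₂ _+_ e′ (cong₂ _*_ b≡ b≡)) (eq₃ P M b₀)))))))
      y₀ = _∣_.quotient p∣y
      y≡ : y ≡ y₀ * P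
      y≡ = _∣_.equality p∣y
      M-eq : P * M ≡ + 8 * (y₀ * P * (y₀ * P)) - b₀ * P * (b₀ * P)
      M-eq = trans (sym e′) (cong₂ _-_ (cong (λ k → + 8 * k) (cong₂ _*_ y≡ y≡)) (cong₂ _*_ b≡ b≡))
      eq₄ : ∀ y₀ b₀ P → + 8 * (y₀ * P * (y₀ * P)) - b₀ * P * (b₀ * P) ≡ P * ((+ 8 * (y₀ * y₀) - b₀ * b₀) * P)
      eq₄ = solve-∀

    open Reduction D off-diagonal public

    -- Modulo p the form `ι u` is zY², so its double root modulo p sits at Y = 0.
    ι : Form → Form
    ι (form y z b) = form (P * y) z (P * b)

    reduced-disc : ∀ y z b → disc (ι (form y z b)) ≡ + suc D → + 8 * (y * z) - P * (b * b) ≡ M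
    reduced-disc y z b e = cancel-P (+ 8 * (y * z) - P * (b * b)) M (trans (eq P y z b) (trans e (sym pM≡D)))
      where
      eq : ∀ P y z b → P * (+ 8 * (y * z) - P * (b * b)) ≡ + 8 * (P * y * z) - P * b * (P * b)
      eq = solve-∀

    b-multiple : ∀ y₀ z b → + 8 * (y₀ * P * z) - b * b ≡ + suc D → P ∣ b
    b-multiple y₀ z b e = ∣-square b (divides (+ 8 * (y₀ * z) - M) (trans (eq₁ (+ 8 * (y₀ * P * z)) (b * b))
      (trans (cong (λ k → + 8 * (y₀ * P * z) - k) (trans e (sym pM≡D))) (eq₂ y₀ z P M))))
      where
      eq₁ : ∀ a b → b ≡ a - (a - b)
      eq₁ = solve-∀
      eq₂ : ∀ y₀ z P M → + 8 * (y₀ * P * z) - P * M ≡ (+ 8 * (y₀ * z) - M) * P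
      eq₂ = solve-∀

    to-ι-∣ : ∀ y₀ z b₀ → Admissible D (form (y₀ * P) z (b₀ * P)) →
      ∃ λ u → Admissible D (ι u) × form (y₀ * P) z (b₀ * P) ~ ι u
    to-ι-∣ y₀ z b₀ a = form y₀ z b₀ , subst (Admissible D) x≡ a , subst (form (y₀ * P) z (b₀ * P) ~_) x≡ ~-refl
      where
      x≡ : form (y₀ * P) z (b₀ * P) ≡ ι (form y₀ z b₀)
      x≡ = form-≡ (ℤₚ.*-comm y₀ P) refl (ℤₚ.*-comm b₀ P)

    z-multiple : ∀ y z b₀ → ¬ P ∣ y → disc (form y z (P * b₀)) ≡ + suc D → P ∣ z
    z-multiple y z b₀ p∤y e = right (prime-∣-* p-prime y z (strip-2 (y * z) (strip-2 (+ 2 * (y * z))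
        (strip-2 (+ 2 * (+ 2 * (y * z)))
      (divides (M + b₀ * b₀ * P) (trans (eq₁ (y * z) (P * b₀ * (P * b₀))) (trans
          (cong (λ k → k + P * b₀ * (P * b₀)) (trans e (sym pM≡D))) (eq₂ P M b₀))))))))
      where
      eq₁ : ∀ q b → + 2 * (+ 2 * (+ 2 * q)) ≡ (+ 8 * q - b) + b
      eq₁ = solve-∀
      eq₂ : ∀ P M b₀ → P * M + P * b₀ * (P * b₀) ≡ (M + b₀ * b₀ * P) * P
      eq₂ = solve-∀
      right : (P ∣ y) ⊎ (P ∣ z) → P ∣ z
      right (inj₁ h) = ⊥-elim (p∤y h)
      right (inj₂ h) = h

    swap-to-ι : ∀ y z b b₀ → ¬ P ∣ y → b ≡ P * b₀ → Admissible D (form y z b) → ∃ λ u → Admissible D (ι u) × form y z b ~ ι u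
    swap-to-ι y z b b₀ p∤y refl a = form z₀ y b₀ , subst (Admissible D) swap≡ (swap-admissible a) , subst (form y z
        (P * b₀) ~_) swap≡ (swap-~ (form y z (P * b₀)))
      where
      p∣z = z-multiple y z b₀ p∤y (Admissible.disc≡ a)
      z₀ = _∣_.quotient p∣z
      swap≡ : form z y (P * b₀) ≡ ι (form z₀ y b₀)
      swap≡ = form-≡ (trans (_∣_.equality p∣z) (ℤₚ.*-comm z₀ P)) refl refl

    centred-b : ∀ y b e k → + 4 * y * e ≡ + 1 + P * k → + 4 * (y * - (b * e)) + b ≡ P * - (b * k)
    centred-b y b e k h = trans (eq₁ y b e) (trans (cong (λ q → b - b * q) h) (eq₂ b P k))
      where
      eq₁ : ∀ y b e → + 4 * (y * - (b * e)) + b ≡ b - b * (+ 4 * y * e)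
      eq₁ = solve-∀
      eq₂ : ∀ b P k → b - b * (+ 1 + P * k) ≡ P * - (b * k)
      eq₂ = solve-∀

    -- If p divides y, the discriminant makes it divide b. Otherwise 4y has an inverse e modulo p,
    -- translation by -be completes the square so that p divides b and hence z, and the exchange
    -- finishes.
    to-ι : ∀ x → Admissible D x → ∃ λ u → Admissible D (ι u) × x ~ ι u
    to-ι (form y z b) a = cases (P ∣? y)
      where
      Goal : Form → Set
      Goal x = ∃ λ u → Admissible D (ι u) × x ~ ι u
      divisible : ∀ {y b} → P ∣ y → P ∣ b → Admissible D (form y z b) → Goal (form y z b)
      divisible (divides y₀ refl) (divides b₀ refl) a = to-ι-∣ y₀ z b₀ a
      coprime : ¬ P ∣ y → (∃₂ λ e k → + 4 * y * e ≡ + 1 + P * k) → Goal (form y z b)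
      coprime p∤y (e , k , h) =
        let x′ = translate (- (b * e)) (form y z b)
            (u , au , x′~u) = swap-to-ι y (Form.z x′) (Form.b x′) (- (b * k)) p∤y (centred-b y b e k h)
                (translate-admissible (- (b * e)) a)
        in u , au , ~-trans (translate-~ (- (b * e)) (form y z b)) x′~u
      p∤4y : ¬ P ∣ y → ¬ P ∣ + 4 * y
      p∤4y p∤y h = p∤y (strip-2 y (strip-2 (+ 2 * y) (subst (P ∣_) (eq y) h)))
        where
        eq : ∀ y → + 4 * y ≡ + 2 * (+ 2 * y)
        eq = solve-∀
      cases : Dec (P ∣ y) → Goal (form y z b)
      cases (yes p∣y@(divides y₀ y≡)) =
        divisible p∣y (b-multiple y₀ z b (trans (cong (λ y → + 8 * (y * z) - b * b) (sym y≡)) (Admissible.disc≡ a))) a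
      cases (no p∤y) = coprime p∤y (prime-inverse p-prime (+ 4 * y) (p∤4y p∤y))

    p∤z : ∀ {y z b} → disc (ι (form y z b)) ≡ + suc D → ¬ P ∣ z
    p∤z {y} {z} {b} e (divides z₀ refl) = p∤M (divides (+ 8 * (y * z₀) - b * b) (trans (sym (reduced-disc y z b e))
        (eq y z₀ b P)))
      where
      eq : ∀ y z₀ b P → + 8 * (y * (z₀ * P)) - P * (b * b) ≡ (+ 8 * (y * z₀) - b * b) * P
      eq = solve-∀

    ∣z*square : ∀ {y z b} → disc (ι (form y z b)) ≡ + suc D → ∀ a → P ∣ z * (a * a) → P ∣ a
    ∣z*square {y} {z} {b} e a h with prime-∣-* p-prime z (a * a) h
    ... | inj₁ p∣z = ⊥-elim (p∤z {y} {z} {b} e p∣z)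
    ... | inj₂ h′  = ∣-square a h′

    -- An equivalence between two forms of shape `ι` must preserve the line Y = 0 modulo p: the new
    -- first coefficient is 2zγ² modulo p, and z is prime to p.
    γ-multiple : ∀ {y z b y′} α γ → disc (ι (form y z b)) ≡ + suc D →
      P * y′ ≡ P * y * (α * α) + P * b * (α * γ) + + 2 * (z * (γ * γ)) → P ∣ γ
    γ-multiple {y} {z} {b} {y′} α γ e h = ∣z*square {y} {z} {b} e γ (strip-2 (z * (γ * γ))
      (divides (y′ - y * (α * α) - b * (α * γ)) (trans (eq₁ (P * y * (α * α)) (P * b * (α * γ)) (+ 2 * (z * (γ * γ))))
        (trans (cong (λ k → k - P * y * (α * α) - P * b * (α * γ)) (sym h)) (eq₂ P y b y′ α γ)))))
      where
      eq₁ : ∀ a b c → c ≡ a + b + c - a - b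
      eq₁ = solve-∀
      eq₂ : ∀ P y b y′ α γ → P * y′ - P * y * (α * α) - P * b * (α * γ) ≡ (y′ - y * (α * α) - b * (α * γ)) * P
      eq₂ = solve-∀

    -- With the exchange, the coefficient that becomes divisible by p is the last one, which is zδ²
    -- modulo p.
    δ-multiple : ∀ {y z b y′} β δ → disc (ι (form y z b)) ≡ + suc D →
      P * y′ ≡ + 2 * (P * y * (β * β)) + P * b * (β * δ) + z * (δ * δ) → P ∣ δ
    δ-multiple {y} {z} {b} {y′} β δ e h = ∣z*square {y} {z} {b} e δ
      (divides (y′ - + 2 * (y * (β * β)) - b * (β * δ)) (trans (eq₁ (+ 2 * (P * y * (β * β))) (P * b * (β * δ)) (z * (δ * δ)))
        (trans (cong (λ k → k - + 2 * (P * y * (β * β)) - P * b * (β * δ)) (sym h)) (eq₂ P y b y′ β δ))))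
      where
      eq₁ : ∀ a b c → c ≡ a + b + c - a - b
      eq₁ = solve-∀
      eq₂ : ∀ P y b y′ β δ → P * y′ - + 2 * (P * y * (β * β)) - P * b * (β * δ) ≡ (y′ - + 2 * (y * (β * β)) - b * (β * δ)) * P
      eq₂ = solve-∀

    -- Because p divides the lower left entry, conjugation by the involution stays integral: that
    -- entry loses the factor p and β gains it. Accordingly the equation for one outer coefficient
    -- is multiplied by p and that for the other is divided by p.
    involution-plain : ∀ {y z b y′ z′ b′} α β γ₀ δ → det (matrix α β (γ₀ * P) δ) ≡ + 1 →
      ι (form y′ z′ b′) ≡ act (matrix α β (γ₀ * P) δ) (ι (form y z b)) → ι (form z y b) ~ ι (form z′ y′ b′)
    involution-plain {y} {z} {b} {y′} {z′} {b′} α β γ₀ δ d h = plain (matrix δ γ₀ (P * β) α) (trans (eq₀ α β γ₀ δ P) d) (form-≡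
        (trans (cong (λ k → P * k) (cong Form.z h)) (eq₃ P y z b β δ))
        (cancel-P y′ (+ 2 * (P * z * (γ₀ * γ₀)) + P * b * (γ₀ * α) + y * (α * α)) (trans (cong Form.y h) (eq₄ P y z b α γ₀)))
        (trans (cong Form.b h) (eq₅ P y z b α β γ₀ δ)))
      where
      eq₀ : ∀ α β γ₀ δ P → δ * α - + 2 * (γ₀ * (P * β)) ≡ α * δ - + 2 * (β * (γ₀ * P))
      eq₀ = solve-∀
      eq₃ : ∀ P y z b β δ → P * (+ 2 * (P * y * (β * β)) + P * b * (β * δ) + z * (δ * δ))
        ≡ P * z * (δ * δ) + P * b * (δ * (P * β)) + + 2 * (y * (P * β * (P * β)))
      eq₃ = solve-∀
      eq₄ : ∀ P y z b α γ₀ → P * y * (α * α) + P * b * (α * (γ₀ * P)) + + 2 * (z * (γ₀ * P * (γ₀ * P)))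
        ≡ P * (+ 2 * (P * z * (γ₀ * γ₀)) + P * b * (γ₀ * α) + y * (α * α))
      eq₄ = solve-∀
      eq₅ : ∀ P y z b α β γ₀ δ → + 4 * (P * y * (α * β)) + P * b * (α * δ + + 2 * (β * (γ₀ * P))) + + 4 * (z * (γ₀ * P * δ))
        ≡ + 4 * (P * z * (δ * γ₀)) + P * b * (δ * α + + 2 * (γ₀ * (P * β))) + + 4 * (y * (P * β * α))
      eq₅ = solve-∀

    -- The same transfer along the other diagonal: δ loses the factor p and α gains it.
    involution-swapped : ∀ {y z b y′ z′ b′} α β γ δ₀ → det (matrix α β γ (δ₀ * P)) ≡ + 1 →
      ι (form y′ z′ b′) ≡ swap (act (matrix α β γ (δ₀ * P)) (ι (form y z b))) → ι (form z y b) ~ ι (form z′ y′ b′)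
    involution-swapped {y} {z} {b} {y′} {z′} {b′} α β γ δ₀ d h = swapped (matrix δ₀ γ β (P * α)) (trans
        (eq₀ α β γ δ₀ P) d) (form-≡
        (trans (cong (λ k → P * k) (cong Form.z h)) (eq₃ P y z b α γ))
        (cancel-P y′ (P * z * (δ₀ * δ₀) + P * b * (δ₀ * β) + + 2 * (y * (β * β))) (trans (cong Form.y h) (eq₄ P y z b β δ₀)))
        (trans (cong Form.b h) (eq₅ P y z b α β γ δ₀)))
      where
      eq₀ : ∀ α β γ δ₀ P → δ₀ * (P * α) - + 2 * (γ * β) ≡ α * (δ₀ * P) - + 2 * (β * γ)
      eq₀ = solve-∀
      eq₃ : ∀ P y z b α γ → P * (P * y * (α * α) + P * b * (α * γ) + + 2 * (z * (γ * γ)))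
        ≡ + 2 * (P * z * (γ * γ)) + P * b * (γ * (P * α)) + y * (P * α * (P * α))
      eq₃ = solve-∀
      eq₄ : ∀ P y z b β δ₀ → + 2 * (P * y * (β * β)) + P * b * (β * (δ₀ * P)) + z * (δ₀ * P * (δ₀ * P))
        ≡ P * (P * z * (δ₀ * δ₀) + P * b * (δ₀ * β) + + 2 * (y * (β * β)))
      eq₄ = solve-∀
      eq₅ : ∀ P y z b α β γ δ₀ → + 4 * (P * y * (α * β)) + P * b * (α * (δ₀ * P) + + 2 * (β * γ)) + + 4 * (z * (γ * (δ₀ * P)))
        ≡ + 4 * (P * z * (δ₀ * γ)) + P * b * (δ₀ * (P * α) + + 2 * (γ * β)) + + 4 * (y * (β * (P * α)))
      eq₅ = solve-∀

    -- In these coordinates the Atkin–Lehner involution at p is the exchange of y and z.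
    involution : ∀ u u′ → disc (ι u) ≡ + suc D → ι u ~ ι u′ → ι (swap u) ~ ι (swap u′)
    involution (form y z b) (form y′ z′ b′) e (plain (matrix α β γ δ) d h) =
      go (γ-multiple {y} {z} {b} {y′} α γ e (cong Form.y h)) d h
      where
      go : ∀ {γ} → P ∣ γ → det (matrix α β γ δ) ≡ + 1 → ι (form y′ z′ b′) ≡ act (matrix α β γ δ) (ι (form y z b)) → ι
          (form z y b) ~ ι (form z′ y′ b′)
      go (divides γ₀ refl) d h = involution-plain {y} {z} {b} {y′} {z′} {b′} α β γ₀ δ d h
    involution (form y z b) (form y′ z′ b′) e (swapped (matrix α β γ δ) d h) =
      go (δ-multiple {y} {z} {b} {y′} β δ e (cong Form.y h)) d h
      where
      go : ∀ {δ} → P ∣ δ → det (matrix α β γ δ) ≡ + 1 → ι (form y′ z′ b′) ≡ swap (act (matrix α β γ δ)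
          (ι (form y z b))) → ι (form z y b) ~ ι (form z′ y′ b′)
      go (divides δ₀ refl) d h = involution-swapped {y} {z} {b} {y′} {z′} {b′} α β γ δ₀ d h

    parityℤ : ∀ a → (∃ λ h → a ≡ + 2 * h) ⊎ (∃ λ h → a ≡ + 2 * h + + 1)
    parityℤ a = cases (a %ℕ 2) (n%ℕd<d a 2) (a≡a%ℕn+[a/ℕn]*n a 2)
      where
      eq₀ : ∀ k → + 0 + k * + 2 ≡ + 2 * k
      eq₀ = solve-∀
      eq₁ : ∀ k → + 1 + k * + 2 ≡ + 2 * k + + 1
      eq₁ = solve-∀
      cases : ∀ r → r ℕ.< 2 → a ≡ + r + (a /ℕ 2) * + 2 → (∃ λ h → a ≡ + 2 * h) ⊎ (∃ λ h → a ≡ + 2 * h + + 1)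
      cases 0 _ e = inj₁ (a /ℕ 2 , trans e (eq₀ (a /ℕ 2)))
      cases 1 _ e = inj₂ (a /ℕ 2 , trans e (eq₁ (a /ℕ 2)))
      cases (suc (suc _)) (s≤s (s≤s ())) _

    odd-squareℤ : ∀ h → ∃ λ t → (+ 2 * h + + 1) * (+ 2 * h + + 1) ≡ + 8 * t + + 1
    odd-squareℤ h with parityℤ h
    ... | inj₁ (k , refl) = k * (+ 2 * k + + 1) , eq k
      where
      eq : ∀ k → (+ 2 * (+ 2 * k) + + 1) * (+ 2 * (+ 2 * k) + + 1) ≡ + 8 * (k * (+ 2 * k + + 1)) + + 1
      eq = solve-∀
    ... | inj₂ (k , refl) = (+ 2 * k + + 1) * (k + + 1) , eq k
      where
      eq : ∀ k → (+ 2 * (+ 2 * k + + 1) + + 1) * (+ 2 * (+ 2 * k + + 1) + + 1) ≡ + 8 * ((+ 2 * k + + 1) * (k + + 1)) + + 1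
      eq = solve-∀

    Odd : ℤ → Set
    Odd a = ∃ λ h → a ≡ + 2 * h + + 1

    odd≢even : ∀ {a} → Odd a → ∀ h → a ≢ + 2 * h
    odd≢even (k , refl) h e = 2∤1 (h - k) (trans (eq h k) (trans (cong (λ a → a - + 2 * k) (sym e)) (eq′ k)))
      where
      eq : ∀ h k → + 2 * (h - k) ≡ + 2 * h - + 2 * k
      eq = solve-∀
      eq′ : ∀ k → + 2 * k + + 1 - + 2 * k ≡ + 1
      eq′ = solve-∀

    P≢7 : ∀ w → P ≢ + 8 * w + + 7
    P≢7 (+ w) e = clash p±3
      where
      p%8 : p ℕ.% 8 ≡ 7
      p%8 = trans (cong (ℕ._% 8) (ℤₚ.+-injective (trans e (trans (cong (λ k → k + + 7)
          (trans (ℤₚ.*-comm (+ 8) (+ w)) (sym (ℤₚ.pos-* w 8)))) (ℤₚ.+-comm (+ (w ℕ.* 8)) (+ 7))))))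
        (ℕ.[m+kn]%n≡m%n 7 w 8)
      clash : ±3mod8 p → ⊥
      clash (≡3 h) with () ← trans (sym h) p%8
      clash (≡5 h) with () ← trans (sym h) p%8
    P≢7 -[1+ w ] e = 0≰negative (0≤+ {p ℕ.+ 8 ℕ.* w}) (trans (cong (λ k → P + k) (ℤₚ.pos-* 8 w)) (trans
        (cong (λ k → k + + 8 * + w) e) (eq (+ w))))
      where
      eq : ∀ w → + 8 * - (+ 1 + w) + + 7 + + 8 * w ≡ -[1+ 0 ]
      eq = solve-∀

    -- As b is odd, so is v, and odd squares are 1 modulo 8. The residue of M modulo 8 then
    -- determines that of p through pM.
    M-not-square-ratio : ∀ b v → Odd b → M * (v * v) ≢ b * b
    M-not-square-ratio b v odd-b@(h , refl) e with parityℤ v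
    ... | inj₁ (k , refl) = odd≢even (proj₁ b² * + 4 , trans (proj₂ b²) (eq₁ (proj₁ b²))) (+ 2 * (M * (k * k)))
        (trans (sym e) (eq₂ M k))
      where
      b² = odd-squareℤ h
      eq₁ : ∀ t → + 8 * t + + 1 ≡ + 2 * (t * + 4) + + 1
      eq₁ = solve-∀
      eq₂ : ∀ M k → M * (+ 2 * k * (+ 2 * k)) ≡ + 2 * (+ 2 * (M * (k * k)))
      eq₂ = solve-∀
    ... | inj₂ (k , refl) = P≢7 (d - m * P) (trans (eq₁ P M) (trans
        (cong₂ (λ x y → x - P * (y - + 1)) (trans pM≡D (proj₂ D≡7)) M≡1) (eq₂ d P m)))
      where
      t = proj₁ (odd-squareℤ k)
      t′ = proj₁ (odd-squareℤ h)
      d = proj₁ D≡7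
      m = t′ - t * M
      M≡1 : M ≡ + 8 * m + + 1
      M≡1 = trans (eq M t) (trans (cong (λ a → M * a - + 8 * (t * M)) (sym (proj₂ (odd-squareℤ k)))) (trans
          (cong (λ a → a - + 8 * (t * M)) (trans e (proj₂ (odd-squareℤ h)))) (eq′ t′ (t * M))))
        where
        eq : ∀ M t → M ≡ M * (+ 8 * t + + 1) - + 8 * (t * M)
        eq = solve-∀
        eq′ : ∀ t′ a → + 8 * t′ + + 1 - + 8 * a ≡ + 8 * (t′ - a) + + 1
        eq′ = solve-∀
      eq₁ : ∀ P M → P ≡ P * M - P * (M - + 1)
      eq₁ = solve-∀
      eq₂ : ∀ d P m → + 8 * d + + 7 - P * (+ 8 * m + + 1 - + 1) ≡ + 8 * (d - m * P) + + 7
      eq₂ = solve-∀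

    -- The last coefficients give y ≡ zδ² (mod p), hence s² ≡ M ≡ 8yz ≡ 2(2zδ)².
    no-fixed-plain : ∀ y z b α β γ δ → disc (ι (form y z b)) ≡ + suc D →
      ι (form z y b) ≢ act (matrix α β γ δ) (ι (form y z b))
    no-fixed-plain y z b α β γ δ e h = p∤s (2u²≡s² p-prime p±3 (+ 2 * z * δ) s (divides
        (c + b * b - + 8 * z * (+ 2 * (y * (β * β)) + b * (β * δ)))
      (trans (eq₁ z δ (+ 2 * (P * y * (β * β)) + P * b * (β * δ)) (s * s))
        (trans (cong (λ k → + 8 * z * (k - (+ 2 * (P * y * (β * β)) + P * b * (β * δ))) - s * s) (sym (cong Form.z h)))
          (trans (eq₂ P y z b β δ (s * s)) (trans (cong (λ k → k + P * (b * b) - + 8 * z * (P *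
              (+ 2 * (y * (β * β)) + b * (β * δ))) - s * s) (trans (reduced-disc y z b e) M≡s²))
            (eq₃ P (s * s) c (b * b) z (+ 2 * (y * (β * β)) + b * (β * δ)))))))))
      where
      eq₁ : ∀ z δ r s² → + 2 * (+ 2 * z * δ * (+ 2 * z * δ)) - s² ≡ + 8 * z * (r + z * (δ * δ) - r) - s²
      eq₁ = solve-∀
      eq₂ : ∀ P y z b β δ s² → + 8 * z * (y - (+ 2 * (P * y * (β * β)) + P * b * (β * δ))) - s²
        ≡ (+ 8 * (y * z) - P * (b * b)) + P * (b * b) - + 8 * z * (P * (+ 2 * (y * (β * β)) + b * (β * δ))) - s²
      eq₂ = solve-∀
      eq₃ : ∀ P s² c b² z r → s² + P * c + P * b² - + 8 * z * (P * r) - s² ≡ (c + b² - + 8 * z * r) * P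
      eq₃ = solve-∀

    module FixedSwapped (y z b α β γ δ₀ : ℤ) (0<y : + 0 ≤ P * y - + 1) (D≡ : disc (ι (form y z b)) ≡ + suc D) (b-odd : Odd b)
      (d : det (matrix α β γ (δ₀ * P)) ≡ + 1)
      (h : ι (form z y b) ≡ swap (act (matrix α β γ (δ₀ * P)) (ι (form y z b)))) where

      u τ : ℤ
      u = δ₀ - α
      τ = α + δ₀

      E₁ : y ≡ P * y * (α * α) + P * b * (α * γ) + + 2 * (z * (γ * γ))
      E₁ = cong Form.z h
      E₂ : P * b ≡ + 4 * (P * y * (α * β)) + P * b * (α * (δ₀ * P) + + 2 * (β * γ)) + + 4 * (z * (γ * (δ₀ * P)))
      E₂ = cong Form.b h

      -- L₁, L₂ and L₃ say that (γ, u, -β) is proportional to (y, b, z): the fixed points of an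
      -- automorphism are the roots of its form. E₁ and E₂ are combined so that the determinant
      -- factors out.
      L₁ : y * u ≡ b * γ
      L₁ = cancel-P (y * u) (b * γ) (ℤₚ.*-cancelˡ-≡ (+ 2) (P * (y * u)) (P * (b * γ))
        (trans (eq₁ P y δ₀ α b γ) (trans (cong₂ (λ k l → + 2 * (δ₀ * P) * k - γ * l - + 2 * P * y * α + P * b * γ) E₁ E₂)
          (trans (eq₂ P y z b α β γ δ₀) (trans (cong (λ k → (+ 2 * P * y * α + P * b * γ) * k - + 2 * P * y * α + P * b
              * γ) d) (eq₃ P y α b γ))))))
        where
        eq₁ : ∀ P y δ₀ α b γ → + 2 * (P * (y * (δ₀ - α))) ≡ + 2 * (δ₀ * P) * y - γ * (P * b) - + 2 * P * y * α + P * b * γ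
        eq₁ = solve-∀
        eq₂ : ∀ P y z b α β γ δ₀ →
          + 2 * (δ₀ * P) * (P * y * (α * α) + P * b * (α * γ) + + 2 * (z * (γ * γ)))
          - γ * (+ 4 * (P * y * (α * β)) + P * b * (α * (δ₀ * P) + + 2 * (β * γ)) + + 4 * (z *
              (γ * (δ₀ * P)))) - + 2 * P * y * α + P * b * γ
          ≡ (+ 2 * P * y * α + P * b * γ) * (α * (δ₀ * P) - + 2 * (β * γ)) - + 2 * P * y * α + P * b * γ
        eq₂ = solve-∀
        eq₃ : ∀ P y α b γ → (+ 2 * P * y * α + P * b * γ) * + 1 - + 2 * P * y * α + P * b * γ ≡ + 2 * (P * (b * γ))
        eq₃ = solve-∀

      L₂ : - (β * y) ≡ z * γ
      L₂ = ℤₚ.*-cancelˡ-≡ (+ 4) (- (β * y)) (z * γ)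
        (trans (eq₁ α P b β y) (trans (cong₂ (λ k l → α * l - + 4 * β * k - P * b * α) E₁ E₂)
          (trans (eq₂ P y z b α β γ δ₀) (trans (cong (λ k → (P * b * α + + 4 * (z * γ)) * k - P * b * α) d) (eq₃ P b α z γ)))))
        where
        eq₁ : ∀ α P b β y → + 4 * - (β * y) ≡ α * (P * b) - + 4 * β * y - P * b * α
        eq₁ = solve-∀
        eq₂ : ∀ P y z b α β γ δ₀ →
          α * (+ 4 * (P * y * (α * β)) + P * b * (α * (δ₀ * P) + + 2 * (β * γ)) + + 4 * (z * (γ * (δ₀ * P))))
          - + 4 * β * (P * y * (α * α) + P * b * (α * γ) + + 2 * (z * (γ * γ))) - P * b * α
          ≡ (P * b * α + + 4 * (z * γ)) * (α * (δ₀ * P) - + 2 * (β * γ)) - P * b * α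
        eq₂ = solve-∀
        eq₃ : ∀ P b α z γ → (P * b * α + + 4 * (z * γ)) * + 1 - P * b * α ≡ + 4 * (z * γ)
        eq₃ = solve-∀

      y≢0 : y ≢ + 0
      y≢0 refl = 0≰negative 0<y (cong (_- + 1) (ℤₚ.*-zeroʳ P))

      L₃ : b * β ≡ - (z * u)
      L₃ = ℤₚ.*-cancelˡ-≡ y (b * β) (- (z * u)) {{≢-nonZero y≢0}} (trans (eq₁ y b β) (trans (cong (λ k → - (b * k)) L₂)
        (trans (eq₂ b z γ) (trans (cong (λ k → - (z * k)) (sym L₁)) (eq₃ y z u)))))
        where
        eq₁ : ∀ y b β → y * (b * β) ≡ - (b * - (β * y))
        eq₁ = solve-∀
        eq₂ : ∀ b z γ → - (b * (z * γ)) ≡ - (z * (b * γ))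
        eq₂ = solve-∀
        eq₃ : ∀ y z u → - (z * (y * u)) ≡ y * - (z * u)
        eq₃ = solve-∀

      -- The form is fixed up to the factor p by a matrix of determinant p and trace pτ, hence of discriminant p(pτ² - 4).
      trace : M * (u * u) ≡ b * b * (+ 4 - P * (τ * τ))
      trace = sym (trans (eq₁ P b α δ₀ β γ) (trans (cong₂ (λ k l → b * b * (+ 4 * (+ 1 - (k + + 0))) - P * (b * b) *
          (u * u) - + 8 * l) d (cong₂ _*_ L₃ (sym L₁)))
        (trans (eq₂ P b y z u) (cong (λ k → k * (u * u)) (reduced-disc y z b D≡)))))
        where
        eq₁ : ∀ P b α δ₀ β γ → b * b * (+ 4 - P * ((α + δ₀) * (α + δ₀)))
          ≡ b * b * (+ 4 * (+ 1 - (α * (δ₀ * P) - + 2 * (β * γ) + + 0))) - P * (b * b) * ((δ₀ - α) *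
              (δ₀ - α)) - + 8 * (b * β * (b * γ))
        eq₁ = solve-∀
        eq₂ : ∀ P b y z u → b * b * (+ 4 * (+ 1 - (+ 1 + + 0))) - P * (b * b) * (u * u) - + 8 * (- (z * u) *
            (y * u)) ≡ (+ 8 * (y * z) - P * (b * b)) * (u * u)
        eq₂ = solve-∀

      b≢0 : b ≢ + 0
      b≢0 e = odd≢even b-odd (+ 0) e

      0≤M : + 0 ≤ M
      0≤M = 0≤-cancel P (ℤₚ.i≤j⇒0≤j-i (+≤+ (ℕₚ.≤-trans (s≤s z≤n) (±3-≥3 p±3)))) (subst (+ 0 ≤_) (sym pM≡D) 0≤+)

      small : + 0 ≤ + 4 - P * (τ * τ)
      small = 0≤-cancel (b * b) (0≤-square-1 b≢0) (subst (+ 0 ≤_) trace (0≤-* 0≤M (0≤-square u)))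

      pτ²≤4 : p ℕ.* (∣ τ ∣ ℕ.* ∣ τ ∣) ℕ.≤ 4
      pτ²≤4 = ℤₚ.drop‿+≤+ (subst (_≤ + 4) (trans (cong (λ k → P * k) (abs-square τ)) (sym
          (ℤₚ.pos-* p (∣ τ ∣ ℕ.* ∣ τ ∣)))) (ℤₚ.0≤i-j⇒j≤i small))

      cases : ∀ n → ∣ τ ∣ ≡ n → p ℕ.* (n ℕ.* n) ℕ.≤ 4 → ⊥
      -- Now Mu² = 4b². For even u, halving u gives the excluded square ratio; odd u would make M
      -- even, while pM = 8N+7 is odd.
      cases 0 τ≡0 _ = case-0 (parityℤ u)
        where
        M4 : M * (u * u) ≡ + 4 * (b * b)
        M4 = trans trace (trans (cong (λ k → b * b * (+ 4 - P * k)) (trans (abs-square τ)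
            (cong (λ n → + (n ℕ.* n)) τ≡0))) (eq b P))
          where
          eq : ∀ b P → b * b * (+ 4 - P * + 0) ≡ + 4 * (b * b)
          eq = solve-∀
        case-0 : (∃ λ h → u ≡ + 2 * h) ⊎ Odd u → ⊥
        case-0 (inj₁ (v , u≡)) = M-not-square-ratio b v b-odd (ℤₚ.*-cancelˡ-≡ (+ 4) (M * (v * v)) (b * b)
            (trans (eq M v) (trans (cong (λ u → M * (u * u)) (sym u≡)) M4)))
          where
          eq : ∀ M v → + 4 * (M * (v * v)) ≡ M * (+ 2 * v * (+ 2 * v))
          eq = solve-∀
        case-0 (inj₂ (v , u≡)) = odd≢even {+ suc D} (+ 4 * proj₁ D≡7 + + 3 , trans (proj₂ D≡7) (eq₀ (proj₁ D≡7)))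
            (P * (+ 2 * (b * b) - M * (+ 2 * (v * v) + + 2 * v)))
          (trans (sym pM≡D) (trans (eq₁ P M v) (trans (cong (λ k → P * (k - + 2 * (M * (+ 2 * (v * v) + + 2 * v))))
              (trans (cong (λ u → M * (u * u)) (sym u≡)) M4)) (eq₂ P b M v))))
          where
          eq₀ : ∀ t → + 8 * t + + 7 ≡ + 2 * (+ 4 * t + + 3) + + 1
          eq₀ = solve-∀
          eq₁ : ∀ P M v → P * M ≡ P * (M * ((+ 2 * v + + 1) * (+ 2 * v + + 1)) - + 2 * (M * (+ 2 * (v * v) + + 2 * v)))
          eq₁ = solve-∀
          eq₂ : ∀ P b M v → P * (+ 4 * (b * b) - + 2 * (M * (+ 2 * (v * v) + + 2 * v))) ≡ + 2 * (P *
              (+ 2 * (b * b) - M * (+ 2 * (v * v) + + 2 * v)))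
          eq₂ = solve-∀
      -- Here p = 3, so 4 - pτ² = 1 and the trace relation is itself a square ratio.
      cases 1 τ≡1 p≤4 = M-not-square-ratio b u b-odd (trans trace (trans
          (cong₂ (λ k l → b * b * (+ 4 - k * l)) (cong +_ p≡3) (trans (abs-square τ) (cong (λ n → + (n ℕ.* n)) τ≡1)))
          (ℤₚ.*-identityʳ (b * b))))
        where
        three : ∀ p → ±3mod8 p → 3 ℕ.≤ p → p ℕ.≤ 4 → p ≡ 3
        three 3 _ _ _ = refl
        three 4 (≡3 ()) _ _
        three 4 (≡5 ()) _ _
        three 0 _ () _
        three 1 _ (s≤s ()) _
        three 2 _ (s≤s (s≤s ())) _
        three (suc (suc (suc (suc (suc _))))) _ _ (s≤s (s≤s (s≤s (s≤s ()))))
        p≡3 : p ≡ 3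
        p≡3 = three p p±3 (±3-≥3 p±3) (subst (ℕ._≤ 4) (ℕₚ.*-identityʳ p) p≤4)
      cases (suc (suc n)) _ le = ℕₚ.<⇒≱ (s≤s (s≤s (s≤s (s≤s (s≤s (z≤n {7})))))) (ℕₚ.≤-trans
          (ℕₚ.*-mono-≤ (±3-≥3 p±3) (ℕₚ.*-mono-≤ (2≤ n) (2≤ n))) le)
        where
        2≤ : ∀ n → 2 ℕ.≤ suc (suc n)
        2≤ n = s≤s (s≤s z≤n)

      impossible : ⊥
      impossible = cases ∣ τ ∣ refl pτ²≤4

    no-fixed-point : ∀ u → Admissible D (ι u) → ¬ ι u ~ ι (swap u)
    no-fixed-point (form y z b) a (plain (matrix α β γ δ) d h) = no-fixed-plain y z b α β γ δ (Admissible.disc≡ a) h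
    no-fixed-point (form y z b) a (swapped (matrix α β γ δ) d h) = go (δ-multiple {y} {z} {b} {z} β δ
        (Admissible.disc≡ a) (cong Form.y h)) d h
      where
      b-odd : Odd b
      b-odd = odd-factor (parityℤ b) (Admissible.b≡1 a)
        where
        odd-factor : (∃ λ h → b ≡ + 2 * h) ⊎ Odd b → (∃ λ i → P * b ≡ + 4 * i + + 1) → Odd b
        odd-factor (inj₂ o) _ = o
        odd-factor (inj₁ (h , b≡)) (i , e) = ⊥-elim (odd≢even {P * b} (+ 2 * i , trans e (eq₁ i)) (P * h) (trans
            (cong (λ b → P * b) b≡) (eq₂ P h)))
          where
          eq₁ : ∀ i → + 4 * i + + 1 ≡ + 2 * (+ 2 * i) + + 1
          eq₁ = solve-∀
          eq₂ : ∀ P h → P * (+ 2 * h) ≡ + 2 * (P * h)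
          eq₂ = solve-∀
      go : ∀ {δ} → P ∣ δ → det (matrix α β γ δ) ≡ + 1 → ι (form z y b) ≡ swap (act (matrix α β γ δ) (ι (form y z b))) → ⊥
      go (divides δ₀ refl) d h = FixedSwapped.impossible y z b α β γ δ₀ (Admissible.positive a) (Admissible.disc≡ a) b-odd d h

-- Parity from a perfect matching; sums as lengths of lists

module Counting where

  open import Defs using (sumTo)
  open import Data.Bool using (if_then_else_)
  open import Data.Empty using (⊥-elim)
  open import Data.Integer as ℤ using (ℤ; +_)
  import Data.Integer.Properties as ℤₚ
  open import Data.Nat as ℕ using (ℕ; zero; suc; s≤s; z≤n)
  import Data.Nat.Properties as ℕₚ
  open import Data.List using (List; []; _∷_; _++_; length; map; filter; downFrom; cartesianProduct)
  import Data.List.Properties as List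
  open import Data.List.Membership.Propositional using (_∈_)
  open import Data.List.Membership.Propositional.Properties using (∈-∃++)
  open import Data.List.Relation.Binary.Permutation.Propositional using (_↭_; ↭-sym; ↭⇒↭ₛ)
  open import Data.List.Relation.Binary.Permutation.Propositional.Properties using (shift; ∈-resp-↭; ↭-length)
  open import Data.List.Relation.Binary.Permutation.Setoid.Properties using (Unique-resp-↭)
  open import Data.List.Relation.Unary.Any using (here; there)
  import Data.List.Relation.Unary.All as All
  open import Data.List.Relation.Unary.AllPairs using (_∷_)
  open import Data.List.Relation.Unary.Unique.Propositional using (Unique)
  open import Data.Product using (∃; _,_; _×_)
  open import Relation.Nullary using (¬_; yes; no)
  open import Relation.Nullary.Decidable using (⌊_⌋)
  open import Relation.Unary using (Decidable; Pred)
  open import Relation.Binary.PropositionalEquality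
  open import Level using (0ℓ)

  module Pairing {A : Set} (_R_ : A → A → Set)
    (R-sym : ∀ {x y} → x R y → y R x) (R-functional : ∀ {x y z} → x R y → x R z → y ≡ z) (R-irreflexive : ∀ {x} → ¬ x R x) where

    private
      extract : ∀ {y : A} {xs} → y ∈ xs → ∃ λ ws → xs ↭ y ∷ ws
      extract {y} y∈xs with ys , zs , refl ← ∈-∃++ y∈xs = ys ++ zs , shift y ys zs

      -- The head and its partner are removed together. Symmetry and functionality show that no
      -- other element is matched with either, so the rest is still matched within itself. The bound
      -- n drives the recursion because the remainder is not a sublist in the structural sense.
      go : ∀ n xs → length xs ℕ.≤ n → Unique xs → (∀ {x} → x ∈ xs → ∃ λ y → y ∈ xs × x R y) → ∃ λ h → length xs ≡ h ℕ.+ h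
      go n       []       _       _ _       = 0 , refl
      go (suc n) (x ∷ xs) (s≤s l) (x≢ ∷ u) partner with partner (here refl)
      ... | y , here refl  , xRy = ⊥-elim (R-irreflexive xRy)
      ... | y , there y∈xs , xRy with extract y∈xs
      ... | ws , xs↭ with Unique-resp-↭ (setoid A) (↭⇒↭ₛ xs↭) u
      ... | y≢ ∷ u′ = let (h , e) = go n ws (ℕₚ.≤-trans (ℕₚ.n≤1+n _) (subst (ℕ._≤ n) (↭-length xs↭) l)) u′ partner′
                      in suc h , cong suc (trans (↭-length xs↭) (trans (cong suc e) (sym (ℕₚ.+-suc h h))))
        where
        partner′ : ∀ {z} → z ∈ ws → ∃ λ z′ → z′ ∈ ws × z R z′
        partner′ z∈ws with partner (there (∈-resp-↭ (↭-sym xs↭) (there z∈ws)))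
        ... | z′ , here refl , zRx = ⊥-elim (All.lookup y≢ z∈ws (R-functional xRy (R-sym zRx)))
        ... | z′ , there z′∈xs , zRz′ with ∈-resp-↭ xs↭ z′∈xs
        ... | there z′∈ws = z′ , z′∈ws , zRz′
        ... | here refl with R-functional (R-sym xRy) (R-sym zRz′)
        ... | refl = ⊥-elim (All.lookup x≢ (∈-resp-↭ (↭-sym xs↭) (there z∈ws)) refl)

    even-length : ∀ xs → Unique xs → (∀ {x} → x ∈ xs → ∃ λ y → y ∈ xs × x R y) → ∃ λ h → length xs ≡ h ℕ.+ h
    even-length xs = go (length xs) xs ℕₚ.≤-refl

  -- `downFrom` starts with the largest index, the one that `sumTo` splits off.
  length-filter-row : ∀ {P : Pred (ℕ × ℕ) 0ℓ} (P? : Decidable P) r m →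
    + length (filter P? (map (r ,_) (downFrom (suc m)))) ≡ sumTo m (λ j → if ⌊ P? (r , j) ⌋ then + 1 else + 0)
  length-filter-row P? r zero with P? (r , 0)
  ... | yes _ = refl
  ... | no  _ = refl
  length-filter-row P? r (suc m) with P? (r , suc m)
  ... | yes _ = trans (cong (λ k → + 1 ℤ.+ k) (length-filter-row P? r m)) (ℤₚ.+-comm (+ 1)
      (sumTo m λ j → if ⌊ P? (r , j) ⌋ then + 1 else + 0))
  ... | no  _ = trans (length-filter-row P? r m) (sym (ℤₚ.+-identityʳ _))

  length-filter-product : ∀ {P : Pred (ℕ × ℕ) 0ℓ} (P? : Decidable P) n m →
    + length (filter P? (cartesianProduct (downFrom (suc n)) (downFrom (suc m))))
      ≡ sumTo n (λ r → sumTo m (λ j → if ⌊ P? (r , j) ⌋ then + 1 else + 0))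
  length-filter-product P? zero m = trans (cong (λ xs → + length (filter P? xs)) (List.++-identityʳ
      (map (0 ,_) (downFrom (suc m))))) (length-filter-row P? 0 m)
  length-filter-product P? (suc n) m = begin
    + length (filter P? (row ++ rows))                       ≡⟨ cong (λ xs → + length xs) (List.filter-++ P? row rows) ⟩
    + length (filter P? row ++ filter P? rows)               ≡⟨ cong +_ (List.length-++ (filter P? row)) ⟩
    + length (filter P? row) ℤ.+ + length (filter P? rows)   ≡⟨ cong₂ ℤ._+_ (length-filter-row P? (suc n) m)
        (length-filter-product P? n m) ⟩
    _                                                        ≡⟨ ℤₚ.+-comm (sumTo m _) (sumTo n _) ⟩
    _                                                        ∎
    where
    open ≡-Reasoning
    row = map (suc n ,_) (downFrom (suc m))
    rows = cartesianProduct (downFrom (suc n)) (downFrom (suc m))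

  sumTo-truncate : ∀ {m} n (f : ℕ → ℤ) → m ℕ.≤ n → (∀ j → m ℕ.< j → f j ≡ + 0) → sumTo n f ≡ sumTo m f
  sumTo-truncate {m} n f m≤n h with m ℕₚ.≟ n
  ... | yes refl = refl
  sumTo-truncate {m} zero    f z≤n h | no m≢n = refl
  sumTo-truncate {m} (suc n) f m≤n h | no m≢n =
    let m<1+n = ℕₚ.≤∧≢⇒< m≤n m≢n
    in trans (cong₂ ℤ._+_ (sumTo-truncate n f (ℕ.s≤s⁻¹ m<1+n) h) (h (suc n) m<1+n)) (ℤₚ.+-identityʳ _)

-- From lattice points to reduced forms, and the parity of their number

module Points where

  open import Defs
  open Triangular
  open PowerSeries
  open Coefficients
  open Residues
  open Forms
  open ReducedForms
  open Involution
  open Counting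
  open import Data.Bool using (Bool; if_then_else_)
  open import Data.Empty using (⊥-elim)
  open import Data.Integer using (ℤ; +_; +[1+_]; -[1+_]; _+_; _*_; _-_; -_; ∣_∣; _≤_; +≤+)
  import Data.Integer.Properties as ℤₚ
  import Data.Integer.Divisibility as Unsigned
  open import Data.Integer.Divisibility.Signed using (_∣_; divides; ∣⇒∣ᵤ)
  open import Data.Integer.Tactic.RingSolver using (solve-∀)
  import Data.Nat.Tactic.RingSolver as ℕSolver
  open import Data.List using (List; downFrom; cartesianProduct; filter; length)
  open import Data.List.Membership.Propositional using (_∈_)
  open import Data.List.Membership.Propositional.Properties using (∈-filter⁺; ∈-filter⁻; ∈-cartesianProduct⁺; ∈-downFrom⁺)
  open import Data.List.Relation.Unary.Unique.Propositional using (Unique)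
  import Data.List.Relation.Unary.Unique.Propositional.Properties as Unique
  open import Data.Nat as ℕ using (ℕ; zero; suc; s≤s; z≤n; _%_)
  import Data.Nat.DivMod as ℕ
  import Data.Nat.Properties as ℕₚ
  open import Data.Nat.Primality using (Prime)
  open import Data.Product using (∃; ∃₂; _,_; _×_; proj₁; proj₂)
  open import Data.Sum using (_⊎_; inj₁; inj₂)
  open import Function using (_∘_)
  open import Relation.Nullary using (¬_; Dec; yes; no)
  open import Relation.Nullary.Decidable using (⌊_⌋; _×-dec_)
  open import Relation.Binary.PropositionalEquality hiding (J)

  σ : ℕ → ℤ
  σ zero    = + 1
  σ (suc j) = - σ j

  -- (-1)^j (2j+1), the representative of ±(2j+1) that is ≡ 1 (mod 4)
  oddRep : ℕ → ℤ
  oddRep j = σ j * + suc (j ℕ.+ j)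

  ∣σ∣ : ∀ j → ∣ σ j ∣ ≡ 1
  ∣σ∣ zero    = refl
  ∣σ∣ (suc j) = trans (ℤₚ.∣-i∣≡∣i∣ (σ j)) (∣σ∣ j)

  ∣oddRep∣ : ∀ j → ∣ oddRep j ∣ ≡ suc (j ℕ.+ j)
  ∣oddRep∣ j = trans (ℤₚ.abs-* (σ j) (+ suc (j ℕ.+ j))) (trans (cong (ℕ._* suc (j ℕ.+ j)) (∣σ∣ j)) (ℕₚ.*-identityˡ _))

  double-injective : ∀ {i j} → i ℕ.+ i ≡ j ℕ.+ j → i ≡ j
  double-injective {i} {j} e = ℕₚ.*-cancelˡ-≡ i j 2 (trans (eq i) (trans e (sym (eq j))))
    where
    eq : ∀ i → 2 ℕ.* i ≡ i ℕ.+ i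
    eq = ℕSolver.solve-∀

  oddRep-injective : ∀ {i j} → oddRep i ≡ oddRep j → i ≡ j
  oddRep-injective {i} {j} e = double-injective (ℕₚ.suc-injective (trans (sym (∣oddRep∣ i)) (trans (cong ∣_∣ e) (∣oddRep∣ j))))

  oddRep-step : ∀ j → oddRep (suc (suc j)) ≡ oddRep j + + 4 * σ j
  oddRep-step j = trans (cong₂ (λ s n → s * + suc (suc (suc n))) (ℤₚ.neg-involutive (σ j)) (trans
      (ℕₚ.+-suc j (suc j)) (cong suc (ℕₚ.+-suc j j)))) (eq (σ j) (+ suc (j ℕ.+ j)))
    where
    eq : ∀ s n → s * (+ 4 + n) ≡ s * n + + 4 * s
    eq = solve-∀

  oddRep≡1 : ∀ j → ∃ λ i → oddRep j ≡ + 4 * i + + 1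
  oddRep≡1 0 = + 0 , refl
  oddRep≡1 1 = - + 1 , refl
  oddRep≡1 (suc (suc j)) = let (i , e) = oddRep≡1 j in i + σ j , trans (oddRep-step j) (trans (cong (_+ + 4 * σ j) e)
      (eq i (σ j)))
    where
    eq : ∀ i s → + 4 * i + + 1 + + 4 * s ≡ + 4 * (i + s) + + 1
    eq = solve-∀

  -- Even j = 2n gives 4n+1 and odd j = 2n+1 gives -(4n+3). The sign is part of the induction
  -- because each double step adds 4`σ j`.
  oddRep-surjective : ∀ i → ∃ λ j → oddRep j ≡ + 4 * i + + 1
  oddRep-surjective (+ n) = let (j , _ , e) = go n in j , e
    where
    go : ∀ n → ∃ λ j → σ j ≡ + 1 × oddRep j ≡ + 4 * + n + + 1
    go zero    = 0 , refl , refl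
    go (suc n) = let (j , s , e) = go n in suc (suc j) , trans (ℤₚ.neg-involutive (σ j)) s ,
      trans (oddRep-step j) (trans (cong₂ (λ a b → a + + 4 * b) e s) (eq (+ n)))
      where
      eq : ∀ n → + 4 * n + + 1 + + 4 * + 1 ≡ + 4 * (+ 1 + n) + + 1
      eq = solve-∀
  oddRep-surjective -[1+ n ] = let (j , _ , e) = go n in j , e
    where
    go : ∀ n → ∃ λ j → σ j ≡ - + 1 × oddRep j ≡ + 4 * - (+ 1 + + n) + + 1
    go zero    = 1 , refl , refl
    go (suc n) = let (j , s , e) = go n in suc (suc j) , trans (ℤₚ.neg-involutive (σ j)) s ,
      trans (oddRep-step j) (trans (cong₂ (λ a b → a + + 4 * b) e s) (eq (+ n)))
      where
      eq : ∀ n → + 4 * - (+ 1 + n) + + 1 + + 4 * - + 1 ≡ + 4 * - (+ 1 + (+ 1 + n)) + + 1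
      eq = solve-∀

  oddRep² : ∀ j → oddRep j * oddRep j ≡ + 8 * + tri j + + 1
  oddRep² j = trans (abs-square (oddRep j)) (trans (cong (λ n → + (n ℕ.* n)) (∣oddRep∣ j)) (trans (cong +_ (odd-square j))
    (trans (cong (λ k → + 1 + k) (ℤₚ.pos-* (tri j) 8)) (eq (+ tri j)))))
    where
    eq : ∀ t → + 1 + t * + 8 ≡ + 8 * t + + 1
    eq = solve-∀

  ±oddRep : ∀ j → (oddRep j ≡ + suc (j ℕ.+ j)) ⊎ (oddRep j ≡ - + suc (j ℕ.+ j))
  ±oddRep j = go (oddRep j) (∣oddRep∣ j)
    where
    go : ∀ a {n} → ∣ a ∣ ≡ suc n → (a ≡ + suc n) ⊎ (a ≡ - + suc n)
    go (+ n)    e = inj₁ (cong +_ e)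
    go -[1+ n ] e = inj₂ (cong (λ m → - + m) e)

  -- Since 2j+1 is odd, lying strictly below 2y = 2r+2 is the same as being at most 2r+1.
  oddRep-bounds : ∀ {r j} → j ℕ.≤ r → let b = oddRep j ; y = + suc r in (+ 0 ≤ + 2 * y + b - + 1) × (+ 0 ≤ + 2 * y - b - + 1)
  oddRep-bounds {r} {j} j≤r with ±oddRep j | ℤₚ.i≤j⇒0≤j-i (+≤+ j≤r)
  ... | inj₁ e | 0≤r-j rewrite e = subst (+ 0 ≤_) (eq (+ r) (+ j)) (0≤-+ (0≤-* (0≤+ {2}) 0≤r-j)
      (0≤-+ (0≤-* (0≤+ {4}) (0≤+ {j})) (0≤+ {2}))) , subst (+ 0 ≤_) (eq′ (+ r) (+ j)) (0≤-* (0≤+ {2}) 0≤r-j)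
    where
    eq : ∀ r j → + 2 * (r - j) + (+ 4 * j + + 2) ≡ + 2 * (+ 1 + r) + (+ 1 + (j + j)) - + 1
    eq = solve-∀
    eq′ : ∀ r j → + 2 * (r - j) ≡ + 2 * (+ 1 + r) - (+ 1 + (j + j)) - + 1
    eq′ = solve-∀
  ... | inj₂ e | 0≤r-j rewrite e = subst (+ 0 ≤_) (eq′ (+ r) (+ j)) (0≤-* (0≤+ {2}) 0≤r-j) , subst (+ 0 ≤_) (eq (+ r)
      (+ j)) (0≤-+ (0≤-* (0≤+ {2}) 0≤r-j) (0≤-+ (0≤-* (0≤+ {4}) (0≤+ {j})) (0≤+ {2})))
    where
    eq : ∀ r j → + 2 * (r - j) + (+ 4 * j + + 2) ≡ + 2 * (+ 1 + r) - (- (+ 1 + (j + j))) - + 1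
    eq = solve-∀
    eq′ : ∀ r j → + 2 * (r - j) ≡ + 2 * (+ 1 + r) + - (+ 1 + (j + j)) - + 1
    eq′ = solve-∀

  oddRep-bounded : ∀ {r j} → let b = oddRep j ; y = + suc r in + 0 ≤ + 2 * y + b - + 1 → + 0 ≤ + 2 * y - b - + 1 → j ℕ.≤ r
  oddRep-bounded {r} {j} l u = ℤₚ.drop‿+≤+ (ℤₚ.0≤i-j⇒j≤i (0≤-cancel (+ 2) (0≤+ {1}) (bound (±oddRep j))))
    where
    bound : (oddRep j ≡ + suc (j ℕ.+ j)) ⊎ (oddRep j ≡ - + suc (j ℕ.+ j)) → + 0 ≤ + 2 * (+ r - + j)
    bound (inj₁ e) = subst (+ 0 ≤_) (trans (cong (λ b → + 2 * + suc r - b - + 1) e) (eq (+ r) (+ j))) u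
      where
      eq : ∀ r j → + 2 * (+ 1 + r) - (+ 1 + (j + j)) - + 1 ≡ + 2 * (r - j)
      eq = solve-∀
    bound (inj₂ e) = subst (+ 0 ≤_) (trans (cong (λ b → + 2 * + suc r + b - + 1) e) (eq (+ r) (+ j))) l
      where
      eq : ∀ r j → + 2 * (+ 1 + r) + - (+ 1 + (j + j)) - + 1 ≡ + 2 * (r - j)
      eq = solve-∀

  indicator-cong : ∀ {A B : Set} (a? : Dec A) (b? : Dec B) → (A → B) → (B → A) →
    (if ⌊ a? ⌋ then + 1 else + 0) ≡ (if ⌊ b? ⌋ then + 1 else + 0)
  indicator-cong (yes _) (yes _) _ _ = refl
  indicator-cong (no _)  (no _)  _ _ = refl
  indicator-cong (yes a) (no ¬b) f _ = ⊥-elim (¬b (f a))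
  indicator-cong (no ¬a) (yes b) _ g = ⊥-elim (¬a (g b))

  module Parity (N p : ℕ) (p-prime : Prime p) (p±3 : ±3mod8 p) (M s c : ℤ)
    (pM≡ : + p * M ≡ + (7 ℕ.+ 8 ℕ.* N)) (M≡s² : M ≡ s * s + + p * c) (p∤M : ¬ + p ∣ M) where

    D : ℕ
    D = 6 ℕ.+ 8 ℕ.* N

    D≡ : + suc D ≡ + 8 * + N + + 7
    D≡ = trans (cong (λ k → + 7 + k) (ℤₚ.pos-* 8 N)) (ℤₚ.+-comm (+ 7) (+ 8 * + N))

    open AtkinLehner p p-prime p±3 D M s c pM≡ M≡s² p∤M (+ N , D≡)
    open Coefficient N using (Hit; hit?; indicator; v-mod-4)

    -- With y = r+1 and b = ±(2j+1), the equation `yz≡` is 8yz - b² = 8N+7 divided by 8.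
    record Point (r j z : ℕ) : Set where
      constructor point
      field
        j≤r : j ℕ.≤ r
        y<z : suc r ℕ.< z
        yz≡ : suc r ℕ.* z ≡ suc N ℕ.+ tri j

    pointForm : ℕ → ℕ → ℕ → Form
    pointForm r j z = form (+ suc r) (+ z) (oddRep j)

    point-reduced : ∀ {r j z} → Point r j z → Reduced (pointForm r j z)
    point-reduced {r} {j} {z} (point j≤r y<z _) =
      let (l , u) = oddRep-bounds j≤r
      in reduced 0≤+ l u (subst (+ 0 ≤_) (eq (+ z) (+ suc r)) (ℤₚ.i≤j⇒0≤j-i (+≤+ y<z)))
      where
      eq : ∀ z y → z - (+ 1 + y) ≡ z - y - + 1
      eq = solve-∀

    disc-oddRep : ∀ y z j → disc (form y z (oddRep j)) ≡ + 8 * (y * z - + tri j) - + 1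
    disc-oddRep y z j = trans (cong (λ k → + 8 * (y * z) - k) (oddRep² j)) (eq y z (+ tri j))
      where
      eq : ∀ y z t → + 8 * (y * z) - (+ 8 * t + + 1) ≡ + 8 * (y * z - t) - + 1
      eq = solve-∀

    point-admissible : ∀ {r j z} → Point r j z → Admissible D (pointForm r j z)
    point-admissible {r} {j} {z} (point _ _ yz≡) = admissible 0≤+
      (trans (disc-oddRep (+ suc r) (+ z) j) (trans (cong (λ k → + 8 * (k - + tri j) - + 1) (trans
          (sym (ℤₚ.pos-* (suc r) z)) (cong +_ yz≡))) (trans (eq (+ N) (+ tri j)) (sym D≡))))
      (oddRep≡1 j)
      where
      eq : ∀ N t → + 8 * ((+ 1 + N) + t - t) - + 1 ≡ + 8 * N + + 7
      eq = solve-∀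

    disc⇒yz : ∀ y z n t → + 8 * (+ y * + z - + t) - + 1 ≡ + 8 * + n + + 7 → y ℕ.* z ≡ suc n ℕ.+ t
    disc⇒yz y z n t e = ℤₚ.+-injective (trans (ℤₚ.pos-* y z) (ℤₚ.*-cancelˡ-≡ (+ 8) (+ y * + z) (+ 1 + + n + + t)
      (trans (eq₁ (+ y * + z) (+ t)) (trans (cong (λ k → k + + 8 * + t + + 1) e) (eq₂ (+ n) (+ t))))))
      where
      eq₁ : ∀ a t → + 8 * a ≡ + 8 * (a - t) - + 1 + + 8 * t + + 1
      eq₁ = solve-∀
      eq₂ : ∀ n t → + 8 * n + + 7 + + 8 * t + + 1 ≡ + 8 * (+ 1 + n + t)
      eq₂ = solve-∀

    Recognised : Form → Set
    Recognised t = ∃ λ r → ∃₂ λ j z → Point r j z × pointForm r j z ≡ t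

    recognise-oddRep : ∀ r z j → let t = form (+ suc r) (+ z) (oddRep j) in Reduced t → Admissible D t → Recognised t
    recognise-oddRep r z j (reduced _ l u y<z) a = r , j , z ,
      point (oddRep-bounded {r} {j} l u) (ℤₚ.drop‿+≤+ (ℤₚ.0≤i-j⇒j≤i (subst (+ 0 ≤_) (eq (+ z) (+ suc r)) y<z)))
        (disc⇒yz (suc r) z N (tri j) (trans (sym (disc-oddRep (+ suc r) (+ z) j)) (trans (Admissible.disc≡ a) D≡))) , refl
      where
      eq : ∀ z y → z - y - + 1 ≡ z - (+ 1 + y)
      eq = solve-∀

    recognise-b : ∀ y z b → + 0 ≤ y - + 1 → + 0 ≤ z - + 1 → (∃ λ j → oddRep j ≡ b) →
      Reduced (form y z b) → Admissible D (form y z b) → Recognised (form y z b)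
    recognise-b +[1+ r ] +[1+ z ] _ _ _ (j , refl) red a = recognise-oddRep r (suc z) j red a

    recognise : ∀ t → Reduced t → Admissible D t → Recognised t
    recognise (form y z b) red a = recognise-b y z b (Reduced.0<y red) (z-positive a) (representative (Admissible.b≡1 a)) red a
      where
      representative : (∃ λ i → b ≡ + 4 * i + + 1) → ∃ λ j → oddRep j ≡ b
      representative (i , e) = let (j , e′) = oddRep-surjective i in j , trans e′ (sym e)

    -- Writing z = y + 1 + k with y = r+1 gives yz - 1 - `tri j` = `E r j` + y + ky, so k is the
    -- exponent taken from the geometric series 1/(1 - q^y).
    point⇒hit : ∀ {r j z} → Point r j z → Hit r j
    point⇒hit {r} {j} {z} (point j≤r y<z yz≡) =
      subst (E r j ℕ.+ suc r ℕ.≤_) (sym N≡) (ℕₚ.m≤m+n _ _) ,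
      trans (cong (_% suc r) (trans (cong (ℕ._∸ (E r j ℕ.+ suc r)) N≡) (ℕₚ.m+n∸m≡n (E r j ℕ.+ suc r) _))) (ℕ.m*n%n≡0 k (suc r))
      where
      k = z ℕ.∸ suc (suc r)
      z≡ : z ≡ suc (suc r) ℕ.+ k
      z≡ = sym (ℕₚ.m+[n∸m]≡n y<z)
      N≡ : N ≡ E r j ℕ.+ suc r ℕ.+ k ℕ.* suc r
      N≡ = ℕₚ.+-cancelʳ-≡ (tri j) N _ (ℕₚ.suc-injective (trans (sym yz≡) (trans (cong (suc r ℕ.*_) z≡) (trans (eq₁ r k)
        (trans (cong (λ e → suc (e ℕ.+ suc r ℕ.+ k ℕ.* suc r)) (sym (E-tri j≤r))) (eq₂ (E r j) (tri j) (suc r) (k ℕ.* suc r)))))))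
        where
        eq₁ : ∀ r k → suc r ℕ.* (suc (suc r) ℕ.+ k) ≡ suc (r ℕ.* (2 ℕ.+ r) ℕ.+ suc r ℕ.+ k ℕ.* suc r)
        eq₁ = ℕSolver.solve-∀
        eq₂ : ∀ e t y k → suc (e ℕ.+ t ℕ.+ y ℕ.+ k) ≡ suc (e ℕ.+ y ℕ.+ k ℕ.+ t)
        eq₂ = ℕSolver.solve-∀

    hit⇒point : ∀ {r j} → j ℕ.≤ r → Hit r j → ∃ λ z → Point r j z
    hit⇒point {r} {j} j≤r (e≤N , divisible) = suc (suc r) ℕ.+ k , point j≤r (ℕₚ.m≤m+n _ k) yz≡
      where
      k = (N ℕ.∸ (E r j ℕ.+ suc r)) ℕ./ suc r
      N≡ : N ≡ E r j ℕ.+ suc r ℕ.+ k ℕ.* suc r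
      N≡ = trans (sym (ℕₚ.m+[n∸m]≡n e≤N)) (cong (λ m → E r j ℕ.+ suc r ℕ.+ m) (trans
          (ℕ.m≡m%n+[m/n]*n (N ℕ.∸ (E r j ℕ.+ suc r)) (suc r)) (cong (ℕ._+ k ℕ.* suc r) divisible)))
      yz≡ : suc r ℕ.* (suc (suc r) ℕ.+ k) ≡ suc N ℕ.+ tri j
      yz≡ = trans (eq₁ r k) (trans (cong (λ e → suc (e ℕ.+ suc r ℕ.+ k ℕ.* suc r)) (sym (E-tri j≤r))) (trans
          (eq₂ (E r j) (tri j) (suc r) (k ℕ.* suc r)) (cong (λ N → suc N ℕ.+ tri j) (sym N≡))))
        where
        eq₁ : ∀ r k → suc r ℕ.* (suc (suc r) ℕ.+ k) ≡ suc (r ℕ.* (2 ℕ.+ r) ℕ.+ suc r ℕ.+ k ℕ.* suc r)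
        eq₁ = ℕSolver.solve-∀
        eq₂ : ∀ e t y k → suc (e ℕ.+ t ℕ.+ y ℕ.+ k) ≡ suc (e ℕ.+ y ℕ.+ k) ℕ.+ t
        eq₂ = ℕSolver.solve-∀

    -- Equality would produce a form with y = z.
    E≢N : ∀ r j → j ℕ.≤ r → E r j ≢ N
    E≢N r j j≤r e = off-diagonal (+ suc r) (oddRep j) (trans (disc-oddRep (+ suc r) (+ suc r) j)
      (trans (cong (λ k → + 8 * (k - + tri j) - + 1) (trans (sym (ℤₚ.pos-* (suc r) (suc r))) (cong +_ y²≡))) (trans
          (eq (+ N) (+ tri j)) (sym D≡))))
      where
      eq : ∀ N t → + 8 * ((+ 1 + N) + t - t) - + 1 ≡ + 8 * N + + 7
      eq = solve-∀
      eq₁ : ∀ r → suc r ℕ.* suc r ≡ suc (r ℕ.* (2 ℕ.+ r))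
      eq₁ = ℕSolver.solve-∀
      y²≡ : suc r ℕ.* suc r ≡ suc N ℕ.+ tri j
      y²≡ = trans (eq₁ r) (cong suc (trans (sym (E-tri j≤r)) (cong (ℕ._+ tri j) e)))

    -- The involution on classes, as a relation: u is any representative of the required shape.
    Linked : Form → Form → Set
    Linked t t′ = ∃ λ u → Admissible D (ι u) × t ~ ι u × ι (swap u) ~ t′

    ι-swap-admissible : ∀ u → Admissible D (ι u) → Admissible D (ι (swap u))
    ι-swap-admissible (form y z b) a = admissible
      (subst (+ 0 ≤_) (eq₁ P z) (0≤-+ (0≤-+ (0≤-* 0<P z>0) 0<P) z>0))
      (trans (eq₂ P y z b) (Admissible.disc≡ a)) (Admissible.b≡1 a)
      where
      z>0 : + 0 ≤ z - + 1
      z>0 = z-positive a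
      0<P : + 0 ≤ P - + 1
      0<P = ℤₚ.i≤j⇒0≤j-i (+≤+ (ℕₚ.≤-trans (s≤s z≤n) (±3-≥3 p±3)))
      eq₁ : ∀ P z → (P - + 1) * (z - + 1) + (P - + 1) + (z - + 1) ≡ P * z - + 1
      eq₁ = solve-∀
      eq₂ : ∀ P y z b → + 8 * (P * z * y) - P * b * (P * b) ≡ + 8 * (P * y * z) - P * b * (P * b)
      eq₂ = solve-∀

    swap-swap : ∀ x → swap (swap x) ≡ x
    swap-swap (form y z b) = refl

    linked-sym : ∀ {t t′} → Linked t t′ → Linked t′ t
    linked-sym {t} (u , a , t~u , u~t′) = swap u , ι-swap-admissible u a , ~-sym u~t′ , subst (λ x → ι x ~ t) (sym
        (swap-swap u)) (~-sym t~u)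

    -- Two choices of u give equivalent images by `involution`, and equivalent reduced forms are
    -- equal.
    linked-functional : ∀ {t t₁ t₂} → Reduced t₁ → Reduced t₂ → Linked t t₁ → Linked t t₂ → t₁ ≡ t₂
    linked-functional r₁ r₂ (u , a , t~u , u~t₁) (u′ , _ , t~u′ , u′~t₂) = reduced-unique r₁ r₂
      (~-trans (~-sym u~t₁) (~-trans (involution u u′ (Admissible.disc≡ a) (~-trans (~-sym t~u) t~u′)) u′~t₂))

    linked-irreflexive : ∀ {t} → ¬ Linked t t
    linked-irreflexive (u , a , t~u , u~t) = no-fixed-point u a (~-sym (~-trans u~t t~u))

    linked-total : ∀ t → Admissible D t → ∃ λ t′ → Reduced t′ × Admissible D t′ × Linked t t′
    linked-total t a =
      let (u , au , t~u) = to-ι t a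
          (t′ , r′ , a′ , u~t′) = reduce (ι (swap u)) (ι-swap-admissible u au)
      in t′ , r′ , a′ , u , au , t~u , u~t′

    -- Only r and j are kept, as in the double sum to be counted; z is determined by them.
    Partners : ℕ × ℕ → ℕ × ℕ → Set
    Partners (r , j) (r′ , j′) = ∃₂ λ z z′ → Point r j z × Point r′ j′ z′ × Linked (pointForm r j z) (pointForm r′ j′ z′)

    z-unique : ∀ {r j z z′} → Point r j z → Point r j z′ → z ≡ z′
    z-unique {r} {_} {z} {z′} a b = ℕₚ.*-cancelˡ-≡ z z′ (suc r) (trans (Point.yz≡ a) (sym (Point.yz≡ b)))

    partners-sym : ∀ {x y} → Partners x y → Partners y x
    partners-sym (z , z′ , a , a′ , l) = z′ , z , a′ , a , linked-sym l

    partners-functional : ∀ {x y₁ y₂} → Partners x y₁ → Partners x y₂ → y₁ ≡ y₂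
    partners-functional {r , j} {r₁ , j₁} {r₂ , j₂} (z , z₁ , a , a₁ , l₁) (z′ , z₂ , a′ , a₂ , l₂) with refl ← z-unique a a′ =
      cong₂ _,_ (ℕₚ.suc-injective (ℤₚ.+-injective (cong Form.y e))) (oddRep-injective (cong Form.b e))
      where
      e : pointForm r₁ j₁ z₁ ≡ pointForm r₂ j₂ z₂
      e = linked-functional (point-reduced a₁) (point-reduced a₂) l₁ l₂

    partners-irreflexive : ∀ {x} → ¬ Partners x x
    partners-irreflexive (z , z′ , a , a′ , l) with refl ← z-unique a a′ = linked-irreflexive l

    Listed : ℕ × ℕ → Set
    Listed (r , j) = j ℕ.≤ r × Hit r j

    listed? : ∀ x → Dec (Listed x)
    listed? (r , j) = (j ℕ.≤? r) ×-dec hit? r j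

    box points : List (ℕ × ℕ)
    -- A hit has r + 1 ≤ N, and j ≤ r, so this square contains every listed pair.
    box = cartesianProduct (downFrom (suc N)) (downFrom (suc N))
    points = filter listed? box

    listed⇒∈ : ∀ {r j} → Listed (r , j) → (r , j) ∈ points
    listed⇒∈ {r} {j} l@(j≤r , (e≤N , _)) = ∈-filter⁺ listed? (∈-cartesianProduct⁺ (∈-downFrom⁺ r<)
        (∈-downFrom⁺ (ℕₚ.≤-<-trans j≤r r<))) l
      where
      r< : r ℕ.< suc N
      r< = ℕₚ.m≤n⇒m≤1+n (ℕₚ.≤-trans (ℕₚ.m≤n+m (suc r) (E r j)) e≤N)

    partner : ∀ {x} → x ∈ points → ∃ λ y → y ∈ points × Partners x y
    partner {r , j} x∈ =
      let (_ , (j≤r , hit)) = ∈-filter⁻ listed? {xs = box} x∈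
          (z , a) = hit⇒point j≤r hit
          (t , red , adm , l) = linked-total (pointForm r j z) (point-admissible a)
          (r′ , j′ , z′ , a′ , t≡) = recognise t red adm
      in (r′ , j′) , listed⇒∈ (Point.j≤r a′ , point⇒hit a′) , z , z′ , a , a′ , subst (Linked (pointForm r j z)) (sym t≡) l

    open Pairing Partners partners-sym partners-functional partners-irreflexive

    even : ∃ λ h → length points ≡ h ℕ.+ h
    even = even-length points (Unique.filter⁺ listed? (Unique.cartesianProduct⁺ (Unique.downFrom⁺ (suc N))
        (Unique.downFrom⁺ (suc N)))) partner

    -- The list runs over a square and the sum over the triangle j ≤ r; `Listed` includes j ≤ r, so
    -- the terms outside the triangle are zero.
    count : + length points ≡ sumTo N (λ r → sumTo r (indicator r))
    count = trans (length-filter-product listed? N N) (sumTo-cong N λ r r≤N →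
      trans (sumTo-truncate N (λ j → if ⌊ listed? (r , j) ⌋ then + 1 else + 0) r≤N (λ j r<j → outside r j
          (ℕₚ.<⇒≱ r<j))) (sumTo-cong r (inside r)))
      where
      outside : ∀ r j → ¬ j ℕ.≤ r → (if ⌊ listed? (r , j) ⌋ then + 1 else + 0) ≡ + 0
      outside r j j≰r = indicator-cong (listed? (r , j)) (no (λ ())) (j≰r ∘ proj₁) ⊥-elim
      inside : ∀ r j → j ℕ.≤ r → (if ⌊ listed? (r , j) ⌋ then + 1 else + 0) ≡ indicator r j
      inside r j j≤r = indicator-cong (listed? (r , j)) (hit? r j) proj₂ (j≤r ,_)

    4∣v : + 4 Unsigned.∣ vℕ N
    4∣v = conclude (v-mod-4 E≢N) count even
      where
      eq : ∀ h k → + 2 * (h + h) + + 4 * k ≡ (h + k) * + 4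
      eq = solve-∀
      conclude : ∀ {a S n} → a ≡₄ + 2 * S → + n ≡ S → (∃ λ h → n ≡ h ℕ.+ h) → + 4 Unsigned.∣ a
      conclude (k , refl) refl (h , refl) = ∣⇒∣ᵤ (divides (+ h + k) (eq (+ h) k))

-- The arithmetic progression of the theorem

open import Defs
open Residues
open Points
open import Data.Bool using (Bool; true; T)
open import Data.Bool.ListAction using (any)
open import Data.Empty using (⊥-elim)
open import Data.Integer as ℤ using (ℤ; +_; -[1+_]; ∣_∣)
import Data.Integer.Properties as ℤₚ
open import Data.Integer.DivMod using (_%ℕ_; _/ℕ_; n%ℕd<d; a≡a%ℕn+[a/ℕn]*n)
open import Data.Integer.Divisibility using (_∣_)
import Data.Integer.Divisibility.Signed as Signed
open import Data.Integer.Tactic.RingSolver using (solve-∀)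
open import Data.List using (upTo)
open import Data.List.Relation.Unary.Any using (satisfied)
open import Data.List.Relation.Unary.Any.Properties using (any⁻)
open import Data.Nat as ℕ using (ℕ; zero; suc; s≤s; _%_)
import Data.Nat.DivMod as ℕ
import Data.Nat.Divisibility as ℕ
import Data.Nat.Properties as ℕₚ
open import Data.Nat.Primality using (Prime)
open import Data.Product using (∃₂; _,_; _×_)
open import Relation.Nullary using (¬_)
open import Relation.Nullary.Decidable using (⌊_⌋; toWitness)
open import Relation.Binary.PropositionalEquality

odd⇒±3mod8 : ∀ p → p % 2 ≡ 1 → p % 8 ≢ 1 → p % 8 ≢ 7 → ±3mod8 p
odd⇒±3mod8 p odd ≢1 ≢7 = go (p % 8) refl (ℕ.m%n<n p 8) (trans (%8-%2 p) odd)
  where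
  go : ∀ r → p % 8 ≡ r → r ℕ.< 8 → p % 8 % 2 ≡ 1 → ±3mod8 p
  go 1 e _ _ = ⊥-elim (≢1 e)
  go 3 e _ _ = ≡3 e
  go 5 e _ _ = ≡5 e
  go 7 e _ _ = ⊥-elim (≢7 e)
  go 0 e _ h with () ← trans (sym h) (cong (_% 2) e)
  go 2 e _ h with () ← trans (sym h) (cong (_% 2) e)
  go 4 e _ h with () ← trans (sym h) (cong (_% 2) e)
  go 6 e _ h with () ← trans (sym h) (cong (_% 2) e)
  go (suc (suc (suc (suc (suc (suc (suc (suc _)))))))) _ (s≤s (s≤s (s≤s (s≤s (s≤s (s≤s (s≤s (s≤s ())))))))) _

legendre-square : ∀ k p′ → legendre k (suc p′) ≡ + 1 → ∃₂ λ x r → k %ℕ suc p′ ≡ suc r × (x ℕ.* x) % suc p′ ≡ suc r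
legendre-square k p′ e with k %ℕ suc p′
legendre-square k p′ () | zero
... | suc r with any (λ x → ⌊ (x ℕ.* x) % suc p′ ℕₚ.≟ suc r ⌋) (upTo (suc p′)) in found
... | true with satisfied (any⁻ (λ x → ⌊ (x ℕ.* x) % suc p′ ℕₚ.≟ suc r ⌋) (upTo (suc p′)) (subst T (sym found) _))
... | x , h = x , r , refl , toWitness h

-- The x found by the search serves as s. The remainder of k is `suc r`, nonzero and below p, so p
-- does not divide k.
residue : ∀ k p → legendre k p ≡ + 1 → ∃₂ λ s c → k ≡ s ℤ.* s ℤ.+ + p ℤ.* c × ¬ + p Signed.∣ k
residue k zero    ()
residue k p@(suc p′) e with legendre-square k p′ e
... | x , r , k% , x²% = + x , k /ℕ p ℤ.- + b , k≡ , p∤k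
  where
  b = (x ℕ.* x) ℕ./ p
  k-division : k ≡ + suc r ℤ.+ (k /ℕ p) ℤ.* + p
  k-division = trans (a≡a%ℕn+[a/ℕn]*n k p) (cong (λ m → + m ℤ.+ (k /ℕ p) ℤ.* + p) k%)
  x-division : + x ℤ.* + x ≡ + suc r ℤ.+ + b ℤ.* + p
  x-division = trans (sym (ℤₚ.pos-* x x)) (trans (cong +_ (trans (ℕ.m≡m%n+[m/n]*n (x ℕ.* x) p) (cong
      (ℕ._+ b ℕ.* p) x²%))) (cong (λ m → + suc r ℤ.+ m) (ℤₚ.pos-* b p)))
  k≡ : k ≡ + x ℤ.* + x ℤ.+ + p ℤ.* (k /ℕ p ℤ.- + b)
  k≡ = trans k-division (trans (eq (+ suc r) (k /ℕ p) (+ b) (+ p)) (cong (λ a → a ℤ.+ + p ℤ.* (k /ℕ p ℤ.- + b)) (sym x-division)))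
    where
    eq : ∀ r a b p → r ℤ.+ a ℤ.* p ≡ r ℤ.+ b ℤ.* p ℤ.+ p ℤ.* (a ℤ.- b)
    eq = solve-∀
  p∤k : ¬ + p Signed.∣ k
  p∤k h = ℕₚ.<⇒≱ (subst (ℕ._< p) k% (n%ℕd<d k p))
    (ℕ.∣⇒≤ (Signed.∣⇒∣ᵤ (Signed.∣m+n∣n⇒∣m {m = + suc r} (subst (+ p Signed.∣_) k-division h) (Signed.divides (k /ℕ p) refl))))

theorem4p1 : (p : ℕ) → Prime p → p % 2 ≡ 1 → p % 8 ≢ 1 → p % 8 ≢ 7 →
    (δ : ℤ) → (+ (p ℕ.* p)) ∣ (+ 8 ℤ.* δ ℤ.- + 1) →
    (k n : ℤ) → legendre k p ≡ + 1 →
    + 4 ∣ v (+ (p ℕ.* p) ℤ.* n ℤ.+ (+ p ℤ.* k ℤ.- + 7) ℤ.* δ)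
theorem4p1 p p-prime odd ≢1 ≢7 δ p²∣ k n e = cases _ refl
  where
  cases : ∀ A → A ≡ + (p ℕ.* p) ℤ.* n ℤ.+ (+ p ℤ.* k ℤ.- + 7) ℤ.* δ → + 4 ∣ v A
  -- At negative arguments v is 0 by convention.
  cases -[1+ _ ] _  = ℕ.divides 0 refl
  cases (+ N)    A≡ with residue k p e | Signed.∣ᵤ⇒∣ {+ (p ℕ.* p)} {+ 8 ℤ.* δ ℤ.- + 1} p²∣
  ... | s , c , k≡ , p∤k | Signed.divides q 8δ≡ = Parity.4∣v N p p-prime (odd⇒±3mod8 p odd ≢1 ≢7) M s (c ℤ.+ m) pM≡ M≡ p∤M
    where
    P = + p
    -- With 8δ = 1 + qp² one gets 8N + 7 = 8p²n + (pk - 7)(1 + qp²) + 7 = p(k + pm) for this m, so M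
    -- ≡ k modulo p.
    m = + 8 ℤ.* n ℤ.+ q ℤ.* (P ℤ.* k ℤ.- + 7)
    M = k ℤ.+ P ℤ.* m
    M≡ : M ≡ s ℤ.* s ℤ.+ P ℤ.* (c ℤ.+ m)
    M≡ = trans (cong (λ k → k ℤ.+ P ℤ.* m) k≡) (eq s P c m)
      where
      eq : ∀ s P c m → s ℤ.* s ℤ.+ P ℤ.* c ℤ.+ P ℤ.* m ≡ s ℤ.* s ℤ.+ P ℤ.* (c ℤ.+ m)
      eq = solve-∀
    p∤M : ¬ P Signed.∣ M
    p∤M h = p∤k (Signed.∣m+n∣n⇒∣m h (Signed.∣m⇒∣m*n m (Signed.∣-refl)))
    pM≡ : P ℤ.* M ≡ + (7 ℕ.+ 8 ℕ.* N)
    pM≡ = sym (begin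
      + (7 ℕ.+ 8 ℕ.* N)      ≡⟨ cong (λ a → + 7 ℤ.+ a) (trans (ℤₚ.pos-* 8 N) (cong (λ a → + 8 ℤ.* a) A≡)) ⟩
      + 7 ℤ.+ + 8 ℤ.* (+ (p ℕ.* p) ℤ.* n ℤ.+ (P ℤ.* k ℤ.- + 7) ℤ.* δ)
        ≡⟨ eq₁ (+ (p ℕ.* p)) n (P ℤ.* k ℤ.- + 7) δ ⟩
      + 7 ℤ.+ + 8 ℤ.* (+ (p ℕ.* p)) ℤ.* n ℤ.+ (P ℤ.* k ℤ.- + 7) ℤ.* (+ 1 ℤ.+ (+ 8 ℤ.* δ ℤ.- + 1))
        ≡⟨ cong (λ a → + 7 ℤ.+ + 8 ℤ.* (+ (p ℕ.* p)) ℤ.* n ℤ.+ (P ℤ.* k ℤ.- + 7) ℤ.* (+ 1 ℤ.+ a)) 8δ≡ ⟩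
      + 7 ℤ.+ + 8 ℤ.* (+ (p ℕ.* p)) ℤ.* n ℤ.+ (P ℤ.* k ℤ.- + 7) ℤ.* (+ 1 ℤ.+ q ℤ.* + (p ℕ.* p))
        ≡⟨ cong (λ a → + 7 ℤ.+ + 8 ℤ.* a ℤ.* n ℤ.+ (P ℤ.* k ℤ.- + 7) ℤ.* (+ 1 ℤ.+ q ℤ.* a)) (ℤₚ.pos-* p p) ⟩
      + 7 ℤ.+ + 8 ℤ.* (P ℤ.* P) ℤ.* n ℤ.+ (P ℤ.* k ℤ.- + 7) ℤ.* (+ 1 ℤ.+ q ℤ.* (P ℤ.* P))
        ≡⟨ eq₂ P n k q ⟩
      P ℤ.* M ∎)
      where
      open ≡-Reasoning
      eq₁ : ∀ Q n a δ → + 7 ℤ.+ + 8 ℤ.* (Q ℤ.* n ℤ.+ a ℤ.* δ) ≡ + 7 ℤ.+ + 8 ℤ.* Q ℤ.* n ℤ.+ a ℤ.* (+ 1 ℤ.+ (+ 8 ℤ.* δ ℤ.- + 1))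
      eq₁ = solve-∀
      eq₂ : ∀ P n k q → + 7 ℤ.+ + 8 ℤ.* (P ℤ.* P) ℤ.* n ℤ.+ (P ℤ.* k ℤ.- + 7) ℤ.* (+ 1 ℤ.+ q ℤ.* (P ℤ.* P))
        ≡ P ℤ.* (k ℤ.+ P ℤ.* (+ 8 ℤ.* n ℤ.+ q ℤ.* (P ℤ.* k ℤ.- + 7)))
      eq₂ = solve-∀
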